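{- Let $A$ be a cograph. Then $A$ is provable in $\mathsf{GS}\cup\{\mathsf{ss}{\uparrow}\}$ if and only if $A$ is provable in the system $\{\mathsf{ai}{\downarrow},\mathsf{sw}\}$.
   Context: Atoms: fix a countable set $\mathcal V$ of variables and a disjoint copy $\overline{\mathcal V}$; atoms are elements of $\mathcal V\cup\overline{\mathcal V}$, with $\overline{\overline a}=a$. A graph is a finite simple undirected graph with vertices labelled by atoms, identified up to label-preserving isomorphism; $\emptyset$ is the empty graph. A cograph is a graph with no induced subgraph that is a path on four vertices. $G\sqcup H$ is disjoint union; $G\otimes H$ is disjoint union plus all edges between $V_G$ and $V_H$. $\overline G$: same vertices, complementary edges, dual labels. A context is a graph $C$ with $R\subseteq V_C$; $C[M]_R$ is $C\sqcup M$ plus all edges between $V_M$ and $R$. A module of $G$ is an induced subgraph $M$ with every outside vertex adjacent to all or none of $M$; $P$ is prime if $|V_P|\ge2$ and its only modules are $\emptyset$, singletons and $P$. For $G$ with vertices $v_1,\dots,v_n$, $G\langle H_1,\dots,H_n\rangle$ replaces $v_i$ by $H_i$, keeps internal edges, joins $H_i$ to $H_j$ ($i\ne j$) iff $v_iv_j\in E_G$; $\overline G\langle\cdots\rangle$ uses the same vertex order. Rules (premise $\longrightarrow$ conclusion): $\mathsf{ai}{\downarrow}$: $\emptyset\longrightarrow\overline a\sqcup a$; $\mathsf{ss}{\downarrow}$: $B[A]_S\longrightarrow B\sqcup A$, $S\subseteq V_B$, $S\ne\emptyset$, $A\ne\emptyset$; $\mathsf{p}{\downarrow}$: $(M_1\sqcup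 N_1)\otimes\cdots\otimes(M_n\sqcup N_n)\longrightarrow\overline P\langle M_1,\dots,M_n\rangle\sqcup P\langle N_1,\dots,N_n\rangle$, $P$ prime, $n=|V_P|\ge4$, all $M_i\ne\emptyset$; $\mathsf{ss}{\uparrow}$: $B\otimes A\longrightarrow B[A]_S$, $S\subseteq V_B$, $S\ne V_B$, $A\ne\emptyset$; $\mathsf{sw}$ (switch): $(A\sqcup B)\otimes C\longrightarrow A\sqcup(B\otimes C)$ for arbitrary graphs $A,B,C$. $\mathsf{GS}=\{\mathsf{ai}{\downarrow},\mathsf{ss}{\downarrow},\mathsf{p}{\downarrow}\}$. A derivation in a system $\mathsf S$ is a finite sequence of graphs each step of which is a label-preserving isomorphism or replaces $C[X]_R$ by $C[Y]_R$ for a context and an instance $X\longrightarrow Y$ of a rule of $\mathsf S$; $A$ is provable in $\mathsf S$ if there is a derivation in $\mathsf S$ from $\emptyset$ to $A$. -}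

module Defs where

open import Data.Nat using (ℕ; zero; suc; _≤_)
open import Data.Bool using (Bool; true; false; not; if_then_else_)
open import Data.Fin using (Fin; _≟_)
open import Data.Empty using (⊥; ⊥-elim)
open import Data.Sum using (_⊎_; inj₁; inj₂)
open import Data.Product using (Σ; Σ-syntax; ∃; ∃-syntax; _×_; _,_; proj₁; proj₂)
open import Relation.Nullary using (¬_; Dec; yes; no)
open import Relation.Binary.PropositionalEquality using (_≡_; refl; sym; trans)
open import Relation.Binary.Construct.Closure.ReflexiveTransitive using (Star)
open import Function.Bundles using (_↔_; Inverse)

data Atom : Set where
  var  : ℕ → Atom
  dvar : ℕ → Atom

dual : Atom → Atom
dual (var x)  = dvar x
dual (dvar x) = var x

record LGraph (V : Set) : Set where
  field
    lab    : V → Atom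
    adj    : V → V → Bool
    adjSym : ∀ x y → adj x y ≡ adj y x
    adjIrr : ∀ x → adj x x ≡ false
open LGraph public

Graph : Set
Graph = Σ ℕ (λ n → LGraph (Fin n))

record _≅_ {V W : Set} (G : LGraph V) (H : LGraph W) : Set where
  field
    bij     : V ↔ W
    labPres : ∀ x → lab H (Inverse.to bij x) ≡ lab G x
    adjPres : ∀ x y → adj H (Inverse.to bij x) (Inverse.to bij y) ≡ adj G x y

emptyL : LGraph ⊥
emptyL = record { lab = λ () ; adj = λ () ; adjSym = λ () ; adjIrr = λ () }

∅G : Graph
∅G = 0 , record { lab = λ () ; adj = λ () ; adjSym = λ () ; adjIrr = λ () }

data One : Set where
  ⋆ : One

single : Atom → LGraph One
single a = record { lab = λ _ → a ; adj = λ _ _ → false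
                  ; adjSym = λ _ _ → refl ; adjIrr = λ _ → refl }

plug : {W VM : Set} → LGraph W → (W → Bool) → LGraph VM → LGraph (W ⊎ VM)
plug {W} {VM} C R M = record { lab = l ; adj = a ; adjSym = s ; adjIrr = i }
  where
  l : W ⊎ VM → Atom
  l (inj₁ x) = lab C x
  l (inj₂ y) = lab M y
  a : W ⊎ VM → W ⊎ VM → Bool
  a (inj₁ x) (inj₁ x') = adj C x x'
  a (inj₁ x) (inj₂ y)  = R x
  a (inj₂ y) (inj₁ x)  = R x
  a (inj₂ y) (inj₂ y') = adj M y y'
  s : ∀ u v → a u v ≡ a v u
  s (inj₁ x) (inj₁ x') = adjSym C x x'
  s (inj₁ x) (inj₂ y)  = refl
  s (inj₂ y) (inj₁ x)  = refl
  s (inj₂ y) (inj₂ y') = adjSym M y y'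
  i : ∀ u → a u u ≡ false
  i (inj₁ x) = adjIrr C x
  i (inj₂ y) = adjIrr M y

_⊔_ : {V W : Set} → LGraph V → LGraph W → LGraph (V ⊎ W)
G ⊔ H = plug G (λ _ → false) H

_⊗_ : {V W : Set} → LGraph V → LGraph W → LGraph (V ⊎ W)
G ⊗ H = plug G (λ _ → true) H

infixr 6 _⊔_
infixr 7 _⊗_

JV : (n : ℕ) → (Fin n → Set) → Set
JV zero    F = ⊥
JV (suc n) F = F Fin.zero ⊎ JV n (λ i → F (Fin.suc i))

bigJoin : (n : ℕ) (F : Fin n → Set) → ((i : Fin n) → LGraph (F i)) → LGraph (JV n F)
bigJoin zero    F G = emptyL
bigJoin (suc n) F G = G Fin.zero ⊗ bigJoin n (λ i → F (Fin.suc i)) (λ i → G (Fin.suc i))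

complement : {n : ℕ} → LGraph (Fin n) → LGraph (Fin n)
complement {n} P = record { lab = λ i → dual (lab P i) ; adj = a ; adjSym = s ; adjIrr = ir }
  where
  a' : (i j : Fin n) → Dec (i ≡ j) → Bool
  a' i j (yes _) = false
  a' i j (no _)  = not (adj P i j)
  a : Fin n → Fin n → Bool
  a i j = a' i j (i ≟ j)
  s : ∀ i j → a i j ≡ a j i
  s i j with i ≟ j | j ≟ i
  ... | yes _ | yes _ = refl
  ... | yes p | no q  = ⊥-elim (q (sym p))
  ... | no p  | yes q = ⊥-elim (p (sym q))
  ... | no _  | no _  rewrite adjSym P i j = refl
  ir : ∀ i → a i i ≡ false
  ir i with i ≟ i
  ... | yes _ = refl
  ... | no q  = ⊥-elim (q refl)

compose : {n : ℕ} → LGraph (Fin n) → (F : Fin n → Set) → ((i : Fin n) → LGraph (F i))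
        → LGraph (Σ (Fin n) F)
compose {n} P F H = record { lab = l ; adj = a ; adjSym = s ; adjIrr = ir }
  where
  l : Σ (Fin n) F → Atom
  l (i , x) = lab (H i) x
  a' : (i j : Fin n) → Dec (i ≡ j) → F i → F j → Bool
  a' i .i (yes refl) x y = adj (H i) x y
  a' i j  (no _)     x y = adj P i j
  a : Σ (Fin n) F → Σ (Fin n) F → Bool
  a (i , x) (j , y) = a' i j (i ≟ j) x y
  s : ∀ u v → a u v ≡ a v u
  s (i , x) (j , y) with i ≟ j | j ≟ i
  ... | yes refl | yes refl = adjSym (H i) x y
  ... | yes p    | no q     = ⊥-elim (q (sym p))
  ... | no p     | yes q    = ⊥-elim (p (sym q))
  ... | no _     | no _     = adjSym P i j
  ir : ∀ u → a u u ≡ false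
  ir (i , x) with i ≟ i
  ... | yes refl = adjIrr (H i) x
  ... | no q     = ⊥-elim (q refl)

-- A vertex subset S (the vertex set of an induced subgraph) is a module of G
IsModule : {V : Set} → LGraph V → (V → Bool) → Set
IsModule {V} G S = ∀ v → S v ≡ false →
  (∀ m → S m ≡ true → adj G v m ≡ true) ⊎ (∀ m → S m ≡ true → adj G v m ≡ false)

Prime : {n : ℕ} → LGraph (Fin n) → Set
Prime {n} P = 2 ≤ n × (∀ S → IsModule P S →
     (∀ v → S v ≡ false)
   ⊎ (Σ[ v ∈ Fin n ] (S v ≡ true × (∀ w → S w ≡ true → w ≡ v)))
   ⊎ (∀ v → S v ≡ true))

InducedP4 : {V : Set} → LGraph V → Set
InducedP4 {V} G = Σ[ a ∈ V ] Σ[ b ∈ V ] Σ[ c ∈ V ] Σ[ d ∈ V ]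
  ( ¬ (a ≡ b) × ¬ (a ≡ c) × ¬ (a ≡ d) × ¬ (b ≡ c) × ¬ (b ≡ d) × ¬ (c ≡ d)
  × adj G a b ≡ true × adj G b c ≡ true × adj G c d ≡ true
  × adj G a c ≡ false × adj G a d ≡ false × adj G b d ≡ false )

Cograph : Graph → Set
Cograph (n , G) = ¬ InducedP4 G

-- Rules: an instance is a pair premise ⟶ conclusion

record Pair : Set₁ where
  constructor _⟶_
  field
    {VX VY} : Set
    X : LGraph VX
    Y : LGraph VY

System : Set₂
System = Pair → Set₁

data AiDown : System where
  aiDown : (a : Atom) → AiDown (emptyL ⟶ (single (dual a) ⊔ single a))

data SsDown : System where
  ssDown : {VB VA : Set} (B : LGraph VB) (A : LGraph VA) (S : VB → Bool)
         → (Σ[ v ∈ VB ] S v ≡ true) → VA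
         → SsDown (plug B S A ⟶ (B ⊔ A))

data PDown : System where
  pDown : (n : ℕ) (P : LGraph (Fin n)) → Prime P → 4 ≤ n
        → (FM FN : Fin n → Set)
        → (M : (i : Fin n) → LGraph (FM i)) → (N : (i : Fin n) → LGraph (FN i))
        → ((i : Fin n) → FM i)
        → PDown (bigJoin n (λ i → FM i ⊎ FN i) (λ i → M i ⊔ N i)
                 ⟶ (compose (complement P) FM M ⊔ compose P FN N))

data SsUp : System where
  ssUp : {VB VA : Set} (B : LGraph VB) (A : LGraph VA) (S : VB → Bool)
       → (Σ[ v ∈ VB ] S v ≡ false) → VA
       → SsUp ((B ⊗ A) ⟶ plug B S A)

data Sw : System where
  sw : {VA VB VC : Set} (A : LGraph VA) (B : LGraph VB) (C : LGraph VC)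
     → Sw (((A ⊔ B) ⊗ C) ⟶ (A ⊔ (B ⊗ C)))

GSssUp : System
GSssUp p = AiDown p ⊎ SsDown p ⊎ PDown p ⊎ SsUp p

AiSw : System
AiSw p = AiDown p ⊎ Sw p

data Step (Sys : System) : Graph → Graph → Set₁ where
  isoStep  : {G H : Graph} → proj₂ G ≅ proj₂ H → Step Sys G H
  ruleStep : {G H : Graph} {W : Set} (C : LGraph W) (R : W → Bool) (p : Pair)
           → Sys p
           → proj₂ G ≅ plug C R (Pair.X p)
           → proj₂ H ≅ plug C R (Pair.Y p)
           → Step Sys G H

Provable : System → Graph → Set₁
Provable Sys A = Star (Step Sys) ∅G A

{-# OPTIONS --safe #-}
module Submission where

-- For (⇒) an invariant of derivations is used. A graph with a set of vertices coloured 0 is refuted if it evaluates to 0,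
-- where ⊔ is read as ∨ and ⊗ as ∧; on graphs that are not cographs, evaluation is replaced by the inductive relation
-- Refuted. The invariant: some involution β pairing dual vertices is such that no β-closed set of vertices is refuted under
-- a colouring in which paired vertices have opposite colours. Read from conclusion to premise, every rule of GS ∪ {ss↑}
-- preserves refutation, so the invariant passes from premise to conclusion.
-- For a cograph the invariant rules out chordless alternating cycles, since such a cycle coloured alternately is refuted.
-- A cograph without chordless alternating cycles is provable by a sequentialisation argument: follow the linking from tree
-- to tree through ⊔-components, leaving each tensor opposite to where it was entered. When a component repeats, the loop
-- has a cusp on one side of a tensor (otherwise it is a chordless alternating cycle), and a switch read upwards moves the
-- other components of the loop into that side without creating a chordless alternating cycle.

open import Defs
open import Function.Bundles using (_⇔_)

open import Data.Bool using (Bool; true; false; not; _∧_; _∨_; _xor_; if_then_else_) renaming (_≟_ to _≟ᵇ_)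
open import Data.Bool.Properties using (not-involutive)
open import Data.Empty using (⊥; ⊥-elim)
open import Data.Fin using (Fin; zero; suc; _≟_)
open import Data.Fin.Properties using (+↔⊎)
open import Data.List using (List; []; _∷_; _++_; allFin; length)
open import Data.List.Membership.Propositional using () renaming (_∈_ to _∈ˡ_)
open import Data.List.Membership.Propositional.Properties using (∈-allFin; ∈-++⁺ˡ; ∈-++⁺ʳ; ∈-++⁻)
open import Data.List.Properties using (++-assoc; ++-identityʳ; length-++)
open import Data.List.Relation.Binary.Permutation.Propositional as ↭ using (_↭_; ↭-sym; ↭-trans; ↭-refl; ↭-reflexive)
open import Data.List.Relation.Binary.Permutation.Propositional.Properties
  using (shift; ++⁺; ++⁺ʳ; ++-comm; ∈-resp-↭; All-resp-↭; ↭-length)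
open import Data.List.Relation.Unary.All as All using (All; []; _∷_)
open import Data.List.Relation.Unary.AllPairs using ([]; _∷_)
open import Data.List.Relation.Unary.Any as Any using (Any; here; there)
open import Data.List.Relation.Unary.Unique.Propositional using (Unique)
open import Data.List.Relation.Unary.Unique.Propositional.Properties using (allFin⁺)
open import Data.Nat using (ℕ; zero; suc; _+_; _≤_; _<_; z≤n; s≤s)
open import Data.Nat.Properties
  using (≤-trans; ≤-refl; ≤-reflexive; ≤-pred; n≤1+n; m≤m+n; m≤n+m; +-comm; +-assoc; +-mono-≤; +-monoˡ-≤)
open import Data.Nat.Solver using (module +-*-Solver)
open import Data.Product using (Σ; Σ-syntax; _×_; _,_; proj₁; proj₂)
open import Data.Sum using (_⊎_; inj₁; inj₂; [_,_]′; map₂) renaming (swap to ⊎-swap)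
open import Data.Sum.Function.Propositional using (_⊎-↔_)
open import Data.Unit using (⊤)
open import Function.Base using (_∘_; case_of_)
open import Function.Bundles using (_↔_; Inverse; mk↔ₛ′; mk⇔)
open import Function.Construct.Composition using () renaming (inverse to ↔-trans)
open import Function.Construct.Identity using () renaming (inverse to ↔-refl)
open import Function.Properties.Inverse using (↔-sym)
open import Relation.Binary.Construct.Closure.ReflexiveTransitive using (Star; ε; _◅_; _◅◅_)
open import Relation.Binary.PropositionalEquality using (_≡_; refl; sym; trans; cong; cong₂; subst)
open import Relation.Nullary using (¬_; Dec; yes; no; does; ¬?; _×-dec_; _⊎-dec_)
open import Relation.Nullary.Decidable using (map′)
open import Relation.Unary using (Decidable)

-- The invariant speaks of all β-closed sets because irrefutability of the whole vertex set would be
-- too weak: `(a ⊔ ā) ⊔ (b ⊗ b̄)` is never refuted as a whole, yet it is not provable; its subset of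
-- `b` and `b̄` is refuted. A derivation of a cograph may pass through graphs that are not cographs,
-- so `Refuted` has to make sense on every graph, where one set can be decomposed in many unrelated
-- ways. Hence the inversion lemmas: a refutation can be read along a given decomposition into apart
-- parts, into joined parts, or into a module and the rest, whatever decomposition it was built
-- with. For p↓ the decisive fact is that a graph and its complement are never both refuted unless
-- some vertex is zero for both. In the sequentialisation, a bad set created by a switch contains
-- exactly one new edge, and a detour along the loop replaces that edge, so a bad set existed before
-- the switch. Switches read upwards keep the number of leaves and tensors and lower the number of
-- trees, whereas axioms and splittings lower the former: the induction is lexicographic.

Subset : Set → Set
Subset V = V → Bool

infix 4 _∈_ _⊆_
record _∈_ {V : Set} (x : V) (S : Subset V) : Set where
  constructor mem
  field holds : S x ≡ true
open _∈_

_⊆_ : {V : Set} → Subset V → Subset V → Set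
S ⊆ T = ∀ {x} → x ∈ S → x ∈ T

Inhabited Empty : {V : Set} → Subset V → Set
Inhabited {V} S = Σ[ x ∈ V ] x ∈ S
Empty S = ∀ {x} → ¬ (x ∈ S)

∈-dec : {V : Set} (S : Subset V) (x : V) → x ∈ S ⊎ ¬ (x ∈ S)
∈-dec S x with S x in eq
... | true  = inj₁ (mem eq)
... | false = inj₂ (λ { (mem p) → case trans (sym p) eq of λ () })

infixr 7 _∩_
infixr 6 _∪_

opaque

  _∩_ _∪_ : {V : Set} → Subset V → Subset V → Subset V
  (S ∩ T) x = S x ∧ T x
  (S ∪ T) x = S x ∨ T x

  ∈∩ : ∀ {V} {S T : Subset V} {x} → x ∈ S → x ∈ T → x ∈ S ∩ T
  ∈∩ (mem p) (mem q) = mem (cong₂ _∧_ p q)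

  ∩ˡ : ∀ {V} {S T : Subset V} {x} → x ∈ S ∩ T → x ∈ S
  ∩ˡ {S = S} {x = x} (mem p) with S x in eq
  ... | true = mem eq

  ∩ʳ : ∀ {V} {S T : Subset V} {x} → x ∈ S ∩ T → x ∈ T
  ∩ʳ {S = S} {x = x} (mem p) with S x
  ... | true = mem p

  ∪ˡ : ∀ {V} {S T : Subset V} {x} → x ∈ S → x ∈ S ∪ T
  ∪ˡ {T = T} {x = x} (mem p) = mem (cong (_∨ T x) p)

  ∪ʳ : ∀ {V} {S T : Subset V} {x} → x ∈ T → x ∈ S ∪ T
  ∪ʳ {S = S} {T} {x} (mem p) with S x in eq
  ... | true  = mem (cong (_∨ T x) eq)
  ... | false = mem (trans (cong (_∨ T x) eq) p)

  ∪-elim : ∀ {V} {S T : Subset V} {x} → x ∈ S ∪ T → x ∈ S ⊎ x ∈ T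
  ∪-elim {S = S} {x = x} (mem p) with S x in eq
  ... | true  = inj₁ (mem eq)
  ... | false = inj₂ (mem p)

-- Rule instances live on arbitrary vertex types. Of their finiteness the invariant needs only that
-- emptiness of a subset can be decided, and this passes along bijections and to the summands of a
-- sum.
Searchable : Set → Set
Searchable V = (S : Subset V) → Inhabited S ⊎ Empty S

record Split {V : Set} (T A B : Subset V) : Set where
  constructor mkSplit
  field
    left  : A ⊆ T
    right : B ⊆ T
    cover : ∀ {x} → x ∈ T → x ∈ A ⊎ x ∈ B
    disj  : ∀ {x} → x ∈ A → x ∈ B → ⊥
open Split

module _ {V : Set} {T A B : Subset V} where

  swap : Split T A B → Split T B A
  swap p = mkSplit (right p) (left p) (λ t → [ inj₂ , inj₁ ]′ (cover p t)) (λ b a → disj p a b)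

  restrict : {X : Subset V} → Split T A B → X ⊆ T → Split X (X ∩ A) (X ∩ B)
  restrict {X} p X⊆T = mkSplit ∩ˡ ∩ˡ
    (λ x → [ (λ a → inj₁ (∈∩ x a)) , (λ b → inj₂ (∈∩ x b)) ]′ (cover p (X⊆T x)))
    (λ a b → disj p (∩ʳ a) (∩ʳ b))

  restrictʳ : {X : Subset V} → Split T A B → X ⊆ T → Split X (A ∩ X) (B ∩ X)
  restrictʳ {X} p X⊆T = mkSplit (∩ʳ) (∩ʳ)
    (λ x → [ (λ a → inj₁ (∈∩ a x)) , (λ b → inj₂ (∈∩ b x)) ]′ (cover p (X⊆T x)))
    (λ a b → disj p (∩ˡ a) (∩ˡ b))

  split-∩ : {U : Subset V} → Split T A B → Split (T ∩ U) (A ∩ U) (B ∩ U)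
  split-∩ p = mkSplit (λ a → ∈∩ (left p (∩ˡ a)) (∩ʳ a)) (λ b → ∈∩ (right p (∩ˡ b)) (∩ʳ b))
    (λ t → [ (λ a → inj₁ (∈∩ a (∩ʳ t))) , (λ b → inj₂ (∈∩ b (∩ʳ t))) ]′ (cover p (∩ˡ t)))
    (λ a b → disj p (∩ˡ a) (∩ˡ b))

-- The refutation relation

module _ {V : Set} (e : V → V → Bool) where

  Homog : Subset V → Subset V → Set
  Homog A B = ∀ {x x' y} → x ∈ A → x' ∈ A → y ∈ B → e x y ≡ e x' y

  Uniform : Bool → Subset V → Subset V → Set
  Uniform b A B = ∀ {x y} → x ∈ A → y ∈ B → e x y ≡ b

  -- On a cograph: the formula with ⊔ as ∨, ⊗ as ∧, and the vertices in Z as 0 evaluates to 0. In par the edges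
  -- between A and B are arbitrary as long as A is a module: this is what makes the relation stable under ss↓.
  data Refuted (Z : V → Set) : Subset V → Set where
    atom : ∀ {T} v → v ∈ T → (∀ {w} → w ∈ T → w ≡ v) → Z v → Refuted Z T
    par  : ∀ {T} A B → Split T A B → Homog A B → Refuted Z A → Refuted Z B → Refuted Z T
    ten  : ∀ {T} A B → Split T A B → Uniform true A B → Refuted Z B → Refuted Z T

module _ {V : Set} {e : V → V → Bool} {Z : V → Set} where

  refuted-cong : ∀ {T T'} → T ⊆ T' → T' ⊆ T → Refuted e Z T → Refuted e Z T'
  refuted-cong f g (atom v v∈T u z) = atom v (f v∈T) (λ w → u (g w)) z
  refuted-cong f g (par A B p h r s) =
    par A B (mkSplit (λ a → f (left p a)) (λ b → f (right p b)) (λ t → cover p (g t)) (disj p)) h r s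
  refuted-cong f g (ten A B p j s) =
    ten A B (mkSplit (λ a → f (left p a)) (λ b → f (right p b)) (λ t → cover p (g t)) (disj p)) j s

  refuted-∩-comm : ∀ {S T} → Refuted e Z (S ∩ T) → Refuted e Z (T ∩ S)
  refuted-∩-comm = refuted-cong (λ x → ∈∩ (∩ʳ x) (∩ˡ x)) (λ x → ∈∩ (∩ʳ x) (∩ˡ x))

  refuted-zero : ∀ {T} → Refuted e Z T → Σ[ v ∈ V ] (v ∈ T × Z v)
  refuted-zero (atom v v∈T u z) = v , v∈T , z
  refuted-zero (par A B p h r s) = let v , v∈A , z = refuted-zero r in v , left p v∈A , z
  refuted-zero (ten A B p j s)   = let v , v∈B , z = refuted-zero s in v , right p v∈B , z

  -- Only an `atom` of the refutation that falls outside `U` obstructs the restriction, and such an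
  -- atom is a zero; the unrefuted part of a `ten` may shrink freely, even to the empty set. For p↓
  -- this brings two quotients to a common support.
  refuted-remove : ∀ {T} (U : Subset V) → Refuted e Z T
                 → Refuted e Z (T ∩ U) ⊎ (Σ[ v ∈ V ] (v ∈ T × ¬ (v ∈ U) × Z v))
  refuted-remove {T} U (atom v v∈T u z) with ∈-dec U v
  ... | inj₁ v∈U = inj₁ (atom v (∈∩ v∈T v∈U) (λ w → u (∩ˡ w)) z)
  ... | inj₂ v∉U = inj₂ (v , v∈T , v∉U , z)
  refuted-remove {T} U (par A B p h r s) with refuted-remove U r | refuted-remove U s
  ... | inj₂ (v , v∈A , v∉U , z) | _ = inj₂ (v , left p v∈A , v∉U , z)
  ... | inj₁ _ | inj₂ (v , v∈B , v∉U , z) = inj₂ (v , right p v∈B , v∉U , z)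
  ... | inj₁ r' | inj₁ s' = inj₁ (par (A ∩ U) (B ∩ U) (split-∩ p)
        (λ a a' b → h (∩ˡ a) (∩ˡ a') (∩ˡ b)) r' s')
  refuted-remove {T} U (ten A B p j s) with refuted-remove U s
  ... | inj₂ (v , v∈B , v∉U , z) = inj₂ (v , right p v∈B , v∉U , z)
  ... | inj₁ s' = inj₁ (ten (A ∩ U) (B ∩ U) (split-∩ p)
        (λ a b → j (∩ˡ a) (∩ˡ b)) s')

-- Properties of refutation

Symmetric : {V : Set} → (V → V → Bool) → Set
Symmetric e = ∀ x y → e x y ≡ e y x

module Elimination {V : Set} {e : V → V → Bool} {Z : V → Set} (search : Searchable V) (e-sym : Symmetric e) where

  private
    R = Refuted e Z

  -- In a `par`, either both halves meet `X` or `X` lies in one of them. In a `ten`, the refuted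
  -- part must meet `X`: otherwise its zero lies in `Y` and a vertex of `X` lies in the other part,
  -- so that the two would be both joined and apart.
  par-inversion : ∀ {T X Y} → Split T X Y → Uniform e false X Y → Inhabited X → R T → R X
  par-inversion sp ap (x , x∈X) (atom v v∈T u z) =
    atom v (subst (_∈ _) (u (left sp x∈X)) x∈X) (λ w → u (left sp w)) z
  par-inversion {X = X} sp ap nX (par A B p h r s) with search (X ∩ A) | search (X ∩ B)
  ... | inj₁ nA | inj₁ nB =
    par (X ∩ A) (X ∩ B) (restrict p (left sp)) (λ a a' b → h (∩ʳ a) (∩ʳ a') (∩ʳ b))
      (refuted-∩-comm
        (par-inversion (restrict sp (left p)) (λ a b → ap (∩ʳ a) (∩ʳ b)) (proj₁ nA , ∈∩ (∩ʳ (proj₂ nA)) (∩ˡ (proj₂ nA))) r))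
      (refuted-∩-comm
        (par-inversion (restrict sp (right p)) (λ a b → ap (∩ʳ a) (∩ʳ b)) (proj₁ nB , ∈∩ (∩ʳ (proj₂ nB))
            (∩ˡ (proj₂ nB))) s))
  ... | inj₂ eA | _ =
    refuted-cong ∩ʳ X⊆B∩X (par-inversion (restrict sp (right p)) (λ a b → ap (∩ʳ a) (∩ʳ b)) (proj₁ nX , X⊆B∩X (proj₂ nX)) s)
    where
    X⊆B∩X : X ⊆ B ∩ X
    X⊆B∩X x = [ (λ a → ⊥-elim (eA (∈∩ x a))) , (λ b → ∈∩ b x) ]′ (cover p (left sp x))
  ... | inj₁ _ | inj₂ eB =
    refuted-cong ∩ʳ X⊆A∩X (par-inversion (restrict sp (left p)) (λ a b → ap (∩ʳ a) (∩ʳ b)) (proj₁ nX , X⊆A∩X (proj₂ nX)) r)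
    where
    X⊆A∩X : X ⊆ A ∩ X
    X⊆A∩X x = [ (λ a → ∈∩ a x) , (λ b → ⊥-elim (eB (∈∩ x b))) ]′ (cover p (left sp x))
  par-inversion {X = X} sp ap nX (ten A B p j s) with search (X ∩ B)
  ... | inj₁ nB =
    ten (X ∩ A) (X ∩ B) (restrict p (left sp)) (λ a b → j (∩ʳ a) (∩ʳ b))
      (refuted-∩-comm
        (par-inversion (restrict sp (right p)) (λ a b → ap (∩ʳ a) (∩ʳ b)) (proj₁ nB , ∈∩ (∩ʳ (proj₂ nB))
            (∩ˡ (proj₂ nB))) s))
  ... | inj₂ eB with refuted-zero s | nX
  ...   | b , b∈B , _ | x , x∈X with cover sp (right p b∈B) | cover p (left sp x∈X)
  ...     | inj₁ b∈X | _ = ⊥-elim (eB (∈∩ b∈X b∈B))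
  ...     | inj₂ _ | inj₂ x∈B = ⊥-elim (eB (∈∩ x∈X x∈B))
  ...     | inj₂ b∈Y | inj₁ x∈A = case trans (sym (j x∈A b∈B)) (ap x∈X b∈Y) of λ ()

  uniform-swap : ∀ {b A B} → Uniform e b A B → Uniform e b B A
  uniform-swap u b a = trans (e-sym _ _) (u a b)

  private
    -- X ∩ A and Y ∩ B refuted: if X ∩ B and Y ∩ A are inhabited, the module A joins X ∩ B to X ∩ A as it is joined to Y ∩ A.
    crossing : ∀ {T X Y A B} → Split T X Y → Uniform e true X Y → Split T A B → Homog e A B
             → R (X ∩ A) → R (Y ∩ B) → R X ⊎ R Y
    crossing {X = X} {Y} {A} {B} sp jn p h r s with search (X ∩ B) | search (Y ∩ A)
    ... | inj₂ eXB | _ = inj₁ (refuted-cong ∩ˡ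
            (λ x → [ (λ a → ∈∩ x a) , (λ b → ⊥-elim (eXB (∈∩ x b))) ]′ (cover p (left sp x))) r)
    ... | inj₁ _ | inj₂ eYA = inj₂ (refuted-cong ∩ˡ
            (λ y → [ (λ a → ⊥-elim (eYA (∈∩ y a))) , (λ b → ∈∩ y b) ]′ (cover p (right sp y))) s)
    ... | inj₁ _ | inj₁ (y , y∈) = inj₁ (ten (X ∩ B) (X ∩ A) (swap (restrict p (left sp)))
            (λ b a → trans (e-sym _ _) (trans (h (∩ʳ a) (∩ʳ y∈) (∩ʳ b)) (trans (e-sym _ _) (jn (∩ˡ b) (∩ˡ y∈))))) r)

  -- The only obstacle is a `par` whose halves are refuted on different sides; there the module
  -- property forces a join inside one side, which `crossing` exploits.
  ten-inversion : ∀ {T X Y} → Split T X Y → Uniform e true X Y → R T → R X ⊎ R Y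
  ten-inversion sp jn (atom v v∈T u z) with cover sp v∈T
  ... | inj₁ v∈X = inj₁ (atom v v∈X (λ w → u (left sp w)) z)
  ... | inj₂ v∈Y = inj₂ (atom v v∈Y (λ w → u (right sp w)) z)
  ten-inversion {X = X} {Y} sp jn (par A B p h r s)
    with ten-inversion (restrictʳ sp (left p)) (λ a b → jn (∩ˡ a) (∩ˡ b)) r
       | ten-inversion (restrictʳ sp (right p)) (λ a b → jn (∩ˡ a) (∩ˡ b)) s
  ... | inj₁ xa | inj₁ xb = inj₁ (par (X ∩ A) (X ∩ B) (restrict p (left sp)) (λ a a' b → h (∩ʳ a) (∩ʳ a') (∩ʳ b)) xa xb)
  ... | inj₂ ya | inj₂ yb = inj₂ (par (Y ∩ A) (Y ∩ B) (restrict p (right sp)) (λ a a' b → h (∩ʳ a) (∩ʳ a') (∩ʳ b)) ya yb)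
  ... | inj₁ xa | inj₂ yb = crossing sp jn p h xa yb
  ... | inj₂ ya | inj₁ xb = [ inj₂ , inj₁ ]′ (crossing (swap sp) (uniform-swap jn) p h ya xb)
  ten-inversion {X = X} {Y} sp jn (ten A B p j s)
    with ten-inversion (restrictʳ sp (right p)) (λ a b → jn (∩ˡ a) (∩ˡ b)) s
  ... | inj₁ xb = inj₁ (ten (X ∩ A) (X ∩ B) (restrict p (left sp)) (λ a b → j (∩ʳ a) (∩ʳ b)) xb)
  ... | inj₂ yb = inj₂ (ten (Y ∩ A) (Y ∩ B) (restrict p (right sp)) (λ a b → j (∩ʳ a) (∩ʳ b)) yb)

  -- An arbitrary border of a module is at best a disjunction, so one of the two parts is refuted.
  -- This weak form of inversion is what remains when the border is mixed, as in ss↑ and in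
  -- complements.
  module-or-rest : ∀ {T M N} → Split T M N → Homog e M N → R T → R M ⊎ R N
  module-or-rest sp hm (atom v v∈T u z) with cover sp v∈T
  ... | inj₁ v∈X = inj₁ (atom v v∈X (λ w → u (left sp w)) z)
  ... | inj₂ v∈Y = inj₂ (atom v v∈Y (λ w → u (right sp w)) z)
  module-or-rest {M = M} {N} sp hm (ten A B p j s)
    with module-or-rest (restrictʳ sp (right p)) (λ a a' b → hm (∩ˡ a) (∩ˡ a') (∩ˡ b)) s
  ... | inj₁ m = inj₁ (ten (M ∩ A) (M ∩ B) (restrict p (left sp)) (λ a b → j (∩ʳ a) (∩ʳ b)) m)
  ... | inj₂ n = inj₂ (ten (N ∩ A) (N ∩ B) (restrict p (right sp)) (λ a b → j (∩ʳ a) (∩ʳ b)) n)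
  module-or-rest {M = M} {N} sp hm (par A B p h r s)
    with module-or-rest (restrictʳ sp (left p)) (λ a a' b → hm (∩ˡ a) (∩ˡ a') (∩ˡ b)) r
       | module-or-rest (restrictʳ sp (right p)) (λ a a' b → hm (∩ˡ a) (∩ˡ a') (∩ˡ b)) s
  ... | inj₁ ma | inj₁ mb = inj₁ (par (M ∩ A) (M ∩ B) (restrict p (left sp)) (λ a a' b → h (∩ʳ a) (∩ʳ a') (∩ʳ b)) ma mb)
  ... | inj₂ na | inj₂ nb = inj₂ (par (N ∩ A) (N ∩ B) (restrict p (right sp)) (λ a a' b → h (∩ʳ a) (∩ʳ a') (∩ʳ b)) na nb)
  ... | inj₁ ma | inj₂ nb with search (M ∩ B) | search (N ∩ A)
  ...   | inj₂ e∅ | _ = inj₁ (refuted-cong ∩ˡ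
            (λ x → [ (λ a → ∈∩ x a) , (λ b → ⊥-elim (e∅ (∈∩ x b))) ]′ (cover p (left sp x))) ma)
  ...   | inj₁ _ | inj₂ e∅ = inj₂ (refuted-cong ∩ˡ
            (λ x → [ (λ a → ⊥-elim (e∅ (∈∩ x a))) , (λ b → ∈∩ x b) ]′ (cover p (right sp x))) nb)
  -- `M` and `A` are both modules, so this one pair decides all the others: if it is an edge,
  -- `M ∩ B` is joined to `M ∩ A`; if not, `N ∩ A` is apart from `M ∩ A` and the refutation of `A`
  -- can be inverted.
  ...   | inj₁ (m , m∈) | inj₁ (n , n∈) with e m n in eq
  ...     | true = inj₁ (ten (M ∩ B) (M ∩ A) (swap (restrict p (left sp)))
              (λ b a → trans (e-sym _ _) (trans (h (∩ʳ a) (∩ʳ n∈) (∩ʳ b))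
                 (trans (e-sym _ _) (trans (hm (∩ˡ b) (∩ˡ m∈) (∩ˡ n∈)) eq)))) ma)
  ...     | false = inj₂ (par (N ∩ A) (N ∩ B) (restrict p (right sp)) (λ a a' b → h (∩ʳ a) (∩ʳ a') (∩ʳ b))
              (par-inversion (swap (restrictʳ sp (left p)))
                 (λ a b → trans (e-sym _ _) (trans (hm (∩ˡ b) (∩ˡ m∈) (∩ˡ a))
                    (trans (e-sym _ _) (trans (h (∩ʳ a) (∩ʳ n∈) (∩ʳ m∈)) (trans (e-sym _ _) eq)))))
                 (n , n∈) r) nb)
  module-or-rest {M = M} {N} sp hm (par A B p h r s)
      | inj₂ na | inj₁ mb with search (M ∩ A) | refuted-zero na | refuted-zero mb
  ...   | inj₂ e∅ | _ | _ = inj₁ (refuted-cong ∩ˡ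
            (λ x → [ (λ a → ⊥-elim (e∅ (∈∩ x a))) , (λ b → ∈∩ x b) ]′ (cover p (left sp x))) mb)
  ...   | inj₁ ma | n , n∈ , _ | m , m∈ , _ with e m n in eq
  ...     | true = inj₁ (ten (M ∩ A) (M ∩ B) (restrict p (left sp))
              (λ a b → trans (h (∩ʳ a) (∩ʳ n∈) (∩ʳ b))
                 (trans (e-sym _ _) (trans (hm (∩ˡ b) (∩ˡ m∈) (∩ˡ n∈)) eq))) mb)
  ...     | false = inj₁ (par (M ∩ A) (M ∩ B) (restrict p (left sp)) (λ a a' b → h (∩ʳ a) (∩ʳ a') (∩ʳ b))
                (par-inversion (restrictʳ sp (left p))
                 (λ a b → trans (hm (∩ˡ a) (∩ˡ m∈) (∩ˡ b))
                    (trans (e-sym _ _) (trans (h (∩ʳ b) (∩ʳ n∈) (∩ʳ m∈)) (trans (e-sym _ _) eq))))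
                 (proj₁ ma , ∈∩ (∩ˡ (proj₂ ma)) (∩ʳ (proj₂ ma))) r) mb)

-- Refutations along bijections and under replacement of a module

module _ {V W : Set} {e : V → V → Bool} {h : W → W → Bool} {Z : V → Set} {Z' : W → Set} (f : V → W) (g : W → V) where

  ∈∘ : ∀ {S : Subset V} {y} → g y ∈ S → y ∈ S ∘ g
  ∈∘ (mem p) = mem p

  ∘∈ : ∀ {S : Subset V} {y} → y ∈ S ∘ g → g y ∈ S
  ∘∈ (mem p) = mem p

  -- The maps have to be inverse only between `T` and `T'`, so each may take an arbitrary default
  -- value elsewhere; a zero of the refutation often supplies that value.
  transport : ∀ {T T'} → (∀ {x} → x ∈ T → f x ∈ T') → (∀ {y} → y ∈ T' → g y ∈ T)
            → (∀ {x} → x ∈ T → g (f x) ≡ x) → (∀ {y} → y ∈ T' → f (g y) ≡ y)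
            → (∀ {x y} → x ∈ T → y ∈ T → e x y ≡ h (f x) (f y)) → (∀ {x} → x ∈ T → Z x → Z' (f x))
            → Refuted e Z T → Refuted h Z' T'
  private
    image : ∀ {T T' A B} → (∀ {x} → x ∈ T → f x ∈ T') → (∀ {y} → y ∈ T' → g y ∈ T)
          → (∀ {x} → x ∈ T → g (f x) ≡ x) → Split T A B → Split T' (T' ∩ (A ∘ g)) (T' ∩ (B ∘ g))
    image F G gf p = mkSplit ∩ˡ ∩ˡ
      (λ t → [ (λ a → inj₁ (∈∩ t (∈∘ a))) , (λ b → inj₂ (∈∩ t (∈∘ b))) ]′ (cover p (G t)))
      (λ a b → disj p (∘∈ (∩ʳ a)) (∘∈ (∩ʳ b)))
    part : ∀ {T T' A} → A ⊆ T → (∀ {x} → x ∈ T → f x ∈ T') → (∀ {x} → x ∈ T → g (f x) ≡ x)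
         → (∀ {y} → y ∈ T' → f (g y) ≡ y)
            → (∀ {x y} → x ∈ T → y ∈ T → e x y ≡ h (f x) (f y)) → (∀ {x} → x ∈ T → Z x → Z' (f x))
         → Refuted e Z A → Refuted h Z' (T' ∩ (A ∘ g))

  transport F G gf fg adj zz (atom v v∈T u z) =
    atom (f v) (F v∈T) (λ w → trans (sym (fg w)) (cong f (u (G w)))) (zz v∈T z)
  transport {T} {T'} F G gf fg adj zz (par A B p m r s) =
    par (T' ∩ (A ∘ g)) (T' ∩ (B ∘ g)) (image F G gf p)
      (λ {x} {x'} {y} a a' b → trans (lower (left p (∘∈ (∩ʳ a))) (∩ˡ a) (right p (∘∈ (∩ʳ b))) (∩ˡ b))
         (trans (m (∘∈ (∩ʳ a)) (∘∈ (∩ʳ a')) (∘∈ (∩ʳ b)))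
                (sym (lower (left p (∘∈ (∩ʳ a'))) (∩ˡ a') (right p (∘∈ (∩ʳ b))) (∩ˡ b)))))
      (part (left p) F gf fg adj zz r) (part (right p) F gf fg adj zz s)
    where
    lower : ∀ {x y} → g x ∈ T → x ∈ T' → g y ∈ T → y ∈ T' → h x y ≡ e (g x) (g y)
    lower gx x gy y = trans (cong₂ h (sym (fg x)) (sym (fg y))) (sym (adj gx gy))
  transport {T} {T'} F G gf fg adj zz (ten A B p j s) =
    ten (T' ∩ (A ∘ g)) (T' ∩ (B ∘ g)) (image F G gf p)
      (λ a b → trans (lower (left p (∘∈ (∩ʳ a))) (∩ˡ a) (right p (∘∈ (∩ʳ b))) (∩ˡ b)) (j (∘∈ (∩ʳ a)) (∘∈ (∩ʳ b))))
      (part (right p) F gf fg adj zz s)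
    where
    lower : ∀ {x y} → g x ∈ T → x ∈ T' → g y ∈ T → y ∈ T' → h x y ≡ e (g x) (g y)
    lower gx x gy y = trans (cong₂ h (sym (fg x)) (sym (fg y))) (sym (adj gx gy))

  part A⊆T F gf fg adj zz r = transport
    (λ a → ∈∩ (F (A⊆T a)) (∈∘ (subst (_∈ _) (sym (gf (A⊆T a))) a))) (λ y → ∘∈ (∩ʳ y))
    (λ a → gf (A⊆T a)) (λ y → fg (∩ˡ y)) (λ a b → adj (A⊆T a) (A⊆T b)) (λ a → zz (A⊆T a)) r

refuted-agree : ∀ {V : Set} {e h : V → V → Bool} {Z Z' : V → Set} {T}
              → (∀ {x y} → x ∈ T → y ∈ T → e x y ≡ h x y) → (∀ {x} → x ∈ T → Z x → Z' x)
              → Refuted e Z T → Refuted h Z' T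
refuted-agree = transport (λ x → x) (λ x → x) (λ x → x) (λ x → x) (λ _ → refl) (λ _ → refl)

module Substitution {V : Set} {e h : V → V → Bool} {Z Z' : V → Set}
                    (search : Searchable V) (e-sym : Symmetric e) (h-sym : Symmetric h) where

  open Elimination {V = V} {e = e} {Z = Z} search e-sym

  private
    ∪-split : {T A B T₀ W : Subset V} → Split T T₀ W → Split T₀ A B → Split T A (B ∪ W)
    ∪-split p q = mkSplit (λ a → left p (left q a))
      (λ x → [ (λ b → left p (right q b)) , right p ]′ (∪-elim x))
      (λ t → [ (λ t₀ → [ inj₁ , (λ b → inj₂ (∪ˡ b)) ]′ (cover q t₀)) , (λ w → inj₂ (∪ʳ w)) ]′ (cover p t))
      (λ a x → [ disj q a , disj p (left q a) ]′ (∪-elim x))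

    ∩∪-split : {T A T₀ W : Subset V} → Split T T₀ W → Split ((T₀ ∩ A) ∪ W) (T₀ ∩ A) W
    ∩∪-split p = mkSplit ∪ˡ ∪ʳ ∪-elim (λ t w → disj p (∩ˡ t) w)

  -- A module may be replaced by another one with the same neighbours if refutability carries over.
  -- The induction is direct as long as `X` lies in one part. When a `par` cuts `X`, the recursive
  -- call concerns only a part of `X`, so `X`, `W` and the implication have to vary.
  substitute : ∀ {T T' T₀ X W} → Refuted e Z T → Split T T₀ X → Split T' T₀ W
             → Inhabited X → Inhabited W
             → (∀ {x y} → x ∈ T₀ → y ∈ T₀ → e x y ≡ h x y) → (∀ {x} → x ∈ T₀ → Z x → Z' x)
             → (∀ {t x w} → t ∈ T₀ → x ∈ X → w ∈ W → e t x ≡ h t w)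
             → (Refuted e Z X → Refuted h Z' W) → Refuted h Z' T'
  substitute (atom v v∈T u z) sp sp' (x , x∈X) _ ag zz tw imp =
    refuted-cong (right sp') T'⊆W
      (imp (atom x x∈X (λ w → trans (u (right sp w)) (sym (u (right sp x∈X)))) (subst Z (sym (u (right sp x∈X))) z)))
    where
    T'⊆W : _ ⊆ _
    T'⊆W t = [ (λ t₀ → ⊥-elim (disj sp t₀ (subst (_∈ _) (trans (u (right sp x∈X)) (sym (u (left sp t₀)))) x∈X))) ,
        (λ w → w) ]′ (cover sp' t)
  substitute {T} {T'} {T₀} {X} {W} (par A B p m r s) sp sp' nX (w₀ , w₀∈W) ag zz tw imp
    with search (X ∩ A) | search (X ∩ B)
  ... | inj₂ e∅ | _ = par A ((T₀ ∩ B) ∪ W) (∪-split sp' q)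
          (λ a a' y → [ (λ b → trans (sym (ag (A⊆T₀ a) (∩ˡ b))) (trans (m a a' (∩ʳ b)) (ag (A⊆T₀ a') (∩ˡ b))))
                      , (λ w → trans (sym (tw (A⊆T₀ a) (proj₂ nX) w)) (trans (m a a' (X⊆B (proj₂ nX)))
                          (tw (A⊆T₀ a') (proj₂ nX) w))) ]′ (∪-elim y))
          (refuted-agree (λ a b → ag (A⊆T₀ a) (A⊆T₀ b)) (λ a → zz (A⊆T₀ a)) r)
          (substitute s (mkSplit ∩ʳ X⊆B (λ b → [ (λ t → inj₁ (∈∩ t b)) , inj₂ ]′ (cover sp (right p b))) (λ t
              → disj sp (∩ˡ t)))
            (∩∪-split sp') nX (w₀ , w₀∈W)
            (λ a b → ag (∩ˡ a) (∩ˡ b)) (λ a → zz (∩ˡ a)) (λ t → tw (∩ˡ t)) imp)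
    where
    X⊆B : X ⊆ B
    X⊆B x = [ (λ a → ⊥-elim (e∅ (∈∩ x a))) , (λ b → b) ]′ (cover p (right sp x))
    A⊆T₀ : A ⊆ T₀
    A⊆T₀ a = [ (λ t → t) , (λ x → ⊥-elim (e∅ (∈∩ x a))) ]′ (cover sp (left p a))
    q : Split T₀ A (T₀ ∩ B)
    q = mkSplit A⊆T₀ ∩ˡ (λ t → [ inj₁ , (λ b → inj₂ (∈∩ t b)) ]′ (cover p (left sp t))) (λ a b → disj p a (∩ʳ b))
  ... | inj₁ _ | inj₂ e∅ = par ((T₀ ∩ A) ∪ W) B (swap (∪-split sp' q))
          (λ y y' b → trans (step y b) (sym (step y' b)))
          (substitute r (mkSplit ∩ʳ X⊆A (λ a → [ (λ t → inj₁ (∈∩ t a)) , inj₂ ]′ (cover sp (left p a))) (λ t → disj sp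
              (∩ˡ t)))
            (∩∪-split sp') nX (w₀ , w₀∈W)
            (λ a b → ag (∩ˡ a) (∩ˡ b)) (λ a → zz (∩ˡ a)) (λ t → tw (∩ˡ t)) imp)
          (refuted-agree (λ a b → ag (B⊆T₀ a) (B⊆T₀ b)) (λ a → zz (B⊆T₀ a)) s)
    where
    X⊆A : X ⊆ A
    X⊆A x = [ (λ a → a) , (λ b → ⊥-elim (e∅ (∈∩ x b))) ]′ (cover p (right sp x))
    B⊆T₀ : B ⊆ T₀
    B⊆T₀ b = [ (λ t → t) , (λ x → ⊥-elim (e∅ (∈∩ x b))) ]′ (cover sp (right p b))
    q : Split T₀ B (T₀ ∩ A)
    q = mkSplit B⊆T₀ ∩ˡ (λ t → [ (λ a → inj₂ (∈∩ t a)) , inj₁ ]′ (cover p (left sp t))) (λ b a → disj p (∩ʳ a) b)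
    step : ∀ {y b} → y ∈ (T₀ ∩ A) ∪ W → b ∈ B → h y b ≡ e (proj₁ nX) b
    step y b = [ (λ a → trans (sym (ag (∩ˡ a) (B⊆T₀ b))) (m (∩ʳ a) (X⊆A (proj₂ nX)) b))
               , (λ w → trans (h-sym _ _) (trans (sym (tw (B⊆T₀ b) (proj₂ nX) w)) (e-sym _ _))) ]′ (∪-elim y)
  ... | inj₁ (xa , xa∈) | inj₁ (xb , xb∈) with search (T₀ ∩ A)
  ...   | inj₂ e∅ =
          substitute s (restrictʳ sp (right p))
            (mkSplit (λ t → left sp' (∩ˡ t)) (right sp')
              (λ t' → [ (λ t → inj₁ ([ (λ a → ⊥-elim (e∅ (∈∩ t a))) , ∈∩ t ]′ (cover p (left sp t)))) , inj₂ ]′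
                  (cover sp' t'))
              (λ t → disj sp' (∩ˡ t)))
            (xb , xb∈) (w₀ , w₀∈W) (λ a b → ag (∩ˡ a) (∩ˡ b)) (λ a → zz (∩ˡ a)) (λ t x → tw (∩ˡ t) (∩ˡ x))
            (λ rb → imp (par (X ∩ A) (X ∩ B) (restrict p (right sp)) (λ a a' b → m (∩ʳ a) (∩ʳ a') (∩ʳ b))
               (refuted-cong (λ a → [ (λ t → ⊥-elim (e∅ (∈∩ t a))) , (λ x → ∈∩ x a) ]′ (cover sp (left p a))) ∩ʳ r) rb))
  -- `T₀ ∩ A` is uniform towards all of `X`: an adjacency is moved inside the module `X` to `xb`,
  -- then inside the module `A` to `a₁`.
  ...   | inj₁ (a₁ , a₁∈) with e a₁ xb in eq
  ...     | false = par (T₀ ∩ A) ((T₀ ∩ B) ∪ W) (∪-split sp' (restrict p (left sp)))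
            (λ a a' y → [ (λ b → trans (sym (ag (∩ˡ a) (∩ˡ b))) (trans (m (∩ʳ a) (∩ʳ a') (∩ʳ b)) (ag (∩ˡ a') (∩ˡ b))))
                      , (λ w → trans (sym (tw (∩ˡ a) (∩ˡ xb∈) w)) (trans (m (∩ʳ a) (∩ʳ a') (∩ʳ xb∈))
                          (tw (∩ˡ a') (∩ˡ xb∈) w))) ]′ (∪-elim y))
            (refuted-agree (λ a b → ag (∩ˡ a) (∩ˡ b)) (λ a → zz (∩ˡ a))
               (par-inversion splA apart (a₁ , a₁∈) r))
            (substitute s (restrictʳ sp (right p))
              (∩∪-split sp') (xb , xb∈) (w₀ , w₀∈W)
              (λ a b → ag (∩ˡ a) (∩ˡ b)) (λ a → zz (∩ˡ a)) (λ t x → tw (∩ˡ t) (∩ˡ x))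
              (λ rb → imp (par (X ∩ A) (X ∩ B) (restrict p (right sp)) (λ a a' b → m (∩ʳ a) (∩ʳ a') (∩ʳ b))
               (par-inversion (swap splA) (uniform-swap apart) (xa , xa∈) r) rb)))
    where
    splA : Split A (T₀ ∩ A) (X ∩ A)
    splA = restrictʳ sp (left p)
    apart : Uniform e false (T₀ ∩ A) (X ∩ A)
    apart a x = trans (trans (tw (∩ˡ a) (∩ˡ x) w₀∈W) (sym (tw (∩ˡ a) (∩ˡ xb∈) w₀∈W))) (trans
        (m (∩ʳ a) (∩ʳ a₁∈) (∩ʳ xb∈)) eq)
  -- Here `A` cannot be inverted to two refuted parts, so `T₀ ∩ A` is moved over into the
  -- replacement of `X ∩ B`; since `A` is a module, `T₀ ∩ B` sees it as it sees `X`. The enlarged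
  -- replacement is refuted outright: `ten-inversion` refutes `T₀ ∩ A`, or else `X ∩ A`, hence `X`,
  -- hence `W`.
  ...     | true =
            substitute s (restrictʳ sp (right p))
              (∪-split sp' (swap (restrict p (left sp)))) (xb , xb∈) (a₁ , ∪ˡ a₁∈)
              (λ a b → ag (∩ˡ a) (∩ˡ b)) (λ a → zz (∩ˡ a))
              (λ t x y → [ (λ a → trans (sym (around t x)) (trans (e-sym _ _)
                  (trans (m (∩ʳ xa∈) (∩ʳ a) (∩ʳ t)) (trans (e-sym _ _) (ag (∩ˡ t) (∩ˡ a))))))
                         , tw (∩ˡ t) (∩ˡ x) ]′ (∪-elim y))
              (λ _ → enlarged)
    where
    around : ∀ {t x} → t ∈ T₀ ∩ B → x ∈ X ∩ B → e t xa ≡ e t x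
    around t x = trans (tw (∩ˡ t) (∩ˡ xa∈) w₀∈W) (sym (tw (∩ˡ t) (∩ˡ x) w₀∈W))
    splA : Split A (T₀ ∩ A) (X ∩ A)
    splA = restrictʳ sp (left p)
    joined : ∀ {a x} → a ∈ T₀ ∩ A → x ∈ X → e a x ≡ true
    joined a x = trans (trans (tw (∩ˡ a) x w₀∈W) (sym (tw (∩ˡ a) (∩ˡ xb∈) w₀∈W))) (trans (m (∩ʳ a) (∩ʳ a₁∈) (∩ʳ xb∈)) eq)
    splW : Split ((T₀ ∩ A) ∪ W) (T₀ ∩ A) W
    splW = ∩∪-split sp'
    hjoin : Uniform h true (T₀ ∩ A) W
    hjoin a w = trans (sym (tw (∩ˡ a) (proj₂ nX) w)) (joined a (proj₂ nX))
    enlarged : Refuted h Z' ((T₀ ∩ A) ∪ W)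
    enlarged with ten-inversion splA (λ a x → joined a (∩ˡ x)) r
    ... | inj₁ ra = ten W (T₀ ∩ A) (swap splW) (λ w a → trans (h-sym _ _) (hjoin a w))
                      (refuted-agree (λ a b → ag (∩ˡ a) (∩ˡ b)) (λ a → zz (∩ˡ a)) ra)
    ... | inj₂ rx = ten (T₀ ∩ A) W splW hjoin
                      (imp (ten (X ∩ B) (X ∩ A) (swap (restrict p (right sp)))
                        (λ b a → trans (e-sym _ _) (trans (m (∩ʳ a) (∩ʳ a₁∈) (∩ʳ b)) (joined a₁∈ (∩ˡ b)))) rx))
  substitute {T} {T'} {T₀} {X} {W} (ten A B p j s) sp sp' nX (w₀ , w₀∈W) ag zz tw imp with search (X ∩ B)
  ... | inj₂ e∅ = ten ((T₀ ∩ A) ∪ W) B (swap (∪-split sp' q))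
          (λ y b → [ (λ a → trans (sym (ag (∩ˡ a) (B⊆T₀ b))) (j (∩ʳ a) b))
               , (λ w → trans (h-sym _ _) (trans (sym (tw (B⊆T₀ b) (proj₂ nX) w))
                   (trans (e-sym _ _) (j (X⊆A (proj₂ nX)) b)))) ]′ (∪-elim y))
          (refuted-agree (λ a b → ag (B⊆T₀ a) (B⊆T₀ b)) (λ a → zz (B⊆T₀ a)) s)
    where
    X⊆A : X ⊆ A
    X⊆A x = [ (λ a → a) , (λ b → ⊥-elim (e∅ (∈∩ x b))) ]′ (cover p (right sp x))
    B⊆T₀ : B ⊆ T₀
    B⊆T₀ b = [ (λ t → t) , (λ x → ⊥-elim (e∅ (∈∩ x b))) ]′ (cover sp (right p b))
    q : Split T₀ B (T₀ ∩ A)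
    q = mkSplit B⊆T₀ ∩ˡ (λ t → [ (λ a → inj₂ (∈∩ t a)) , inj₁ ]′ (cover p (left sp t))) (λ b a → disj p (∩ʳ a) b)
  ... | inj₁ (xb , xb∈) = ten (T₀ ∩ A) ((T₀ ∩ B) ∪ W) (∪-split sp' (restrict p (left sp)))
          (λ a y → [ (λ b → trans (sym (ag (∩ˡ a) (∩ˡ b))) (j (∩ʳ a) (∩ʳ b)))
                   , (λ w → trans (sym (tw (∩ˡ a) (∩ˡ xb∈) w)) (j (∩ʳ a) (∩ʳ xb∈))) ]′ (∪-elim y))
          (substitute s (restrictʳ sp (right p))
              (∩∪-split sp') (xb , xb∈) (w₀ , w₀∈W)
              (λ a b → ag (∩ˡ a) (∩ˡ b)) (λ a → zz (∩ˡ a)) (λ t x → tw (∩ˡ t) (∩ˡ x))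
              (λ rb → imp (ten (X ∩ A) (X ∩ B) (restrict p (right sp)) (λ a b → j (∩ʳ a) (∩ʳ b)) rb)))

-- The De Morgan duality behind p↓. A module of a graph is a module of its complement, so a `par` on
-- one side is answered by `module-or-rest` on the other; a join becomes a pair of apart sets, so a
-- `ten` is answered by `par-inversion`. Both refutations thus descend to the same vertex.
refuted-complement : {V : Set} {g h : V → V → Bool} {Z Z' : V → Set} {T : Subset V}
                   → Searchable V → Symmetric h → (∀ {x y} → ¬ (x ≡ y) → g x y ≡ not (h x y))
                   → Refuted g Z T → Refuted h Z' T → Σ[ v ∈ V ] (v ∈ T × Z v × Z' v)
refuted-complement search h-sym co (atom v v∈T u z) s with refuted-zero s
... | w , w∈T , z' with u w∈T
...   | refl = v , v∈T , z , z'
refuted-complement {g = g} {h} search h-sym co (par A B p m r₁ r₂) s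
  with Elimination.module-or-rest search h-sym p homog s
  where
  not-injective : ∀ {a b} → not a ≡ not b → a ≡ b
  not-injective {true}  {true}  _ = refl
  not-injective {false} {false} _ = refl
  apart : ∀ {x y} → x ∈ A → y ∈ B → ¬ (x ≡ y)
  apart a b refl = disj p a b
  homog : Homog h A B
  homog a a' b = not-injective (trans (sym (co (apart a b))) (trans (m a a' b) (co (apart a' b))))
... | inj₁ sa = let v , v∈A , zz = refuted-complement search h-sym co r₁ sa in v , left p v∈A , zz
... | inj₂ sb = let v , v∈B , zz = refuted-complement search h-sym co r₂ sb in v , right p v∈B , zz
refuted-complement {g = g} {h} search h-sym co (ten A B p j r) s =
  let v , v∈B , zz = refuted-complement search h-sym co r
                       (Elimination.par-inversion search h-sym (swap p) apart (proj₁ nB , proj₁ (proj₂ nB)) s)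
  in v , right p v∈B , zz
  where
  nB = refuted-zero r
  not-true : ∀ {a} → true ≡ not a → a ≡ false
  not-true {false} _ = refl
  apart : Uniform h false B A
  apart b a = trans (h-sym _ _) (not-true (trans (sym (j a b)) (co (λ { refl → disj p a b }))))

-- Subsets given by decidable properties

∈? : {V : Set} (S : Subset V) (x : V) → Dec (x ∈ S)
∈? S x = [ yes , no ]′ (∈-dec S x)

opaque

  decided : {V : Set} {P : V → Set} → (∀ x → Dec (P x)) → Subset V
  decided P? x = does (P? x)

  ∈decided : ∀ {V} {P : V → Set} {P? : ∀ x → Dec (P x)} {x} → P x → x ∈ decided P?
  ∈decided {P? = P?} {x} p with P? x in eq
  ... | yes _ = mem (cong does eq)
  ... | no ¬p = ⊥-elim (¬p p)

  decided∈ : ∀ {V} {P : V → Set} {P? : ∀ x → Dec (P x)} {x} → x ∈ decided P? → P x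
  decided∈ {P? = P?} {x} (mem q) with P? x
  ... | yes p = p

searchable-⊎ : {V W : Set} → Searchable V → Searchable W → Searchable (V ⊎ W)
searchable-⊎ search-V search-W S with search-V (S ∘ inj₁) | search-W (S ∘ inj₂)
... | inj₁ (x , mem p) | _ = inj₁ (inj₁ x , mem p)
... | inj₂ _ | inj₁ (y , mem p) = inj₁ (inj₂ y , mem p)
... | inj₂ e | inj₂ e' = inj₂ λ { {inj₁ x} (mem p) → e (mem p) ; {inj₂ y} (mem p) → e' (mem p) }

searchable-Fin : ∀ n → Searchable (Fin n)
searchable-Fin zero S = inj₂ λ { {()} }
searchable-Fin (suc n) S with ∈-dec S zero | searchable-Fin n (S ∘ suc)
... | inj₁ z | _ = inj₁ (zero , z)
... | inj₂ _ | inj₁ (i , mem p) = inj₁ (suc i , mem p)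
... | inj₂ z | inj₂ e = inj₂ λ { {zero} p → z p ; {suc i} (mem p) → e (mem p) }

-- Each module of T (the trace of a fibre of p) is replaced by one vertex, which is a zero iff the module is refuted.
module Collapse {V : Set} {n : ℕ} (p : V → Fin n) {e : V → V → Bool} {q : Fin n → Fin n → Bool} {Z : V → Set}
                (search : Searchable V) (e-sym : Symmetric e) (q-sym : Symmetric q)
                (quotient : ∀ {x y} → ¬ (p x ≡ p y) → e x y ≡ q (p x) (p y)) (T : Subset V) where

  fibre : Fin n → Subset V
  fibre i = T ∩ decided (λ x → p x ≟ i)

  occupied? : ∀ i → Dec (Inhabited (fibre i))
  occupied? i = [ yes , (λ e → no (λ (_ , x) → e x)) ]′ (search (fibre i))

  support : Subset (Fin n)
  support = decided occupied?

  private
    V⁺ = V ⊎ Fin n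

    p⁺ : V⁺ → Fin n
    p⁺ = [ p , (λ i → i) ]′

    -- On a pair of a fibre's vertex and the vertex that represents this fibre the value is
    -- irrelevant, since no stage contains both.
    e⁺ : V⁺ → V⁺ → Bool
    e⁺ (inj₁ x) (inj₁ y) = e x y
    e⁺ u v = q (p⁺ u) (p⁺ v)

    e⁺-sym : Symmetric e⁺
    e⁺-sym (inj₁ x) (inj₁ y) = e-sym x y
    e⁺-sym (inj₁ x) (inj₂ y) = q-sym _ _
    e⁺-sym (inj₂ x) (inj₁ y) = q-sym _ _
    e⁺-sym (inj₂ x) (inj₂ y) = q-sym _ _

    quotient⁺ : ∀ u v → ¬ (p⁺ u ≡ p⁺ v) → e⁺ u v ≡ q (p⁺ u) (p⁺ v)
    quotient⁺ (inj₁ x) (inj₁ y) ne = quotient ne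
    quotient⁺ (inj₁ x) (inj₂ y) ne = refl
    quotient⁺ (inj₂ x) (inj₁ y) ne = refl
    quotient⁺ (inj₂ x) (inj₂ y) ne = refl

    Z⁺ : V⁺ → Set
    Z⁺ = [ Z , (λ i → Refuted e Z (fibre i)) ]′

    -- The intermediate graphs: fibres over `d` have been contracted to their representatives, the
    -- remaining ones are still present vertex by vertex. Empty fibres get no representative.
    Stage : Subset (Fin n) → V⁺ → Set
    Stage d (inj₁ x) = x ∈ T × ¬ (p x ∈ d)
    Stage d (inj₂ i) = i ∈ support × i ∈ d

    stage? : ∀ d u → Dec (Stage d u)
    stage? d (inj₁ x) = ∈? T x ×-dec ¬? (∈? d (p x))
    stage? d (inj₂ i) = ∈? support i ×-dec ∈? d i

    stage : Subset (Fin n) → Subset V⁺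
    stage d = decided (stage? d)

    ⁅_⁆ : Fin n → Subset (Fin n)
    ⁅ i ⁆ = decided (_≟ i)

    R⁺ = Refuted e⁺ Z⁺

    collapse-one : ∀ d i → R⁺ (stage d) → R⁺ (stage (⁅ i ⁆ ∪ d))
    collapse-one d i r with ∈-dec d i | ∈-dec support i
    ... | inj₁ i∈d | _ = refuted-cong (λ u → ∈decided (to (decided∈ u))) (λ u → ∈decided (from (decided∈ u))) r
      where
      back : ∀ {j} → j ∈ ⁅ i ⁆ ∪ d → j ∈ d
      back k = [ (λ s → subst (_∈ d) (sym (decided∈ s)) i∈d) , (λ s → s) ]′ (∪-elim k)
      to : ∀ {u} → Stage d u → Stage (⁅ i ⁆ ∪ d) u
      to {inj₁ x} (t , s) = t , λ k → s (back k)
      to {inj₂ j} (t , s) = t , ∪ʳ s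
      from : ∀ {u} → Stage (⁅ i ⁆ ∪ d) u → Stage d u
      from {inj₁ x} (t , s) = t , λ k → s (∪ʳ k)
      from {inj₂ j} (t , s) = t , back s
    ... | inj₂ i∉d | inj₂ i∉S = refuted-cong (λ u → ∈decided (to (decided∈ u))) (λ u → ∈decided (from (decided∈ u))) r
      where
      to : ∀ {u} → Stage d u → Stage (⁅ i ⁆ ∪ d) u
      to {inj₁ x} (t , s) = t , λ k → [ (λ a → i∉S (∈decided (x , ∈∩ t (∈decided (decided∈ a))))) , s ]′ (∪-elim k)
      to {inj₂ j} (t , s) = t , ∪ʳ s
      from : ∀ {u} → Stage (⁅ i ⁆ ∪ d) u → Stage d u
      from {inj₁ x} (t , s) = t , λ k → s (∪ʳ k)
      from {inj₂ j} (t , s) = t , [ (λ a → ⊥-elim (i∉S (subst (_∈ support) (decided∈ a) t))) , (λ k → k) ]′ (∪-elim s)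
    ... | inj₂ i∉d | inj₁ i∈S =
      Substitution.substitute (searchable-⊎ search (searchable-Fin n)) e⁺-sym e⁺-sym r
        split split' (inj₁ x₀ , x₀∈X) (inj₂ i , ∈decided refl)
        (λ _ _ → refl) (λ _ z → z)
        (λ {t} {x} {w} t∈ x∈ w∈ → trans (quotient⁺ t x (λ eq → out t∈ (trans eq (inside x∈))))
           (trans (cong (q (p⁺ t)) (trans (inside x∈) (sym (at w∈))))
                  (sym (quotient⁺ t w (λ eq → out t∈ (trans eq (at w∈)))))))
        -- A representative is zero by definition exactly when its fibre is refuted, so the
        -- implication that `substitute` asks for only moves the refutation of `X` back to the
        -- fibre.
        (λ rx → atom (inj₂ i) (∈decided refl) (λ w → decided∈ w)
          (transport [ (λ x → x) , (λ _ → x₀) ]′ inj₁ X→ X← X-id (λ _ → refl) X-adj X-zero rx))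
      where
      at? : ∀ u → Dec (u ≡ inj₂ i)
      at? (inj₁ x) = no λ ()
      at? (inj₂ j) = map′ (cong inj₂) (λ { refl → refl }) (j ≟ i)
      in? : ∀ u → Dec (p⁺ u ≡ i)
      in? u = p⁺ u ≟ i
      X  = stage d ∩ decided in?
      T₀ = stage d ∩ decided (λ u → ¬? (in? u))
      W  = decided at?
      inside : ∀ {u} → u ∈ X → p⁺ u ≡ i
      inside u = decided∈ (∩ʳ u)
      out : ∀ {u} → u ∈ T₀ → ¬ (p⁺ u ≡ i)
      out u = decided∈ (∩ʳ u)
      at : ∀ {u} → u ∈ W → p⁺ u ≡ i
      at w = cong p⁺ (decided∈ w)
      split : Split (stage d) T₀ X
      split = mkSplit ∩ˡ ∩ˡ (λ {u} s → case in? u of λ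
                { (yes a) → inj₂ (∈∩ s (∈decided a)) ; (no a) → inj₁ (∈∩ s (∈decided a)) }) (λ t x → out t (inside x))
      grow : ∀ {u} → Stage d u → ¬ (p⁺ u ≡ i) → Stage (⁅ i ⁆ ∪ d) u
      grow {inj₁ x} (t , s) ne = t , λ k → [ (λ a → ne (decided∈ a)) , s ]′ (∪-elim k)
      grow {inj₂ j} (t , s) ne = t , ∪ʳ s
      shrink : ∀ {u} → Stage (⁅ i ⁆ ∪ d) u → Stage d u ⊎ u ≡ inj₂ i
      shrink {inj₁ x} (t , s) = inj₁ (t , λ k → s (∪ʳ k))
      shrink {inj₂ j} (t , s) = [ (λ a → inj₂ (cong inj₂ (decided∈ a))) , (λ k → inj₁ (t , k)) ]′ (∪-elim s)
      new : ∀ {u} → u ≡ inj₂ i → Stage (⁅ i ⁆ ∪ d) u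
      new refl = i∈S , ∪ˡ (∈decided refl)
      notin : ∀ {u} → Stage (⁅ i ⁆ ∪ d) u → p⁺ u ≡ i → u ≡ inj₂ i
      notin {inj₁ x} (t , s) eq = ⊥-elim (s (∪ˡ (∈decided eq)))
      notin {inj₂ j} (t , s) refl = refl
      split' : Split (stage (⁅ i ⁆ ∪ d)) T₀ W
      split' = mkSplit (λ t → ∈decided (grow (decided∈ (∩ˡ t)) (out t))) (λ w → ∈decided (new (decided∈ w)))
        (λ {u} s → case in? u of λ
          { (yes a) → inj₂ (∈decided (notin (decided∈ s) a))
          ; (no a) → inj₁ (∈∩ (∈decided ([ (λ k → k) , (λ eq → ⊥-elim (a (cong p⁺ eq))) ]′ (shrink (decided∈ s))))
              (∈decided a)) })
        (λ t w → out t (at w))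
      x₀ : V
      x₀ = proj₁ (decided∈ {P? = occupied?} i∈S)
      x₀∈ : x₀ ∈ fibre i
      x₀∈ = proj₂ (decided∈ {P? = occupied?} i∈S)
      X← : ∀ {x} → x ∈ fibre i → inj₁ x ∈ X
      X← x = ∈∩ (∈decided (∩ˡ x , λ k → i∉d (subst (_∈ d) (decided∈ (∩ʳ x)) k))) (∈decided (decided∈ (∩ʳ x)))
      x₀∈X : inj₁ x₀ ∈ X
      x₀∈X = X← x₀∈
      X-inj₁ : ∀ {j} {A : Set} → inj₂ j ∈ X → A
      X-inj₁ x = ⊥-elim (i∉d (subst (_∈ d) (inside x) (proj₂ (decided∈ (∩ˡ x)))))
      X→ : ∀ {u} → u ∈ X → [ (λ x → x) , (λ _ → x₀) ]′ u ∈ fibre i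
      X→ {inj₁ x} u = ∈∩ (proj₁ (decided∈ (∩ˡ u))) (∈decided (inside u))
      X→ {inj₂ j} u = X-inj₁ u
      X-id : ∀ {u} → u ∈ X → inj₁ ([ (λ x → x) , (λ _ → x₀) ]′ u) ≡ u
      X-id {inj₁ x} u = refl
      X-id {inj₂ j} u = X-inj₁ u
      X-adj : ∀ {u v} → u ∈ X → v ∈ X → e⁺ u v ≡ e ([ (λ x → x) , (λ _ → x₀) ]′ u) ([ (λ x → x) , (λ _ → x₀) ]′ v)
      X-adj {inj₁ x} {inj₁ y} u v = refl
      X-adj {inj₁ x} {inj₂ j} u v = X-inj₁ v
      X-adj {inj₂ j} u v = X-inj₁ u
      X-zero : ∀ {u} → u ∈ X → Z⁺ u → Z ([ (λ x → x) , (λ _ → x₀) ]′ u)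
      X-zero {inj₁ x} u z = z
      X-zero {inj₂ j} u z = X-inj₁ u

    mentioned : List (Fin n) → Subset (Fin n)
    mentioned []       = λ _ → false
    mentioned (i ∷ is) = ⁅ i ⁆ ∪ mentioned is

    ∈mentioned : ∀ {i is} → i ∈ˡ is → i ∈ mentioned is
    ∈mentioned (here refl) = ∪ˡ (∈decided refl)
    ∈mentioned (there k)   = ∪ʳ (∈mentioned k)

    collapse-list : ∀ is → R⁺ (stage (λ _ → false)) → R⁺ (stage (mentioned is))
    collapse-list []       r = r
    collapse-list (i ∷ is) r = collapse-one (mentioned is) i (collapse-list is r)

    start : ∀ {u} → u ∈ stage (λ _ → false) → Σ[ x ∈ V ] (u ≡ inj₁ x × x ∈ T)
    start {inj₁ x} s = x , refl , proj₁ (decided∈ s)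
    start {inj₂ i} s with () ← holds (proj₂ (decided∈ s))

    final : ∀ {u} → u ∈ stage (mentioned (allFin n)) → Σ[ i ∈ Fin n ] (u ≡ inj₂ i × i ∈ support)
    final {inj₁ x} s = ⊥-elim (proj₂ (decided∈ s) (∈mentioned (∈-allFin (p x))))
    final {inj₂ i} s = i , refl , proj₁ (decided∈ s)

  collapse : Refuted e Z T → Refuted q (λ i → Refuted e Z (fibre i)) support
  collapse r = transport p⁺ inj₂ F (λ i → ∈decided (i , ∈mentioned (∈-allFin _))) G (λ _ → refl) A B
                 (collapse-list (allFin n) (transport inj₁ [ (λ x → x) , (λ _ → x₀) ]′
                   (λ x → ∈decided (x , λ ())) (λ u → C u) (λ _ → refl) (λ u → D u) (λ _ _ → refl) (λ _ z → z) r))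
    where
    x₀ = proj₁ (refuted-zero r)
    S = stage (mentioned (allFin n))
    F : ∀ {u} → u ∈ S → p⁺ u ∈ support
    F u with final u
    ... | i , refl , i∈ = i∈
    G : ∀ {u} → u ∈ S → inj₂ (p⁺ u) ≡ u
    G u with final u
    ... | i , refl , i∈ = refl
    A : ∀ {u v} → u ∈ S → v ∈ S → e⁺ u v ≡ q (p⁺ u) (p⁺ v)
    A u v with final u
    ... | i , refl , i∈ = refl
    B : ∀ {u} → u ∈ S → Z⁺ u → Refuted e Z (fibre (p⁺ u))
    B u z with final u
    ... | i , refl , i∈ = z
    C : ∀ {u} → u ∈ stage (λ _ → false) → [ (λ x → x) , (λ _ → x₀) ]′ u ∈ T
    C u with start u
    ... | x , refl , x∈ = x∈
    D : ∀ {u} → u ∈ stage (λ _ → false) → inj₁ ([ (λ x → x) , (λ _ → x₀) ]′ u) ≡ u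
    D u with start u
    ... | x , refl , x∈ = refl

-- The invariant and its preservation by the rules

searchable-retract : {V W : Set} (f : V → W) (g : W → V) → (∀ y → f (g y) ≡ y) → Searchable V → Searchable W
searchable-retract f g fg search S with search (S ∘ f)
... | inj₁ (x , mem p) = inj₁ (f x , mem p)
... | inj₂ e = inj₂ λ { {y} (mem p) → e {g y} (mem (trans (cong S (fg y)) p)) }

searchable-inj₁ : {V W : Set} → Searchable (V ⊎ W) → Searchable V
searchable-inj₁ search S with search [ S , (λ _ → false) ]′
... | inj₁ (inj₁ x , mem p) = inj₁ (x , mem p)
... | inj₁ (inj₂ _ , mem ())
... | inj₂ e = inj₂ λ { {x} (mem p) → e {inj₁ x} (mem p) }

searchable-inj₂ : {V W : Set} → Searchable (V ⊎ W) → Searchable W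
searchable-inj₂ search S with search [ (λ _ → false) , S ]′
... | inj₁ (inj₂ x , mem p) = inj₁ (x , mem p)
... | inj₁ (inj₁ _ , mem ())
... | inj₂ e = inj₂ λ { {x} (mem p) → e {inj₂ x} (mem p) }

record Linked {V : Set} (G : LGraph V) : Set where
  field
    search     : Searchable V
    β          : V → V
    β-invol    : ∀ x → β (β x) ≡ x
    β-dual     : ∀ x → lab G (β x) ≡ dual (lab G x)
    irrefutable : (D : Subset V) (c : V → Bool) → (∀ {x} → x ∈ D → β x ∈ D)
                → (∀ {x} → x ∈ D → c (β x) ≡ not (c x)) → ¬ Refuted (adj G) (λ x → c x ≡ false) D

-- The linking travels forwards along the bijection and refutations travel backwards. The edges of
-- `G` and `H` may differ, as long as every refutation in `H` is also one for the edges of `G` read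
-- on the vertices of `H`.
linked-transport : {V W : Set} {G : LGraph V} {H : LGraph W} (f : V → W) (g : W → V)
                 → (∀ x → g (f x) ≡ x) → (∀ y → f (g y) ≡ y) → (∀ x → lab H (f x) ≡ lab G x)
                 → ({D : Subset W} {c : W → Bool} → Refuted (adj H) (λ y → c y ≡ false) D
                    → Refuted (λ x y → adj G (g x) (g y)) (λ y → c y ≡ false) D)
                 → Linked G → Linked H
linked-transport {G = G} {H} f g gf fg labf ref L = record
  { search = searchable-retract f g fg search
  ; β = λ y → f (β (g y))
  ; β-invol = λ y → trans (cong (f ∘ β) (gf _)) (trans (cong f (β-invol _)) (fg y))
  ; β-dual = λ y → trans (labf _) (trans (β-dual (g y)) (cong dual (trans (sym (labf (g y))) (cong (lab H) (fg y)))))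
  ; irrefutable = λ D c closed anti r → irrefutable (D ∘ f) (c ∘ f)
      (λ { {x} (mem p) → mem (trans (cong (D ∘ f ∘ β) (sym (gf x))) (holds (closed {f x} (mem p)))) })
      (λ { {x} (mem p) → trans (cong (c ∘ f ∘ β) (sym (gf x))) (anti {f x} (mem p)) })
      (transport g f (λ { {y} (mem p) → mem (trans (cong D (fg y)) p) }) (λ { (mem p) → mem p })
         (λ {y} _ → fg y) (λ {x} _ → gf x) (λ _ _ → refl) (λ {y} _ z → trans (cong c (fg y)) z) (ref r))
  }
  where open Linked L

linked-≅ : {V W : Set} {G : LGraph V} {H : LGraph W} → G ≅ H → Linked G → Linked H
linked-≅ {G = G} {H} i = linked-transport (to bij) (from bij) (strictlyInverseʳ bij) (strictlyInverseˡ bij) labPres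
    (refuted-agree (λ {x} {y} _ _ → trans (sym (cong₂ (adj H) (strictlyInverseˡ bij x) (strictlyInverseˡ bij y)))
                                           (adjPres (from bij x) (from bij y))) (λ _ z → z))
  where open _≅_ i
        open Inverse

≅-flip : {V W : Set} {G : LGraph V} {H : LGraph W} → G ≅ H → H ≅ G
≅-flip {G = G} {H} i = record
  { bij = record { to = from bij ; from = to bij ; to-cong = from-cong bij ; from-cong = to-cong bij
                 ; inverse = inverseʳ bij , inverseˡ bij }
  ; labPres = λ y → trans (sym (labPres (from bij y))) (cong (lab H) (strictlyInverseˡ bij y))
  ; adjPres = λ x y → trans (sym (adjPres (from bij x) (from bij y)))
                        (cong₂ (adj H) (strictlyInverseˡ bij x) (strictlyInverseˡ bij y))
  }
  where open _≅_ i
        open Inverse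

module _ {W VX VY : Set} (C : LGraph W) (R : W → Bool) (X : LGraph VX) (Y : LGraph VY) (f : VX → VY) (g : VY → VX)
         (gf : ∀ x → g (f x) ≡ x) (fg : ∀ y → f (g y) ≡ y) (labf : ∀ x → lab Y (f x) ≡ lab X x) where

  -- The rewritten subgraph is a module of the whole graph, so `substitute` lifts a fact about the
  -- rule alone to any context. To compare premise and conclusion on one vertex set, the edges of
  -- the premise are read on the vertices of the conclusion.
  linked-context : (Searchable VY → ∀ {Z T} → Refuted (adj Y) Z T → Refuted (λ x y → adj X (g x) (g y)) Z T)
                 → Linked (plug C R X) → Linked (plug C R Y)
  linked-context ref L = linked-transport (map₂ f) (map₂ g)
      (λ { (inj₁ x) → refl ; (inj₂ y) → cong inj₂ (gf y) }) (λ { (inj₁ x) → refl ; (inj₂ y) → cong inj₂ (fg y) })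
      (λ { (inj₁ x) → refl ; (inj₂ y) → labf y }) inside L
    where
    searchY : Searchable (W ⊎ VY)
    searchY = searchable-retract (map₂ f) (map₂ g) (λ { (inj₁ x) → refl ; (inj₂ y) → cong inj₂ (fg y) }) (Linked.search L)
    e h : W ⊎ VY → W ⊎ VY → Bool
    e = adj (plug C R Y)
    h u v = adj (plug C R X) (map₂ g u) (map₂ g v)
    inside : {D : Subset (W ⊎ VY)} {c : W ⊎ VY → Bool} → Refuted e (λ y → c y ≡ false) D → Refuted h (λ y → c y ≡ false) D
    inside {D} {c} r with searchable-inj₂ searchY (D ∘ inj₂)
    ... | inj₂ e∅ = refuted-agree same (λ _ z → z) r
      where
      same : ∀ {u v} → u ∈ D → v ∈ D → e u v ≡ h u v
      same {inj₁ x} {inj₁ y} _ _ = refl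
      same {inj₂ x} (mem p) _ = ⊥-elim (e∅ {x} (mem p))
      same {inj₁ x} {inj₂ y} _ (mem p) = ⊥-elim (e∅ {y} (mem p))
    ... | inj₁ (y₀ , mem y₀∈) =
      Substitution.substitute searchY (adjSym (plug C R Y)) (λ u v → adjSym (plug C R X) (map₂ g u) (map₂ g v)) r
        split split (inj₂ y₀ , y₀∈M) (inj₂ y₀ , y₀∈M) outer (λ _ z → z) border
        (λ m → transport inj₂ back (λ { (mem p) → ∈∩ (mem p) (mem refl) }) (λ u → to u) (λ _ → refl) (λ u → id u)
            (λ _ _ → refl)
             (λ _ z → z) (ref (searchable-inj₂ searchY)
             (transport back inj₂ (λ u → to u) (λ { (mem p) → ∈∩ (mem p) (mem refl) }) (λ u → id u) (λ _ → refl)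
               (λ u v → low u v) (λ u z → zero' u z) m)))
      where
      out : Subset (W ⊎ VY)
      out = [ (λ _ → true) , (λ _ → false) ]′
      mod : Subset (W ⊎ VY)
      mod = [ (λ _ → false) , (λ _ → true) ]′
      split : Split D (D ∩ out) (D ∩ mod)
      split = mkSplit ∩ˡ ∩ˡ (λ { {inj₁ x} p → inj₁ (∈∩ p (mem refl)) ; {inj₂ x} p → inj₂ (∈∩ p (mem refl)) })
                (λ { {inj₁ x} p q → case holds (∩ʳ q) of λ () ; {inj₂ x} p q → case holds (∩ʳ p) of λ () })
      y₀∈M : inj₂ y₀ ∈ D ∩ mod
      y₀∈M = ∈∩ (mem y₀∈) (mem refl)
      isInner : ∀ {x} {A : Set} → inj₁ x ∈ D ∩ mod → A
      isInner q = case holds (∩ʳ q) of λ ()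
      isOuter : ∀ {x} {A : Set} → inj₂ x ∈ D ∩ out → A
      isOuter q = case holds (∩ʳ q) of λ ()
      outer : ∀ {u v} → u ∈ D ∩ out → v ∈ D ∩ out → e u v ≡ h u v
      outer {inj₁ x} {inj₁ y} _ _ = refl
      outer {inj₂ x} p _ = isOuter p
      outer {inj₁ x} {inj₂ y} _ p = isOuter p
      border : ∀ {t u w} → t ∈ D ∩ out → u ∈ D ∩ mod → w ∈ D ∩ mod → e t u ≡ h t w
      border {inj₁ t} {inj₂ u} {inj₂ w} _ _ _ = refl
      border {inj₂ t} p _ _ = isOuter p
      border {inj₁ t} {inj₁ u} _ p _ = isInner p
      border {inj₁ t} {inj₂ u} {inj₁ w} _ _ p = isInner p
      back : W ⊎ VY → VY
      back = [ (λ _ → y₀) , (λ y → y) ]′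
      to : ∀ {u} → u ∈ D ∩ mod → back u ∈ D ∘ inj₂
      to {inj₁ x} p = isInner p
      to {inj₂ y} p = mem (holds (∩ˡ p))
      id : ∀ {u} → u ∈ D ∩ mod → inj₂ (back u) ≡ u
      id {inj₁ x} p = isInner p
      id {inj₂ y} p = refl
      low : ∀ {u v} → u ∈ D ∩ mod → v ∈ D ∩ mod → e u v ≡ adj Y (back u) (back v)
      low {inj₁ x} p _ = isInner p
      low {inj₂ x} {inj₁ y} _ p = isInner p
      low {inj₂ x} {inj₂ y} _ _ = refl
      zero' : ∀ {u} → u ∈ D ∩ mod → c u ≡ false → c (inj₂ (back u)) ≡ false
      zero' {inj₁ x} p = isInner p
      zero' {inj₂ x} p z = z

-- The rules ss↓ and ss↑

module _ {V W : Set} where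

  lefts rights : Subset (V ⊎ W)
  lefts  = [ (λ _ → true) , (λ _ → false) ]′
  rights = [ (λ _ → false) , (λ _ → true) ]′

  sides : ∀ {T} → Split T (T ∩ lefts) (T ∩ rights)
  sides = mkSplit ∩ˡ ∩ˡ (λ { {inj₁ x} p → inj₁ (∈∩ p (mem refl)) ; {inj₂ x} p → inj₂ (∈∩ p (mem refl)) })
                (λ { {inj₁ x} p q → case holds (∩ʳ q) of λ () ; {inj₂ x} p q → case holds (∩ʳ p) of λ () })

  module _ (B : LGraph V) (A : LGraph W) (S : V → Bool) where

    border-homog : ∀ {T} → Homog (adj (plug B S A)) (T ∩ rights) (T ∩ lefts)
    border-homog {_} {inj₁ _} p _ _ = case holds (∩ʳ p) of λ ()
    border-homog {_} {inj₂ _} {inj₁ _} _ p _ = case holds (∩ʳ p) of λ ()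
    border-homog {_} {inj₂ _} {inj₂ _} {inj₁ _} _ _ _ = refl
    border-homog {_} {inj₂ _} {inj₂ _} {inj₂ _} _ _ p = case holds (∩ʳ p) of λ ()

    border-uniform : ∀ {b T} → (∀ x → S x ≡ b) → Uniform (adj (plug B S A)) b (T ∩ rights) (T ∩ lefts)
    border-uniform eq {inj₁ _} p _ = case holds (∩ʳ p) of λ ()
    border-uniform eq {inj₂ _} {inj₁ x} _ _ = eq x
    border-uniform eq {inj₂ _} {inj₂ _} _ p = case holds (∩ʳ p) of λ ()

    refuted-lefts : ∀ S' {Z T} → Refuted (adj (plug B S A)) Z (T ∩ lefts) → Refuted (adj (plug B S' A)) Z (T ∩ lefts)
    refuted-lefts S' = refuted-agree
      (λ { {inj₁ _} {inj₁ _} _ _ → refl ; {inj₂ _} p _ → case holds (∩ʳ p) of λ () ; {inj₁ _} {inj₂ _} _ p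
          → case holds (∩ʳ p) of λ () }) (λ _ z → z)

    refuted-rights : ∀ S' {Z T} → Refuted (adj (plug B S A)) Z (T ∩ rights) → Refuted (adj (plug B S' A)) Z (T ∩ rights)
    refuted-rights S' = refuted-agree
      (λ { {inj₂ _} {inj₂ _} _ _ → refl ; {inj₁ _} p _ → case holds (∩ʳ p) of λ () ; {inj₂ _} {inj₁ _} _ p
          → case holds (∩ʳ p) of λ () }) (λ _ z → z)

module _ {V W : Set} (B : LGraph V) (A : LGraph W) (S : V → Bool) (search : Searchable (V ⊎ W)) where

  -- In the conclusion both parts can be inverted; in the premise `A` is still a module, so `par`
  -- puts them together again over the border `S`.
  refuted-ssDown : ∀ {Z T} → Refuted (adj (B ⊔ A)) Z T → Refuted (adj (plug B S A)) Z T
  refuted-ssDown {T = T} r with search (T ∩ lefts) | search (T ∩ rights)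
  ... | inj₂ e∅ | _ = refuted-cong ∩ˡ only (refuted-rights B A (λ _ → false) S (refuted-cong only ∩ˡ r))
    where
    only : T ⊆ T ∩ rights
    only t = [ (λ l → ⊥-elim (e∅ l)) , (λ r → r) ]′ (cover sides t)
  ... | inj₁ _ | inj₂ e∅ = refuted-cong ∩ˡ only (refuted-lefts B A (λ _ → false) S (refuted-cong only ∩ˡ r))
    where
    only : T ⊆ T ∩ lefts
    only t = [ (λ r → r) , (λ l → ⊥-elim (e∅ l)) ]′ (cover sides t)
  ... | inj₁ nB | inj₁ nA = par (T ∩ rights) (T ∩ lefts) (swap sides) (border-homog B A S)
        (refuted-rights B A (λ _ → false) S (par-inversion (swap sides) apart nA r))
        (refuted-lefts B A (λ _ → false) S (par-inversion sides (uniform-swap apart) nB r))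
    where
    open Elimination search (adjSym (B ⊔ A))
    apart : Uniform (adj (B ⊔ A)) false (T ∩ rights) (T ∩ lefts)
    apart = border-uniform B A (λ _ → false) (λ _ → refl)

  -- A join is refuted as soon as one of its factors is, and one factor is what `module-or-rest`
  -- yields for the module `A`.
  refuted-ssUp : ∀ {Z T} → Refuted (adj (plug B S A)) Z T → Refuted (adj (B ⊗ A)) Z T
  refuted-ssUp {T = T} r with Elimination.module-or-rest search (adjSym (plug B S A)) (swap sides)
      (border-homog B A S {T}) r
  ... | inj₁ a = ten (T ∩ lefts) (T ∩ rights) sides
                   (λ {x} {y} p q → trans (adjSym (B ⊗ A) x y) (border-uniform B A (λ _ → true) (λ _ → refl) q p))
                   (refuted-rights B A S (λ _ → true) a)
  ... | inj₂ b = ten (T ∩ rights) (T ∩ lefts) (swap sides) (border-uniform B A (λ _ → true) (λ _ → refl))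
                   (refuted-lefts B A S (λ _ → true) b)

-- The rule p↓

toΣ : ∀ n {F : Fin n → Set} → JV n F → Σ (Fin n) F
toΣ (suc n) (inj₁ x) = zero , x
toΣ (suc n) (inj₂ u) = let i , x = toΣ n u in suc i , x

fromΣ : ∀ {n} {F : Fin n → Set} (i : Fin n) → F i → JV n F
fromΣ zero    x = inj₁ x
fromΣ (suc i) x = inj₂ (fromΣ i x)

toΣ-fromΣ : ∀ {n} {F : Fin n → Set} (i : Fin n) (x : F i) → toΣ n {F} (fromΣ i x) ≡ (i , x)
toΣ-fromΣ zero    x = refl
toΣ-fromΣ {suc n} {F} (suc i) x rewrite toΣ-fromΣ {n} {F ∘ suc} i x = refl

fromΣ-toΣ : ∀ n {F : Fin n → Set} (u : JV n F) → fromΣ {n} {F} (proj₁ (toΣ n u)) (proj₂ (toΣ n u)) ≡ u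
fromΣ-toΣ (suc n) (inj₁ x) = refl
fromΣ-toΣ (suc n) (inj₂ u) = cong inj₂ (fromΣ-toΣ n u)

bigJoin-lab : ∀ {n F} (G : ∀ i → LGraph (F i)) i x → lab (bigJoin n F G) (fromΣ i x) ≡ lab (G i) x
bigJoin-lab {suc n} G zero    x = refl
bigJoin-lab {suc n} G (suc i) x = bigJoin-lab (G ∘ suc) i x

bigJoin-same : ∀ {n F} (G : ∀ i → LGraph (F i)) i x y → adj (bigJoin n F G) (fromΣ i x) (fromΣ i y) ≡ adj (G i) x y
bigJoin-same {suc n} G zero    x y = refl
bigJoin-same {suc n} G (suc i) x y = bigJoin-same (G ∘ suc) i x y

bigJoin-diff : ∀ {n F} (G : ∀ i → LGraph (F i)) i j x y → ¬ (i ≡ j)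
             → adj (bigJoin n F G) (fromΣ i x) (fromΣ j y) ≡ true
bigJoin-diff {suc n} G zero    zero    x y ne = ⊥-elim (ne refl)
bigJoin-diff {suc n} G zero    (suc j) x y ne = refl
bigJoin-diff {suc n} G (suc i) zero    x y ne = refl
bigJoin-diff {suc n} G (suc i) (suc j) x y ne = bigJoin-diff (G ∘ suc) i j x y (λ eq → ne (cong suc eq))

compose-diff : ∀ {n} (Q : LGraph (Fin n)) F (H : ∀ i → LGraph (F i)) {u v : Σ (Fin n) F} → ¬ (proj₁ u ≡ proj₁ v)
             → adj (compose Q F H) u v ≡ adj Q (proj₁ u) (proj₁ v)
compose-diff Q F H {i , x} {j , y} ne with i ≟ j
... | yes eq = ⊥-elim (ne eq)
... | no _   = refl

compose-same : ∀ {n} (Q : LGraph (Fin n)) F (H : ∀ i → LGraph (F i)) i x y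
             → adj (compose Q F H) (i , x) (i , y) ≡ adj (H i) x y
compose-same Q F H i x y with i ≟ i
... | yes refl = refl
... | no ne = ⊥-elim (ne refl)

complement-diff : ∀ {n} (P : LGraph (Fin n)) {i j} → ¬ (i ≡ j) → adj (complement P) i j ≡ not (adj P i j)
complement-diff P {i} {j} ne with i ≟ j
... | yes eq = ⊥-elim (ne eq)
... | no _   = refl

module _ {n : ℕ} (P : LGraph (Fin n)) (FM FN : Fin n → Set)
         (M : (i : Fin n) → LGraph (FM i)) (N : (i : Fin n) → LGraph (FN i)) where

  private
    F = λ i → FM i ⊎ FN i
    X = bigJoin n F (λ i → M i ⊔ N i)
    MM = compose (complement P) FM M
    NN = compose P FN N
    Y = MM ⊔ NN

  pDown-to : JV n F → Σ (Fin n) FM ⊎ Σ (Fin n) FN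
  pDown-to u = distribute (toΣ n u)
    where
    distribute : Σ (Fin n) F → Σ (Fin n) FM ⊎ Σ (Fin n) FN
    distribute (i , inj₁ x) = inj₁ (i , x)
    distribute (i , inj₂ x) = inj₂ (i , x)

  pDown-from : Σ (Fin n) FM ⊎ Σ (Fin n) FN → JV n F
  pDown-from (inj₁ (i , x)) = fromΣ i (inj₁ x)
  pDown-from (inj₂ (i , x)) = fromΣ i (inj₂ x)

  pDown-from-to : ∀ u → pDown-from (pDown-to u) ≡ u
  pDown-from-to u with toΣ n u | fromΣ-toΣ n u
  ... | i , inj₁ x | eq = eq
  ... | i , inj₂ x | eq = eq

  pDown-to-from : ∀ u → pDown-to (pDown-from u) ≡ u
  pDown-to-from (inj₁ (i , x)) rewrite toΣ-fromΣ {n} {F} i (inj₁ x) = refl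
  pDown-to-from (inj₂ (i , x)) rewrite toΣ-fromΣ {n} {F} i (inj₂ x) = refl

  pDown-lab : ∀ u → lab Y (pDown-to u) ≡ lab X u
  pDown-lab u with toΣ n u | fromΣ-toΣ n u
  ... | i , inj₁ x | refl = sym (bigJoin-lab (λ i → M i ⊔ N i) i (inj₁ x))
  ... | i , inj₂ x | refl = sym (bigJoin-lab (λ i → M i ⊔ N i) i (inj₂ x))

  module _ (search : Searchable (Σ (Fin n) FM ⊎ Σ (Fin n) FN)) where

    -- Collapsing the components turns the two composed graphs into refutations over `complement P`
    -- and over `P`. An index that is zero for both has `M i` and `N i` refuted, hence also their
    -- disjoint union, and one refuted factor refutes the join.
    refuted-pDown : ∀ {Z T} → Refuted (adj Y) Z T → Refuted (λ u v → adj X (pDown-from u) (pDown-from v)) Z T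
    refuted-pDown {Z} {T} r = cases (search (T ∩ lefts)) (search (T ∩ rights))
      where
      h : Σ (Fin n) FM ⊎ Σ (Fin n) FN → Σ (Fin n) FM ⊎ Σ (Fin n) FN → Bool
      h u v = adj X (pDown-from u) (pDown-from v)
      searchM = searchable-inj₁ search
      searchN = searchable-inj₂ search
      TM = T ∘ inj₁
      TN = T ∘ inj₂
      module CM = Collapse proj₁ {adj MM} {adj (complement P)} {Z ∘ inj₁} searchM (adjSym MM) (adjSym (complement P))
          (λ {x} {y} → compose-diff (complement P) FM M {x} {y}) TM
      module CN = Collapse proj₁ {adj NN} {adj P} {Z ∘ inj₂} searchN (adjSym NN) (adjSym P) (λ {x} {y}
          → compose-diff P FN N {x} {y}) TN
      RM = λ i → Refuted (adj MM) (Z ∘ inj₁) (CM.fibre i)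
      RN = λ i → Refuted (adj NN) (Z ∘ inj₂) (CN.fibre i)
      idx : Σ (Fin n) FM ⊎ Σ (Fin n) FN → Fin n
      idx = [ proj₁ , proj₁ ]′
      block rest : Fin n → Subset (Σ (Fin n) FM ⊎ Σ (Fin n) FN)
      block i = T ∩ decided (λ u → idx u ≟ i)
      rest i = T ∩ decided (λ u → ¬? (idx u ≟ i))
      h-diff : ∀ {u v} → ¬ (idx u ≡ idx v) → h u v ≡ true
      h-diff {inj₁ (i , x)} {inj₁ (j , y)} ne = bigJoin-diff (λ i → M i ⊔ N i) i j _ _ ne
      h-diff {inj₁ (i , x)} {inj₂ (j , y)} ne = bigJoin-diff (λ i → M i ⊔ N i) i j _ _ ne
      h-diff {inj₂ (i , x)} {inj₁ (j , y)} ne = bigJoin-diff (λ i → M i ⊔ N i) i j _ _ ne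
      h-diff {inj₂ (i , x)} {inj₂ (j , y)} ne = bigJoin-diff (λ i → M i ⊔ N i) i j _ _ ne
      whole : ∀ i → Refuted h Z (block i) → Refuted h Z T
      whole i = ten (rest i) (block i)
        (mkSplit ∩ˡ ∩ˡ (λ {u} t → case idx u ≟ i of λ { (yes a) → inj₂ (∈∩ t (∈decided a)) ; (no a) → inj₁
            (∈∩ t (∈decided a)) })
                 (λ p q → decided∈ (∩ʳ p) (decided∈ (∩ʳ q))))
        (λ {u} {v} p q → h-diff {u} {v} (λ eq → decided∈ (∩ʳ p) (trans eq (decided∈ (∩ʳ q)))))
      M-block : ∀ i → RM i → Refuted h Z (block i ∩ lefts)
      M-block i s = transport inj₁ back
          (λ x → ∈∩ (∈∩ (mem (holds (∩ˡ x))) (∈decided (decided∈ (∩ʳ x)))) (mem refl)) to (λ _ → refl) id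
          (λ {x} {y} p q → same x y (decided∈ (∩ʳ p)) (decided∈ (∩ʳ q))) (λ _ z → z) s
        where
        x₀ = proj₁ (refuted-zero s)
        back : Σ (Fin n) FM ⊎ Σ (Fin n) FN → Σ (Fin n) FM
        back = [ (λ x → x) , (λ _ → x₀) ]′
        to : ∀ {u} → u ∈ block i ∩ lefts → back u ∈ CM.fibre i
        to {inj₁ x} p = ∈∩ (mem (holds (∩ˡ (∩ˡ p)))) (∈decided (decided∈ (∩ʳ (∩ˡ p))))
        to {inj₂ x} p = case holds (∩ʳ p) of λ ()
        id : ∀ {u} → u ∈ block i ∩ lefts → inj₁ (back u) ≡ u
        id {inj₁ x} p = refl
        id {inj₂ x} p = case holds (∩ʳ p) of λ ()
        same : ∀ x y → proj₁ x ≡ i → proj₁ y ≡ i → adj MM x y ≡ h (inj₁ x) (inj₁ y)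
        same (_ , x) (_ , y) refl refl = trans (compose-same (complement P) FM M i x y)
                                           (sym (bigJoin-same (λ i → M i ⊔ N i) i (inj₁ x) (inj₁ y)))
      N-block : ∀ i → RN i → Refuted h Z (block i ∩ rights)
      N-block i s = transport inj₂ back
          (λ x → ∈∩ (∈∩ (mem (holds (∩ˡ x))) (∈decided (decided∈ (∩ʳ x)))) (mem refl)) to (λ _ → refl) id
          (λ {x} {y} p q → same x y (decided∈ (∩ʳ p)) (decided∈ (∩ʳ q))) (λ _ z → z) s
        where
        x₀ = proj₁ (refuted-zero s)
        back : Σ (Fin n) FM ⊎ Σ (Fin n) FN → Σ (Fin n) FN
        back = [ (λ _ → x₀) , (λ x → x) ]′
        to : ∀ {u} → u ∈ block i ∩ rights → back u ∈ CN.fibre i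
        to {inj₂ x} p = ∈∩ (mem (holds (∩ˡ (∩ˡ p)))) (∈decided (decided∈ (∩ʳ (∩ˡ p))))
        to {inj₁ x} p = case holds (∩ʳ p) of λ ()
        id : ∀ {u} → u ∈ block i ∩ rights → inj₂ (back u) ≡ u
        id {inj₂ x} p = refl
        id {inj₁ x} p = case holds (∩ʳ p) of λ ()
        same : ∀ x y → proj₁ x ≡ i → proj₁ y ≡ i → adj NN x y ≡ h (inj₂ x) (inj₂ y)
        same (_ , x) (_ , y) refl refl = trans (compose-same P FN N i x y)
                                           (sym (bigJoin-same (λ i → M i ⊔ N i) i (inj₂ x) (inj₂ y)))
      h-mixed : ∀ i {u v} → u ∈ block i ∩ lefts → v ∈ block i ∩ rights → h u v ≡ false
      h-mixed i {inj₂ _} p q = case holds (∩ʳ p) of λ ()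
      h-mixed i {inj₁ _} {inj₁ _} p q = case holds (∩ʳ q) of λ ()
      h-mixed i {inj₁ (j , x)} {inj₂ (k , y)} p q with decided∈ (∩ʳ (∩ˡ p)) | decided∈ (∩ʳ (∩ˡ q))
      ... | refl | refl = bigJoin-same (λ i → M i ⊔ N i) i (inj₁ x) (inj₂ y)
      both : ∀ i → RM i → RN i → Refuted h Z T
      both i m k = whole i (par (block i ∩ lefts) (block i ∩ rights) sides
        (λ a a' b → trans (h-mixed i a b) (sym (h-mixed i a' b))) (M-block i m) (N-block i k))
      only-M : ∀ i → RM i → ¬ Inhabited (CN.fibre i) → Refuted h Z T
      only-M i m e∅ = whole i (refuted-cong ∩ˡ (λ b → [ (λ l → l) , absurd ]′ (cover sides b)) (M-block i m))
        where
        absurd : ∀ {u} {A : Set} → u ∈ block i ∩ rights → A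
        absurd {inj₁ _} p = case holds (∩ʳ p) of λ ()
        absurd {inj₂ x} p = ⊥-elim (e∅ (x , ∈∩ (mem (holds (∩ˡ (∩ˡ p)))) (∈decided (decided∈ (∩ʳ (∩ˡ p))))))
      only-N : ∀ i → RN i → ¬ Inhabited (CM.fibre i) → Refuted h Z T
      only-N i m e∅ = whole i (refuted-cong ∩ˡ (λ b → [ absurd , (λ l → l) ]′ (cover sides b)) (N-block i m))
        where
        absurd : ∀ {u} {A : Set} → u ∈ block i ∩ lefts → A
        absurd {inj₂ _} p = case holds (∩ʳ p) of λ ()
        absurd {inj₁ x} p = ⊥-elim (e∅ (x , ∈∩ (mem (holds (∩ˡ (∩ˡ p)))) (∈decided (decided∈ (∩ʳ (∩ˡ p))))))
      split-M : Refuted (adj Y) Z (T ∩ lefts) → Refuted (adj MM) (Z ∘ inj₁) TM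
      split-M s with refuted-zero s
      ... | inj₂ _ , p , _ = case holds (∩ʳ p) of λ ()
      ... | inj₁ x₀ , _ , _ = transport [ (λ x → x) , (λ _ → x₀) ]′ inj₁
        (λ { {inj₁ x} p → mem (holds (∩ˡ p)) ; {inj₂ x} p → case holds (∩ʳ p) of λ () })
        (λ { (mem p) → ∈∩ (mem p) (mem refl) })
        (λ { {inj₁ x} p → refl ; {inj₂ x} p → case holds (∩ʳ p) of λ () }) (λ _ → refl)
        (λ { {inj₁ x} {inj₁ y} _ _ → refl ; {inj₂ x} p _ → case holds (∩ʳ p) of λ () ; {inj₁ x} {inj₂ y} _ p
            → case holds (∩ʳ p) of λ () })
        (λ { {inj₁ x} p z → z ; {inj₂ x} p _ → case holds (∩ʳ p) of λ () }) s
      split-N : Refuted (adj Y) Z (T ∩ rights) → Refuted (adj NN) (Z ∘ inj₂) TN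
      split-N s with refuted-zero s
      ... | inj₁ _ , p , _ = case holds (∩ʳ p) of λ ()
      ... | inj₂ x₀ , _ , _ = transport [ (λ _ → x₀) , (λ x → x) ]′ inj₂
        (λ { {inj₂ x} p → mem (holds (∩ˡ p)) ; {inj₁ x} p → case holds (∩ʳ p) of λ () })
        (λ { (mem p) → ∈∩ (mem p) (mem refl) })
        (λ { {inj₂ x} p → refl ; {inj₁ x} p → case holds (∩ʳ p) of λ () }) (λ _ → refl)
        (λ { {inj₂ x} {inj₂ y} _ _ → refl ; {inj₁ x} p _ → case holds (∩ʳ p) of λ () ; {inj₂ x} {inj₁ y} _ p
            → case holds (∩ʳ p) of λ () })
        (λ { {inj₂ x} p z → z ; {inj₁ x} p _ → case holds (∩ʳ p) of λ () }) s
      apart : Uniform (adj Y) false (T ∩ rights) (T ∩ lefts)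
      apart = border-uniform MM NN (λ _ → false) (λ _ → refl)
      open Elimination search (adjSym Y) using (par-inversion; uniform-swap)
      cases : Inhabited (T ∩ lefts) ⊎ Empty (T ∩ lefts) → Inhabited (T ∩ rights) ⊎ Empty (T ∩ rights) → Refuted h Z T
      cases (inj₂ e∅) _ =
        let i , _ , z = refuted-zero (CN.collapse (split-N (refuted-cong (λ t → [ (λ l → ⊥-elim (e∅ l)) , (λ x → x) ]′ (cover sides t)) ∩ˡ r)))
        in only-N i z (λ (x , p) → e∅ {inj₁ x} (∈∩ (mem (holds (∩ˡ p))) (mem refl)))
      cases (inj₁ _) (inj₂ e∅) =
        let i , _ , z = refuted-zero (CM.collapse (split-M (refuted-cong (λ t → [ (λ x → x) , (λ l → ⊥-elim (e∅ l)) ]′ (cover sides t)) ∩ˡ r)))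
        in only-M i z (λ (x , p) → e∅ {inj₂ x} (∈∩ (mem (holds (∩ˡ p))) (mem refl)))
      -- `T` may meet the `M` and `N` components at different indices. A zero index occupied on one
      -- side only already refutes its block; otherwise both refutations restrict to the common
      -- indices.
      cases (inj₁ nM) (inj₁ nN)
        with refuted-remove CN.support (CM.collapse (split-M (par-inversion sides (uniform-swap apart) nM r)))
           | refuted-remove CM.support (CN.collapse (split-N (par-inversion (swap sides) apart nN r)))
      ... | inj₂ (i , _ , i∉ , z) | _ = only-M i z (λ o → i∉ (∈decided o))
      ... | inj₁ _ | inj₂ (i , _ , i∉ , z) = only-N i z (λ o → i∉ (∈decided o))
      ... | inj₁ m | inj₁ k =
        let i , _ , zm , zk = refuted-complement (searchable-Fin n) (adjSym P) (complement-diff P) m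
                                (refuted-∩-comm k)
        in both i zm zk

-- The two new vertices are linked to each other and form a module. A closed set meeting this module
-- contains both of them, with opposite colours, and `par-inversion` at the one coloured 1 shows
-- that they are not refuted. So the rest is refuted, against the invariant of the premise.
linked-aiDown : {W : Set} (C : LGraph W) (R : W → Bool) (a : Atom)
              → Linked (plug C R emptyL) → Linked (plug C R (single (dual a) ⊔ single a))
linked-aiDown {W} C R a L = record
  { search = search' ; β = β' ; β-invol = invol ; β-dual = dual' ; irrefutable = irref }
  where
  open Linked L
  U = One ⊎ One
  G = plug C R (single (dual a) ⊔ single a)
  β' : W ⊎ U → W ⊎ U
  β' (inj₁ x) = [ inj₁ , (λ ()) ]′ (β (inj₁ x))
  β' (inj₂ (inj₁ ⋆)) = inj₂ (inj₂ ⋆)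
  β' (inj₂ (inj₂ ⋆)) = inj₂ (inj₁ ⋆)
  invol : ∀ u → β' (β' u) ≡ u
  invol (inj₁ x) with β (inj₁ x) | β-invol (inj₁ x)
  ... | inj₁ y | eq rewrite eq = refl
  invol (inj₂ (inj₁ ⋆)) = refl
  invol (inj₂ (inj₂ ⋆)) = refl
  dual-invol : ∀ b → b ≡ dual (dual b)
  dual-invol (var x)  = refl
  dual-invol (dvar x) = refl
  dual' : ∀ u → lab G (β' u) ≡ dual (lab G u)
  dual' (inj₁ x) with β (inj₁ x) | β-dual (inj₁ x)
  ... | inj₁ y | eq = eq
  dual' (inj₂ (inj₁ ⋆)) = dual-invol a
  dual' (inj₂ (inj₂ ⋆)) = refl
  searchOne : Searchable One
  searchOne S = [ (λ p → inj₁ (⋆ , p)) , (λ p → inj₂ (λ { {⋆} → p })) ]′ (∈-dec S ⋆)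
  search' : Searchable (W ⊎ U)
  search' = searchable-⊎ (searchable-inj₁ search) (searchable-⊎ searchOne searchOne)
  irref : (D : Subset (W ⊎ U)) (c : W ⊎ U → Bool) → (∀ {x} → x ∈ D → β' x ∈ D)
        → (∀ {x} → x ∈ D → c (β' x) ≡ not (c x)) → ¬ Refuted (adj G) (λ x → c x ≡ false) D
  irref D c closed anti r
    with Elimination.module-or-rest search' (adjSym G) (swap (sides {T = D})) (border-homog C
        (single (dual a) ⊔ single a) R) r
  ... | inj₁ m = pair (c (inj₂ (inj₁ ⋆))) refl
    where
    open Elimination search' (adjSym G) using (par-inversion)
    l r' : W ⊎ U
    l = inj₂ (inj₁ ⋆)
    r' = inj₂ (inj₂ ⋆)
    at : W ⊎ U → Subset (W ⊎ U)
    at (inj₁ x) = λ _ → false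
    at (inj₂ (inj₁ ⋆)) = [ (λ _ → false) , [ (λ _ → true) , (λ _ → false) ]′ ]′
    at (inj₂ (inj₂ ⋆)) = [ (λ _ → false) , [ (λ _ → false) , (λ _ → true) ]′ ]′
    both : l ∈ D × r' ∈ D
    both with refuted-zero m
    ... | inj₁ _ , p , _ = case holds (∩ʳ p) of λ ()
    ... | inj₂ (inj₁ ⋆) , p , _ = ∩ˡ p , closed (∩ˡ p)
    ... | inj₂ (inj₂ ⋆) , p , _ = closed (∩ˡ p) , ∩ˡ p
    split : Split (D ∩ rights) (at l) (at r')
    split = mkSplit (λ { {inj₂ (inj₁ ⋆)} _ → ∈∩ (proj₁ both) (mem refl) ; {inj₁ _} (mem ()) ; {inj₂ (inj₂ _)} (mem ()) })
                    (λ { {inj₂ (inj₂ ⋆)} _ → ∈∩ (proj₂ both) (mem refl) ; {inj₁ _} (mem ()) ; {inj₂ (inj₁ _)} (mem ()) })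
                    (λ { {inj₁ _} p → case holds (∩ʳ p) of λ () ; {inj₂ (inj₁ ⋆)} _ → inj₁ (mem refl) ; {inj₂
                        (inj₂ ⋆)} _ → inj₂ (mem refl) })
                    (λ { {inj₁ _} (mem ()) _ ; {inj₂ (inj₂ _)} (mem ()) _ ; {inj₂ (inj₁ _)} _ (mem ()) })
    apart : Uniform (adj G) false (at l) (at r')
    apart {inj₁ _} (mem ()) _
    apart {inj₂ (inj₂ _)} (mem ()) _
    apart {inj₂ (inj₁ _)} {inj₁ _} _ (mem ())
    apart {inj₂ (inj₁ _)} {inj₂ (inj₁ _)} _ (mem ())
    apart {inj₂ (inj₁ _)} {inj₂ (inj₂ _)} _ _ = refl
    apart' : Uniform (adj G) false (at r') (at l)
    apart' {x} {y} p q = trans (adjSym G x y) (apart q p)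
    at-l : ∀ {u} → u ∈ at l → u ≡ l
    at-l {inj₂ (inj₁ ⋆)} _ = refl
    at-l {inj₁ _} (mem ())
    at-l {inj₂ (inj₂ _)} (mem ())
    at-r : ∀ {u} → u ∈ at r' → u ≡ r'
    at-r {inj₂ (inj₂ ⋆)} _ = refl
    at-r {inj₁ _} (mem ())
    at-r {inj₂ (inj₁ _)} (mem ())
    pair : ∀ b → c l ≡ b → ⊥
    pair true  eq with refuted-zero (par-inversion split apart (l , mem refl) m)
    ... | u , p , z = case trans (sym eq) (trans (cong c (sym (at-l p))) z) of λ ()
    pair false eq with refuted-zero (par-inversion (swap split) apart' (r' , mem refl) m)
    ... | u , p , z = case trans (sym (trans (anti (proj₁ both)) (cong not eq))) (trans (cong c (sym (at-r p))) z) of λ ()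
  ... | inj₂ s with refuted-zero s
  ...   | inj₂ _ , p , _ = case holds (∩ʳ p) of λ ()
  ...   | inj₁ x₀ , _ , _ = irrefutable D⁻ c⁻ closed⁻ anti⁻
            (transport drop add (λ { {inj₁ x} p → mem (holds (∩ˡ p)) ; {inj₂ x} p → case holds (∩ʳ p) of λ () })
               (λ { {inj₁ x} (mem p) → ∈∩ (mem p) (mem refl) })
               (λ { {inj₁ x} p → refl ; {inj₂ x} p → case holds (∩ʳ p) of λ () }) (λ { {inj₁ x} _ → refl })
               (λ { {inj₁ x} {inj₁ y} _ _ → refl ; {inj₂ x} p _ → case holds (∩ʳ p) of λ () ; {inj₁ x} {inj₂ y} _ p
                   → case holds (∩ʳ p) of λ () })
               (λ { {inj₁ x} p z → z ; {inj₂ x} p _ → case holds (∩ʳ p) of λ () }) s)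
    where
    drop : W ⊎ U → W ⊎ ⊥
    drop = [ inj₁ , (λ _ → inj₁ x₀) ]′
    add : W ⊎ ⊥ → W ⊎ U
    add = [ inj₁ , (λ ()) ]′
    D⁻ : Subset (W ⊎ ⊥)
    D⁻ = D ∘ add
    c⁻ : W ⊎ ⊥ → Bool
    c⁻ = c ∘ add
    closed⁻ : ∀ {x} → x ∈ D⁻ → β x ∈ D⁻
    closed⁻ {inj₁ x} (mem p) with β (inj₁ x) | closed {inj₁ x} (mem p)
    ... | inj₁ y | mem q = mem q
    anti⁻ : ∀ {x} → x ∈ D⁻ → c⁻ (β x) ≡ not (c⁻ x)
    anti⁻ {inj₁ x} (mem p) with β (inj₁ x) | anti {inj₁ x} (mem p)
    ... | inj₁ y | q = q

linked-rule : {W : Set} (C : LGraph W) (R : W → Bool) (p : Pair) → GSssUp p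
            → Linked (plug C R (Pair.X p)) → Linked (plug C R (Pair.Y p))
linked-rule C R _ (inj₁ (aiDown a)) = linked-aiDown C R a
linked-rule C R _ (inj₂ (inj₁ (ssDown B A S _ _))) =
  linked-context C R _ _ (λ x → x) (λ x → x) (λ _ → refl) (λ _ → refl)
    (λ { (inj₁ _) → refl ; (inj₂ _) → refl }) (refuted-ssDown B A S)
linked-rule C R _ (inj₂ (inj₂ (inj₁ (pDown n P _ _ FM FN M N _)))) =
  linked-context C R _ _ (pDown-to P FM FN M N) (pDown-from P FM FN M N) (pDown-from-to P FM FN M N)
    (pDown-to-from P FM FN M N) (pDown-lab P FM FN M N) (refuted-pDown P FM FN M N)
linked-rule C R _ (inj₂ (inj₂ (inj₂ (ssUp B A S _ _)))) =
  linked-context C R _ _ (λ x → x) (λ x → x) (λ _ → refl) (λ _ → refl)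
    (λ { (inj₁ _) → refl ; (inj₂ _) → refl }) (refuted-ssUp B A S)

linked-step : ∀ {G H} → Step GSssUp G H → Linked (proj₂ G) → Linked (proj₂ H)
linked-step (isoStep i) L = linked-≅ i L
linked-step (ruleStep C R p rule i j) L = linked-≅ (≅-flip j) (linked-rule C R p rule (linked-≅ i L))

linked-∅ : Linked (proj₂ ∅G)
linked-∅ = record { search = searchable-Fin 0 ; β = λ () ; β-invol = λ () ; β-dual = λ ()
                  ; irrefutable = λ D c _ _ r → case proj₁ (refuted-zero r) of λ () }

provable⇒linked : ∀ A → Provable GSssUp A → Linked (proj₂ A)
provable⇒linked A = go linked-∅
  where
  go : ∀ {G H} → Linked (proj₂ G) → Star (Step GSssUp) G H → Linked (proj₂ H)
  go L ε        = L
  go L (s ◅ ss) = go (linked-step s L) ss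

-- Graph isomorphisms and derivations in {ai↓, sw}

≅-refl : {V : Set} {G : LGraph V} → G ≅ G
≅-refl = record { bij = ↔-refl _ ; labPres = λ _ → refl ; adjPres = λ _ _ → refl }

≅-trans : {U V W : Set} {G : LGraph U} {H : LGraph V} {K : LGraph W} → G ≅ H → H ≅ K → G ≅ K
≅-trans i j = record
  { bij = ↔-trans (bij i) (bij j)
  ; labPres = λ x → trans (labPres j _) (labPres i x)
  ; adjPres = λ x y → trans (adjPres j _ _) (adjPres i x y) }
  where open _≅_

module _ {V W V' W' : Set} {C : LGraph V} {C' : LGraph V'} {X : LGraph W} {X' : LGraph W'} {R : V → Bool} {R' : V'
    → Bool} where

  plug-cong : (i : C ≅ C') → (∀ x → R' (Inverse.to (_≅_.bij i) x) ≡ R x) → X ≅ X' → plug C R X ≅ plug C' R' X'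
  plug-cong i r j = record
    { bij = bij i ⊎-↔ bij j
    ; labPres = λ { (inj₁ x) → labPres i x ; (inj₂ x) → labPres j x }
    ; adjPres = λ { (inj₁ x) (inj₁ y) → adjPres i x y ; (inj₁ x) (inj₂ y) → r x
                  ; (inj₂ y) (inj₁ x) → r x ; (inj₂ x) (inj₂ y) → adjPres j x y } }
    where open _≅_

module _ {V W : Set} (C : LGraph V) (X : LGraph W) where

  -- Borders are compared only in the presence of a vertex of `X`: around an empty graph any two
  -- borders agree.
  plug-border : {R S : V → Bool} → (∀ x → W → R x ≡ S x) → plug C R X ≅ plug C S X
  plug-border r = record
    { bij = ↔-refl _ ; labPres = λ { (inj₁ _) → refl ; (inj₂ _) → refl }
    ; adjPres = λ { (inj₁ x) (inj₁ y) → refl ; (inj₁ x) (inj₂ y) → sym (r x y)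
                  ; (inj₂ y) (inj₁ x) → sym (r x y) ; (inj₂ x) (inj₂ y) → refl } }

  plug-comm : ∀ b → plug C (λ _ → b) X ≅ plug X (λ _ → b) C
  plug-comm b = record
    { bij = mk↔ₛ′ ⊎-swap ⊎-swap (λ { (inj₁ _) → refl ; (inj₂ _) → refl }) (λ { (inj₁ _) → refl ; (inj₂ _) → refl })
    ; labPres = λ { (inj₁ _) → refl ; (inj₂ _) → refl }
    ; adjPres = λ { (inj₁ x) (inj₁ y) → refl ; (inj₁ x) (inj₂ y) → refl
                  ; (inj₂ y) (inj₁ x) → refl ; (inj₂ x) (inj₂ y) → refl } }

module _ {U V W : Set} (C : LGraph U) (D : LGraph V) (X : LGraph W) where

  plug-assoc : ∀ {R S} → plug C R (plug D S X) ≅ plug (plug C R D) [ R , S ]′ X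
  plug-assoc = record
    { bij = mk↔ₛ′ (λ { (inj₁ x) → inj₁ (inj₁ x) ; (inj₂ (inj₁ x)) → inj₁ (inj₂ x) ; (inj₂ (inj₂ x)) → inj₂ x })
                  (λ { (inj₁ (inj₁ x)) → inj₁ x ; (inj₁ (inj₂ x)) → inj₂ (inj₁ x) ; (inj₂ x) → inj₂ (inj₂ x) })
                  (λ { (inj₁ (inj₁ x)) → refl ; (inj₁ (inj₂ x)) → refl ; (inj₂ x) → refl })
                  (λ { (inj₁ x) → refl ; (inj₂ (inj₁ x)) → refl ; (inj₂ (inj₂ x)) → refl })
    ; labPres = λ { (inj₁ _) → refl ; (inj₂ (inj₁ _)) → refl ; (inj₂ (inj₂ _)) → refl }
    ; adjPres = λ { (inj₁ _) (inj₁ _) → refl ; (inj₁ _) (inj₂ (inj₁ _)) → refl ; (inj₁ _) (inj₂ (inj₂ _)) → refl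
                  ; (inj₂ (inj₁ _)) (inj₁ _) → refl ; (inj₂ (inj₁ _)) (inj₂ (inj₁ _)) → refl ; (inj₂ (inj₁ _)) (inj₂
                      (inj₂ _)) → refl
                  ; (inj₂ (inj₂ _)) (inj₁ _) → refl ; (inj₂ (inj₂ _)) (inj₂ (inj₁ _)) → refl ; (inj₂ (inj₂ _)) (inj₂
                      (inj₂ _)) → refl } }

  ⊔-assoc : (C ⊔ (D ⊔ X)) ≅ ((C ⊔ D) ⊔ X)
  ⊔-assoc = ≅-trans plug-assoc (plug-border (C ⊔ D) X (λ { (inj₁ _) _ → refl ; (inj₂ _) _ → refl }))

plug-∅ʳ : {V E : Set} (C : LGraph V) (X : LGraph E) {R : V → Bool} → ¬ E → plug C R X ≅ C
plug-∅ʳ C X e = record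
  { bij = mk↔ₛ′ [ (λ x → x) , (λ y → ⊥-elim (e y)) ]′ inj₁ (λ _ → refl) (λ { (inj₁ _) → refl ; (inj₂ y) → ⊥-elim (e y) })
  ; labPres = λ { (inj₁ _) → refl ; (inj₂ y) → ⊥-elim (e y) }
  ; adjPres = λ { (inj₁ _) (inj₁ _) → refl ; (inj₁ _) (inj₂ y) → ⊥-elim (e y) ; (inj₂ y) _ → ⊥-elim (e y) } }

plug-∅ˡ : {V : Set} (X : LGraph V) {R : ⊥ → Bool} → plug emptyL R X ≅ X
plug-∅ˡ X = record
  { bij = mk↔ₛ′ [ (λ ()) , (λ x → x) ]′ inj₂ (λ _ → refl) (λ { (inj₁ ()) ; (inj₂ _) → refl })
  ; labPres = λ { (inj₁ ()) ; (inj₂ _) → refl } ; adjPres = λ { (inj₁ ()) ; (inj₂ _) (inj₁ ()) ; (inj₂ _) (inj₂ _)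
      → refl } }

-- A switch is an instance of ss↑ with S = V_B, unless one of A, C is empty and the switch is an isomorphism.
sw⇒ssUp : ∀ {G H} → Step AiSw G H → Step GSssUp G H
sw⇒ssUp (isoStep i) = isoStep i
sw⇒ssUp (ruleStep C R p (inj₁ r) i j) = ruleStep C R p (inj₁ r) i j
sw⇒ssUp {G} {H} (ruleStep C R _ (inj₂ (sw {VA} {VB} {VC} A B D)) i j) =
  cases (searchA (λ _ → true)) (searchD (λ _ → true))
  where
  searchX : Searchable ((VA ⊎ VB) ⊎ VC)
  searchX = searchable-inj₂ (searchable-retract (Inverse.to (_≅_.bij i)) (Inverse.from (_≅_.bij i))
              (Inverse.strictlyInverseˡ (_≅_.bij i)) (searchable-Fin _))
  searchA : Searchable VA
  searchA = searchable-inj₁ (searchable-inj₁ searchX)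
  searchD : Searchable VC
  searchD = searchable-inj₂ searchX
  S : VA ⊎ VB → Bool
  S = [ (λ _ → false) , (λ _ → true) ]′
  j' : proj₂ H ≅ plug C R (plug (A ⊔ B) S D)
  j' = ≅-trans j (plug-cong ≅-refl (λ _ → refl) (plug-assoc A B D))
  trivial : (∀ x → VC → true ≡ S x) → Step GSssUp G H
  trivial eq = isoStep (≅-trans i (≅-trans (plug-cong ≅-refl (λ _ → refl) (plug-border (A ⊔ B) D eq)) (≅-flip j')))
  cases : Inhabited (λ _ → true) ⊎ Empty (λ _ → true) → Inhabited (λ _ → true) ⊎ Empty (λ _ → true) → Step GSssUp G H
  cases (inj₂ e) _ = trivial λ { (inj₁ a) _ → ⊥-elim (e {a} (mem refl)) ; (inj₂ _) _ → refl }
  cases (inj₁ _) (inj₂ e) = trivial λ _ d → ⊥-elim (e {d} (mem refl))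
  cases (inj₁ (a , _)) (inj₁ (d , _)) =
    ruleStep C R _ (inj₂ (inj₂ (inj₂ (ssUp (A ⊔ B) D S (inj₁ a , refl) d)))) i j'

AiSw⇒GSssUp : ∀ {G H} → Star (Step AiSw) G H → Star (Step GSssUp) G H
AiSw⇒GSssUp ε        = ε
AiSw⇒GSssUp (s ◅ ss) = sw⇒ssUp s ◅ AiSw⇒GSssUp ss

-- Provability of graphs on arbitrary finite vertex types

Finite : Set → Set
Finite V = Σ[ n ∈ ℕ ] (V ↔ Fin n)

finite-⊎ : {V W : Set} → Finite V → Finite W → Finite (V ⊎ W)
finite-⊎ (m , f) (n , g) = _ , ↔-trans (f ⊎-↔ g) (↔-sym +↔⊎)

finite-One : Finite One
finite-One = 1 , mk↔ₛ′ (λ _ → zero) (λ _ → ⋆) (λ { zero → refl }) (λ { ⋆ → refl })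

finite-⊥ : Finite ⊥
finite-⊥ = 0 , mk↔ₛ′ (λ ()) (λ ()) (λ ()) (λ ())

-- Derivations run through graphs on `Fin n`, while trees give graphs on nested sums. Asking for all
-- numberings makes the notion invariant under isomorphism; `Finite` supplies a numbering wherever
-- an intermediate graph has to be named.
Prov : {V : Set} → LGraph V → Set₁
Prov G = ∀ {n} (g : LGraph (Fin n)) → g ≅ G → Provable AiSw (n , g)

prov-≅ : {V W : Set} {G : LGraph V} {H : LGraph W} → G ≅ H → Prov G → Prov H
prov-≅ i p g j = p g (≅-trans j (≅-flip i))

relabel : {V : Set} (G : LGraph V) → ((n , _) : Finite V) → Σ[ g ∈ LGraph (Fin n) ] g ≅ G
relabel G (n , f) = g , record { bij = ↔-sym f ; labPres = λ _ → refl ; adjPres = λ _ _ → refl }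
  where
  open Inverse f
  g : LGraph (Fin n)
  g = record { lab = λ i → lab G (from i) ; adj = λ i j → adj G (from i) (from j)
             ; adjSym = λ i j → adjSym G _ _ ; adjIrr = λ i → adjIrr G _ }

prov-rule : {U W : Set} {K : LGraph U} → Finite U → (C : LGraph W) (R : W → Bool) (p : Pair) → AiSw p
          → K ≅ plug C R (Pair.X p) → Prov K → Prov (plug C R (Pair.Y p))
prov-rule fin C R p r i k h j with relabel _ fin
... | g , l = k g l ◅◅ ruleStep C R p r (≅-trans l i) j ◅ ε

prov-∅ : Prov emptyL
prov-∅ g i = isoStep (≅-trans (record { bij = mk↔ₛ′ (λ ()) (λ ()) (λ ()) (λ ()) ; labPres = λ () ; adjPres = λ () })
    (≅-flip i)) ◅ ε

module _ {W : Set} (C : LGraph W) (R : W → Bool) (fin : Finite W) where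

  prov-star : ∀ {G H} → Star (Step AiSw) G H → Prov (plug C R (proj₂ G)) → Prov (plug C R (proj₂ H))
  prov-star ε q = q
  prov-star (isoStep i ◅ ss) q = prov-star ss (prov-≅ (plug-cong ≅-refl (λ _ → refl) i) q)
  prov-star (_◅_ {G} (ruleStep D S p r i j) ss) q = prov-star ss
    (prov-≅ (≅-trans (≅-flip (plug-assoc C D _)) (plug-cong ≅-refl (λ _ → refl) (≅-flip j)))
      (prov-rule {K = plug C R (proj₂ G)} (finite-⊎ fin (_ , ↔-refl _)) (plug C R D) [ R , S ]′ p r
        (≅-trans (plug-cong ≅-refl (λ _ → refl) i) (plug-assoc C D _)) q))

  -- `C` is `C` with the empty graph plugged in, and from there the derivation of `X` is run inside
  -- the context; contexts compose by `plug-assoc`.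
  prov-context : {V : Set} {X : LGraph V} → Finite V → Prov X → Prov C → Prov (plug C R X)
  prov-context {X = X} f x c with relabel X f
  ... | g , i = prov-≅ (plug-cong ≅-refl (λ _ → refl) i) (prov-star (x g i) (prov-≅ (≅-flip (plug-∅ʳ C _ λ ())) c))

-- A list of trees stands for the disjoint union of its members, ten Γ Δ for the join of Γ and Δ.
data Tree (V : Set) : Set where
  leaf : V → Tree V
  ten  : List (Tree V) → List (Tree V) → Tree V

module Semantics {V : Set} (label : V → Atom) where

  Pos : Tree V → Set
  Pos* : List (Tree V) → Set
  Pos (leaf _)  = One
  Pos (ten Γ Δ) = Pos* Γ ⊎ Pos* Δ
  Pos* []      = ⊥
  Pos* (t ∷ Γ) = Pos t ⊎ Pos* Γ

  graph : (t : Tree V) → LGraph (Pos t)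
  graph* : (Γ : List (Tree V)) → LGraph (Pos* Γ)
  graph (leaf v)  = single (label v)
  graph (ten Γ Δ) = graph* Γ ⊗ graph* Δ
  graph* []      = emptyL
  graph* (t ∷ Γ) = graph t ⊔ graph* Γ

  finite : (t : Tree V) → Finite (Pos t)
  finite* : (Γ : List (Tree V)) → Finite (Pos* Γ)
  finite (leaf _)  = finite-One
  finite (ten Γ Δ) = finite-⊎ (finite* Γ) (finite* Δ)
  finite* []      = finite-⊥
  finite* (t ∷ Γ) = finite-⊎ (finite t) (finite* Γ)

  graph-++ : ∀ Γ Δ → graph* (Γ ++ Δ) ≅ (graph* Γ ⊔ graph* Δ)
  graph-++ []      Δ = ≅-flip (plug-∅ˡ _)
  graph-++ (t ∷ Γ) Δ = ≅-trans (plug-cong ≅-refl (λ _ → refl) (graph-++ Γ Δ)) (⊔-assoc _ _ _)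

  graph-↭ : ∀ {Γ Δ} → Γ ↭ Δ → graph* Γ ≅ graph* Δ
  graph-↭ ↭.refl         = ≅-refl
  graph-↭ (↭.prep t p)   = plug-cong ≅-refl (λ _ → refl) (graph-↭ p)
  graph-↭ (↭.swap t u p) = ≅-trans (⊔-assoc _ _ _) (≅-trans
    (plug-cong (plug-comm _ _ false) (λ _ → refl) (graph-↭ p)) (≅-flip (⊔-assoc _ _ _)))
  graph-↭ (↭.trans p q)  = ≅-trans (graph-↭ p) (graph-↭ q)

  -- A sequent calculus for multiplicative linear logic with mix at the level of trees. The switch
  -- enters twice: `split` is the tensor rule, and `merge` moves whole trees into one side of a
  -- tensor.
  data Derivable : List (Tree V) → Set where
    nil   : Derivable []
    ax    : ∀ {x y Γ} → label x ≡ dual (label y) → Derivable Γ → Derivable (leaf x ∷ leaf y ∷ Γ)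
    split : ∀ {H K Γ} → Derivable H → Derivable (K ++ Γ) → Derivable (ten H K ∷ Γ)
    merge : ∀ {H K} N {Γ} → Derivable (ten (N ++ H) K ∷ Γ) → Derivable (ten H K ∷ N ++ Γ)
    flip  : ∀ {H K Γ} → Derivable (ten K H ∷ Γ) → Derivable (ten H K ∷ Γ)
    perm  : ∀ {Γ Δ} → Γ ↭ Δ → Derivable Γ → Derivable Δ

  sound : ∀ {Γ} → Derivable Γ → Prov (graph* Γ)
  sound nil = prov-∅
  sound (ax {x} {y} {Γ} eq d) = prov-≅ iso
      (prov-rule (finite* Γ) (graph* Γ) (λ _ → false) _ (inj₁ (aiDown (label y))) (≅-flip (plug-∅ʳ _ _ λ ())) (sound d))
    where
    iso : (graph* Γ ⊔ (single (dual (label y)) ⊔ single (label y))) ≅ graph* (leaf x ∷ leaf y ∷ Γ)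
    iso rewrite eq = ≅-trans (plug-comm _ _ false) (≅-flip (⊔-assoc _ _ _))
  -- `H` is derived alone, then `K ++ Γ` inside the context in which it is joined to all of `H`; the
  -- switch finally releases `Γ` from the join.
  sound (split {H} {K} {Γ} d d') = prov-≅
      (≅-trans (plug-∅ˡ _ {λ _ → false}) (≅-trans (plug-comm _ _ false)
          (plug-cong (plug-comm _ _ true) (λ _ → refl) ≅-refl)))
      (prov-rule {K = graph* H ⊗ graph* (K ++ Γ)} (finite-⊎ (finite* H) (finite* (K ++ Γ))) emptyL (λ _ → false) _
        (inj₂ (sw (graph* Γ) (graph* K) (graph* H)))
        (≅-trans (plug-comm _ _ true) (≅-trans (plug-cong (≅-trans (graph-++ K Γ) (plug-comm _ _ false)) (λ _
            → refl) ≅-refl)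
                 (≅-flip (plug-∅ˡ _ {λ _ → false}))))
        (prov-context (graph* H) (λ _ → true) (finite* H) (finite* (K ++ Γ)) (sound d') (sound d)))
  sound (merge {H} {K} N {Γ} d) = prov-≅
      (≅-trans (plug-cong ≅-refl (λ _ → refl) (plug-comm _ _ false)) (≅-trans (plug-comm _ _ false)
        (≅-trans (≅-flip (⊔-assoc _ _ _)) (plug-cong ≅-refl (λ _ → refl) (≅-flip (graph-++ N Γ))))))
      (prov-rule (finite* (ten (N ++ H) K ∷ Γ)) (graph* Γ) (λ _ → false) _ (inj₂ (sw (graph* N) (graph* H) (graph* K)))
        (≅-trans (plug-comm _ _ false) (plug-cong ≅-refl (λ _ → refl) (plug-cong (graph-++ N H) (λ _ → refl) ≅-refl)))
            (sound d))
  sound (flip d) = prov-≅ (plug-cong (plug-comm _ _ true) (λ _ → refl) ≅-refl) (sound d)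
  sound (perm p d) = prov-≅ (graph-↭ p) (sound d)

-- Cographs as trees

sift : {A : Set} {P : A → Set} → Decidable P → (xs : List A)
     → Σ[ ys ∈ List A ] Σ[ zs ∈ List A ] (xs ↭ ys ++ zs × All P ys × All (¬_ ∘ P) zs)
sift P? [] = [] , [] , ↭-refl , [] , []
sift P? (x ∷ xs) with P? x | sift P? xs
... | yes p | ys , zs , eq , ps , ns = x ∷ ys , zs , ↭.prep x eq , p ∷ ps , ns
... | no ¬p | ys , zs , eq , ps , ns = ys , x ∷ zs , ↭-trans (↭.prep x eq) (↭-sym (shift x ys zs)) , ps , ¬p ∷ ns

unique-↭ : {A : Set} {xs ys : List A} → xs ↭ ys → Unique xs → Unique ys
unique-↭ ↭.refl u = u
unique-↭ (↭.prep x p) (x∉ ∷ u) = All-resp-↭ p x∉ ∷ unique-↭ p u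
unique-↭ (↭.swap x y p) ((x≢y ∷ x∉) ∷ (y∉ ∷ u)) =
  ((x≢y ∘ sym) ∷ All-resp-↭ p y∉) ∷ (All-resp-↭ p x∉ ∷ unique-↭ p u)
unique-↭ (↭.trans p q) u = unique-↭ q (unique-↭ p u)

unique-++ : {A : Set} (xs : List A) {ys : List A} → Unique (xs ++ ys)
          → Unique xs × Unique ys × (∀ {x} → x ∈ˡ xs → x ∈ˡ ys → ⊥)
unique-++ []       u = [] , u , λ ()
unique-++ (x ∷ xs) (x∉ ∷ u) with unique-++ xs u
... | uxs , uys , dis = All.tabulate (λ y∈ → All.lookup x∉ (∈-++⁺ˡ y∈)) ∷ uxs , uys
      , λ { (here refl) y∈ → All.lookup x∉ (∈-++⁺ʳ xs y∈) refl ; (there p) q → dis p q }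

module Cotree {V : Set} (G : LGraph V) (cograph : ¬ InducedP4 G) where

  private
    e = adj G

    differ : ∀ {x y z} → e x z ≡ true → e y z ≡ false → ¬ (x ≡ y)
    differ p q refl = case trans (sym p) q of λ ()

    p4-free : ∀ {a b c d} → e a b ≡ true → e b c ≡ true → e c d ≡ true
            → e a c ≡ false → e a d ≡ false → e b d ≡ false → ⊥
    p4-free {a} {b} {c} {d} ab bc cd ac ad bd = cograph (a , b , c , d
      , differ ab (adjIrr G b) , differ cd ad ∘ sym , differ ab (trans (adjSym G d b) bd)
      , differ bc (adjIrr G c) , (λ { refl → case trans (sym ab) ad of λ () }) , differ cd (adjIrr G d)
      , ab , bc , cd , ac , ad , bd)

    not-b : ∀ {a b} → ¬ (a ≡ b) → a ≡ not b
    not-b {false} {false} ne = ⊥-elim (ne refl)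
    not-b {false} {true}  ne = refl
    not-b {true}  {false} ne = refl
    not-b {true}  {true}  ne = ⊥-elim (ne refl)

    -- The path on four vertices is self-complementary: for `b = true` the forbidden path is `v`,
    -- `o`, `x`, `n`.
    no-alternation : ∀ b {o n v x} → e o n ≡ not b → e n v ≡ not b → e v x ≡ not b
                   → e o v ≡ b → e o x ≡ b → e n x ≡ b → ⊥
    no-alternation false on nv vx ov ox nx = p4-free on nv vx ov ox nx
    no-alternation true  on nv vx ov ox nx =
      p4-free (trans (adjSym G _ _) ov) ox (trans (adjSym G _ _) nx) vx (trans (adjSym G _ _) nv) on

  record Bipartition (S : List V) : Set where
    constructor bipartition
    field
      {S₁ S₂}  : List V
      type     : Bool
      split    : S ↭ S₁ ++ S₂
      member₁  : Σ[ x ∈ V ] x ∈ˡ S₁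
      member₂  : Σ[ x ∈ V ] x ∈ˡ S₂
      uniform  : ∀ {x y} → x ∈ˡ S₁ → y ∈ˡ S₂ → e x y ≡ type

  private
    -- A pair from `O` and `N` of the wrong type would extend through `v` to `x`, giving a path on
    -- four vertices in the graph or in its complement.
    separate : ∀ {v b S₁ S₂ O N x} → S₁ ↭ O ++ N → All (λ y → e v y ≡ b) O → All (λ y → ¬ (e v y ≡ b)) N
             → (∀ {x y} → x ∈ˡ S₁ → y ∈ˡ S₂ → e x y ≡ b) → x ∈ˡ S₂ → ¬ (e v x ≡ b)
             → ∀ {o y} → o ∈ˡ O → y ∈ˡ v ∷ N ++ S₂ → e o y ≡ b
    separate p os ns u x∈ vx o∈ (here refl) = trans (adjSym G _ _) (All.lookup os o∈)
    separate {v} {b} {O = O} {N} p os ns u x∈ vx {o} {y} o∈ (there y∈) with ∈-++⁻ N y∈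
    ... | inj₂ y∈S₂ = u (∈-resp-↭ (↭-sym p) (∈-++⁺ˡ o∈)) y∈S₂
    ... | inj₁ y∈N with e o y ≟ᵇ b
    ...   | yes eq = eq
    ...   | no ne  = ⊥-elim (no-alternation b (not-b ne) (trans (adjSym G _ _) (not-b (All.lookup ns y∈N))) (not-b vx)
                       (trans (adjSym G _ _) (All.lookup os o∈)) (u (∈-resp-↭ (↭-sym p) (∈-++⁺ˡ o∈)) x∈)
                       (u (∈-resp-↭ (↭-sym p) (∈-++⁺ʳ O y∈N)) x∈))

    bring : ∀ {v : V} {S S₁ S₂} O N → S ↭ S₁ ++ S₂ → S₁ ↭ O ++ N → v ∷ S ↭ O ++ (v ∷ N ++ S₂)
    bring {v} {S₂ = S₂} O N p q = ↭-trans (↭.prep v (↭-trans p (↭-trans (++⁺ʳ S₂ q) (↭-reflexive (++-assoc O N S₂)))))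
                               (↭-sym (shift v O (N ++ S₂)))

    -- If `v` is of type `b` towards all of one part, it joins the other part. Otherwise it has
    -- exceptions in both parts; the vertices of one part towards which it is of type `b`, if there
    -- are any, can be separated from everything else, and if there are none in either part, `v`
    -- alone is separated, with the opposite type.
    extend : ∀ v {S} → Bipartition S → Bipartition (v ∷ S)
    extend v {S} (bipartition {S₁} {S₂} b p (x₁ , x₁∈) (x₂ , x₂∈) u)
      with sift (λ y → e v y ≟ᵇ b) S₁ | sift (λ y → e v y ≟ᵇ b) S₂
    ... | _ | O₂ , [] , p₂ , os₂ , _ = bipartition b
            (↭-trans (↭.prep v (↭-trans p (++-comm S₁ S₂))) (↭-sym (shift v S₂ S₁)))
            (x₂ , x₂∈) (v , here refl)
            (λ { y∈ (here refl) → trans (adjSym G _ _) (All.lookup os₂ (subst (_ ∈ˡ_) (++-identityʳ O₂) (∈-resp-↭ p₂ y∈)))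
               ; y∈ (there z∈) → trans (adjSym G _ _) (u z∈ y∈) })
    ... | O₁ , [] , p₁ , os₁ , _ | _ , _ ∷ _ , _ = bipartition b
            (↭-trans (↭.prep v p) (↭-sym (shift v S₁ S₂)))
            (x₁ , x₁∈) (v , here refl)
            (λ { y∈ (here refl) → trans (adjSym G _ _) (All.lookup os₁ (subst (_ ∈ˡ_) (++-identityʳ O₁) (∈-resp-↭ p₁ y∈)))
               ; y∈ (there z∈) → u y∈ z∈ })
    ... | o ∷ O₁ , n₁ ∷ N₁ , p₁ , os₁ , ns₁ | O₂ , n₂ ∷ N₂ , p₂ , _ , (n₂≢ ∷ _) = bipartition b
            (bring (o ∷ O₁) (n₁ ∷ N₁) p p₁) (o , here refl) (v , here refl)
            (separate p₁ os₁ ns₁ u (∈-resp-↭ (↭-sym p₂) (∈-++⁺ʳ O₂ (here refl))) n₂≢)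
    ... | O₁@[] , n₁ ∷ N₁ , p₁ , _ , (n₁≢ ∷ _) | o ∷ O₂ , n₂ ∷ N₂ , p₂ , os₂ , ns₂ = bipartition b
            (bring (o ∷ O₂) (n₂ ∷ N₂) (↭-trans p (++-comm S₁ S₂)) p₂) (o , here refl) (v , here refl)
            (separate p₂ os₂ ns₂ (λ x y → trans (adjSym G _ _) (u y x)) (∈-resp-↭ (↭-sym p₁) (∈-++⁺ʳ O₁ (here refl))) n₁≢)
    ... | [] , n₁ ∷ N₁ , p₁ , _ , ns₁ | [] , n₂ ∷ N₂ , p₂ , _ , ns₂ = bipartition {S₁ = v ∷ []} (not b)
            (↭.prep v (↭-trans p (++⁺ p₁ p₂))) (v , here refl) (n₁ , here refl)
            (λ { (here refl) y∈ → not-b ([ All.lookup ns₁ , All.lookup ns₂ ]′ (∈-++⁻ (n₁ ∷ N₁) y∈)) ; (there ()) })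

  bipartite : ∀ v u S → Bipartition (v ∷ u ∷ S)
  bipartite v u []      = bipartition {S₁ = v ∷ []} {u ∷ []} (e v u) ↭-refl (v , here refl) (u , here refl)
                            (λ { (here refl) (here refl) → refl })
  bipartite v u (w ∷ S) = extend v (bipartite u w S)

-- Vertices and edges of lists of trees

module Leaves {V : Set} where

  infix 4 _∈ᵗ_ _∈*_

  _∈ᵗ_ : V → Tree V → Set
  _∈*_ : V → List (Tree V) → Set
  x ∈ᵗ leaf v  = x ≡ v
  x ∈ᵗ ten Γ Δ = x ∈* Γ ⊎ x ∈* Δ
  x ∈* []      = ⊥
  x ∈* t ∷ Γ   = x ∈ᵗ t ⊎ x ∈* Γ

  Disjoint : List (Tree V) → List (Tree V) → Set
  Disjoint Γ Δ = ∀ {x} → x ∈* Γ → x ∈* Δ → ⊥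

  Linearᵗ : Tree V → Set
  Linear : List (Tree V) → Set
  Linearᵗ (leaf v)  = ⊤
  Linearᵗ (ten Γ Δ) = Linear Γ × Linear Δ × Disjoint Γ Δ
  Linear []      = ⊤
  Linear (t ∷ Γ) = Linearᵗ t × Linear Γ × (∀ {x} → x ∈ᵗ t → x ∈* Γ → ⊥)

  Cross : List (Tree V) → List (Tree V) → V → V → Set
  Cross Γ Δ x y = (x ∈* Γ × y ∈* Δ) ⊎ (x ∈* Δ × y ∈* Γ)

  Edgeᵗ : Tree V → V → V → Set
  Edge : List (Tree V) → V → V → Set
  Edgeᵗ (leaf v)  x y = ⊥
  Edgeᵗ (ten Γ Δ) x y = Cross Γ Δ x y ⊎ Edge Γ x y ⊎ Edge Δ x y
  Edge []      x y = ⊥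
  Edge (t ∷ Γ) x y = Edgeᵗ t x y ⊎ Edge Γ x y

  ∈*-++ : ∀ Γ {Δ x} → x ∈* Γ ++ Δ → x ∈* Γ ⊎ x ∈* Δ
  ∈*-++ []      p = inj₂ p
  ∈*-++ (t ∷ Γ) (inj₁ p) = inj₁ (inj₁ p)
  ∈*-++ (t ∷ Γ) (inj₂ p) = [ (λ q → inj₁ (inj₂ q)) , inj₂ ]′ (∈*-++ Γ p)

  ∈*-++ˡ : ∀ Γ {Δ x} → x ∈* Γ → x ∈* Γ ++ Δ
  ∈*-++ˡ (t ∷ Γ) (inj₁ p) = inj₁ p
  ∈*-++ˡ (t ∷ Γ) (inj₂ p) = inj₂ (∈*-++ˡ Γ p)

  ∈*-++ʳ : ∀ Γ {Δ x} → x ∈* Δ → x ∈* Γ ++ Δ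
  ∈*-++ʳ []      p = p
  ∈*-++ʳ (t ∷ Γ) p = inj₂ (∈*-++ʳ Γ p)

  Edge-++ : ∀ Γ {Δ x y} → Edge (Γ ++ Δ) x y → Edge Γ x y ⊎ Edge Δ x y
  Edge-++ []      p = inj₂ p
  Edge-++ (t ∷ Γ) (inj₁ p) = inj₁ (inj₁ p)
  Edge-++ (t ∷ Γ) (inj₂ p) = [ (λ q → inj₁ (inj₂ q)) , inj₂ ]′ (Edge-++ Γ p)

  Edge-++ˡ : ∀ Γ {Δ x y} → Edge Γ x y → Edge (Γ ++ Δ) x y
  Edge-++ˡ (t ∷ Γ) (inj₁ p) = inj₁ p
  Edge-++ˡ (t ∷ Γ) (inj₂ p) = inj₂ (Edge-++ˡ Γ p)

  Edge-++ʳ : ∀ Γ {Δ x y} → Edge Δ x y → Edge (Γ ++ Δ) x y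
  Edge-++ʳ []      p = p
  Edge-++ʳ (t ∷ Γ) p = inj₂ (Edge-++ʳ Γ p)

  linear-++ : ∀ Γ {Δ} → Linear Γ → Linear Δ → Disjoint Γ Δ → Linear (Γ ++ Δ)
  linear-++ []      l l' d = l'
  linear-++ (t ∷ Γ) (lt , l , dt) l' d = lt , linear-++ Γ l l' (λ p → d (inj₂ p))
    , λ p q → [ dt p , d (inj₁ p) ]′ (∈*-++ Γ q)

  linear-++⁻ : ∀ Γ {Δ} → Linear (Γ ++ Δ) → Linear Γ × Linear Δ × Disjoint Γ Δ
  linear-++⁻ []      l = _ , l , λ ()
  linear-++⁻ (t ∷ Γ) (lt , l , dt) with linear-++⁻ Γ l
  ... | lΓ , lΔ , d = (lt , lΓ , λ p q → dt p (∈*-++ˡ Γ q)) , lΔ , [ (λ p q → dt p (∈*-++ʳ Γ q)) , d ]′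

  Edge-sym : ∀ Γ {x y} → Edge Γ x y → Edge Γ y x
  Edgeᵗ-sym : ∀ t {x y} → Edgeᵗ t x y → Edgeᵗ t y x
  Edge-sym (t ∷ Γ) (inj₁ p) = inj₁ (Edgeᵗ-sym t p)
  Edge-sym (t ∷ Γ) (inj₂ p) = inj₂ (Edge-sym Γ p)
  Edgeᵗ-sym (ten Γ Δ) (inj₁ (inj₁ (p , q))) = inj₁ (inj₂ (q , p))
  Edgeᵗ-sym (ten Γ Δ) (inj₁ (inj₂ (p , q))) = inj₁ (inj₁ (q , p))
  Edgeᵗ-sym (ten Γ Δ) (inj₂ (inj₁ p)) = inj₂ (inj₁ (Edge-sym Γ p))
  Edgeᵗ-sym (ten Γ Δ) (inj₂ (inj₂ p)) = inj₂ (inj₂ (Edge-sym Δ p))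

  Edge⇒∈ : ∀ Γ {x y} → Edge Γ x y → x ∈* Γ
  Edgeᵗ⇒∈ : ∀ t {x y} → Edgeᵗ t x y → x ∈ᵗ t
  Edge⇒∈ (t ∷ Γ) (inj₁ p) = inj₁ (Edgeᵗ⇒∈ t p)
  Edge⇒∈ (t ∷ Γ) (inj₂ p) = inj₂ (Edge⇒∈ Γ p)
  Edgeᵗ⇒∈ (ten Γ Δ) (inj₁ (inj₁ (p , q))) = inj₁ p
  Edgeᵗ⇒∈ (ten Γ Δ) (inj₁ (inj₂ (p , q))) = inj₂ p
  Edgeᵗ⇒∈ (ten Γ Δ) (inj₂ (inj₁ p)) = inj₁ (Edge⇒∈ Γ p)
  Edgeᵗ⇒∈ (ten Γ Δ) (inj₂ (inj₂ p)) = inj₂ (Edge⇒∈ Δ p)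

  Edge-irrefl : ∀ Γ {x} → Linear Γ → Edge Γ x x → ⊥
  Edgeᵗ-irrefl : ∀ t {x} → Linearᵗ t → Edgeᵗ t x x → ⊥
  Edge-irrefl (t ∷ Γ) (lt , l , _) = [ Edgeᵗ-irrefl t lt , Edge-irrefl Γ l ]′
  Edgeᵗ-irrefl (ten Γ Δ) (lΓ , lΔ , d) (inj₁ (inj₁ (p , q))) = d p q
  Edgeᵗ-irrefl (ten Γ Δ) (lΓ , lΔ , d) (inj₁ (inj₂ (p , q))) = d q p
  Edgeᵗ-irrefl (ten Γ Δ) (lΓ , lΔ , d) (inj₂ (inj₁ p)) = Edge-irrefl Γ lΓ p
  Edgeᵗ-irrefl (ten Γ Δ) (lΓ , lΔ , d) (inj₂ (inj₂ p)) = Edge-irrefl Δ lΔ p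

  ∈*-↭ : ∀ {Γ Δ x} → Γ ↭ Δ → x ∈* Γ → x ∈* Δ
  ∈*-↭ ↭.refl p = p
  ∈*-↭ (↭.prep t q) p = [ inj₁ , (λ r → inj₂ (∈*-↭ q r)) ]′ p
  ∈*-↭ (↭.swap t u q) (inj₁ p) = inj₂ (inj₁ p)
  ∈*-↭ (↭.swap t u q) (inj₂ (inj₁ p)) = inj₁ p
  ∈*-↭ (↭.swap t u q) (inj₂ (inj₂ p)) = inj₂ (inj₂ (∈*-↭ q p))
  ∈*-↭ (↭.trans q r) p = ∈*-↭ r (∈*-↭ q p)

  Edge-↭ : ∀ {Γ Δ x y} → Γ ↭ Δ → Edge Γ x y → Edge Δ x y
  Edge-↭ ↭.refl p = p
  Edge-↭ (↭.prep t q) p = [ inj₁ , (λ r → inj₂ (Edge-↭ q r)) ]′ p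
  Edge-↭ (↭.swap t u q) (inj₁ p) = inj₂ (inj₁ p)
  Edge-↭ (↭.swap t u q) (inj₂ (inj₁ p)) = inj₁ p
  Edge-↭ (↭.swap t u q) (inj₂ (inj₂ p)) = inj₂ (inj₂ (Edge-↭ q p))
  Edge-↭ (↭.trans q r) p = Edge-↭ r (Edge-↭ q p)

  linear-↭ : ∀ {Γ Δ} → Γ ↭ Δ → Linear Γ → Linear Δ
  linear-↭ ↭.refl l = l
  linear-↭ (↭.prep t q) (lt , l , d) = lt , linear-↭ q l , λ p r → d p (∈*-↭ (↭-sym q) r)
  linear-↭ (↭.swap t u q) (lt , (lu , l , du) , dt) =
    lu , (lt , linear-↭ q l , λ p r → dt p (inj₂ (∈*-↭ (↭-sym q) r)))
       , λ p → [ (λ r → dt r (inj₁ p)) , (λ r → du p (∈*-↭ (↭-sym q) r)) ]′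
  linear-↭ (↭.trans q r) l = linear-↭ r (linear-↭ q l)

-- The trees that represent a cograph

module Realisation {V : Set} (G : LGraph V) where

  open Leaves {V}
  open Semantics (lab G)

  val : ∀ t → Pos t → V
  val* : ∀ Γ → Pos* Γ → V
  val (leaf v)  _        = v
  val (ten Γ Δ) (inj₁ p) = val* Γ p
  val (ten Γ Δ) (inj₂ p) = val* Δ p
  val* (t ∷ Γ) (inj₁ p) = val t p
  val* (t ∷ Γ) (inj₂ p) = val* Γ p

  val-∈ : ∀ t p → val t p ∈ᵗ t
  val*-∈ : ∀ Γ p → val* Γ p ∈* Γ
  val-∈ (leaf v)  p = refl
  val-∈ (ten Γ Δ) (inj₁ p) = inj₁ (val*-∈ Γ p)
  val-∈ (ten Γ Δ) (inj₂ p) = inj₂ (val*-∈ Δ p)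
  val*-∈ (t ∷ Γ) (inj₁ p) = inj₁ (val-∈ t p)
  val*-∈ (t ∷ Γ) (inj₂ p) = inj₂ (val*-∈ Γ p)

  pos : ∀ t {x} → x ∈ᵗ t → Σ[ p ∈ Pos t ] val t p ≡ x
  pos* : ∀ Γ {x} → x ∈* Γ → Σ[ p ∈ Pos* Γ ] val* Γ p ≡ x
  pos (leaf v) refl = ⋆ , refl
  pos (ten Γ Δ) (inj₁ q) = let p , eq = pos* Γ q in inj₁ p , eq
  pos (ten Γ Δ) (inj₂ q) = let p , eq = pos* Δ q in inj₂ p , eq
  pos* (t ∷ Γ) (inj₁ q) = let p , eq = pos t q in inj₁ p , eq
  pos* (t ∷ Γ) (inj₂ q) = let p , eq = pos* Γ q in inj₂ p , eq

  val-injective : ∀ t → Linearᵗ t → ∀ p q → val t p ≡ val t q → p ≡ q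
  val*-injective : ∀ Γ → Linear Γ → ∀ p q → val* Γ p ≡ val* Γ q → p ≡ q
  val-injective (leaf v) l ⋆ ⋆ eq = refl
  val-injective (ten Γ Δ) (l , l' , d) (inj₁ p) (inj₁ q) eq = cong inj₁ (val*-injective Γ l p q eq)
  val-injective (ten Γ Δ) (l , l' , d) (inj₁ p) (inj₂ q) eq = ⊥-elim (d (val*-∈ Γ p) (subst (_∈* Δ) (sym eq) (val*-∈ Δ q)))
  val-injective (ten Γ Δ) (l , l' , d) (inj₂ p) (inj₁ q) eq = ⊥-elim (d (val*-∈ Γ q) (subst (_∈* Δ) eq (val*-∈ Δ p)))
  val-injective (ten Γ Δ) (l , l' , d) (inj₂ p) (inj₂ q) eq = cong inj₂ (val*-injective Δ l' p q eq)
  val*-injective (t ∷ Γ) (l , l' , d) (inj₁ p) (inj₁ q) eq = cong inj₁ (val-injective t l p q eq)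
  val*-injective (t ∷ Γ) (l , l' , d) (inj₁ p) (inj₂ q) eq = ⊥-elim (d (val-∈ t p) (subst (_∈* Γ) (sym eq) (val*-∈ Γ q)))
  val*-injective (t ∷ Γ) (l , l' , d) (inj₂ p) (inj₁ q) eq = ⊥-elim (d (val-∈ t q) (subst (_∈* Γ) eq (val*-∈ Γ p)))
  val*-injective (t ∷ Γ) (l , l' , d) (inj₂ p) (inj₂ q) eq = cong inj₂ (val*-injective Γ l' p q eq)

  graph-lab : ∀ t p → lab (graph t) p ≡ lab G (val t p)
  graph*-lab : ∀ Γ p → lab (graph* Γ) p ≡ lab G (val* Γ p)
  graph-lab (leaf v)  p = refl
  graph-lab (ten Γ Δ) (inj₁ p) = graph*-lab Γ p
  graph-lab (ten Γ Δ) (inj₂ p) = graph*-lab Δ p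
  graph*-lab (t ∷ Γ) (inj₁ p) = graph-lab t p
  graph*-lab (t ∷ Γ) (inj₂ p) = graph*-lab Γ p

  Edgeᵗ⇒adj : ∀ t {x y} → Edgeᵗ t x y → Σ[ p ∈ Pos t ] Σ[ q ∈ Pos t ] (val t p ≡ x × val t q ≡ y × adj (graph t) p q ≡ true)
  Edge⇒adj : ∀ Γ {x y} → Edge Γ x y → Σ[ p ∈ Pos* Γ ] Σ[ q ∈ Pos* Γ ] (val* Γ p ≡ x × val* Γ q ≡ y × adj
      (graph* Γ) p q ≡ true)
  Edgeᵗ⇒adj (ten Γ Δ) (inj₁ (inj₁ (a , b))) = let p , eq = pos* Γ a ; q , eq' = pos* Δ b in inj₁ p , inj₂ q , eq , eq' , refl
  Edgeᵗ⇒adj (ten Γ Δ) (inj₁ (inj₂ (a , b))) = let p , eq = pos* Δ a ; q , eq' = pos* Γ b in inj₂ p , inj₁ q , eq , eq' , refl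
  Edgeᵗ⇒adj (ten Γ Δ) (inj₂ (inj₁ a)) = let p , q , r = Edge⇒adj Γ a in inj₁ p , inj₁ q , r
  Edgeᵗ⇒adj (ten Γ Δ) (inj₂ (inj₂ a)) = let p , q , r = Edge⇒adj Δ a in inj₂ p , inj₂ q , r
  Edge⇒adj (t ∷ Γ) (inj₁ a) = let p , q , r = Edgeᵗ⇒adj t a in inj₁ p , inj₁ q , r
  Edge⇒adj (t ∷ Γ) (inj₂ a) = let p , q , r = Edge⇒adj Γ a in inj₂ p , inj₂ q , r

  adj⇒Edgeᵗ : ∀ t p q → adj (graph t) p q ≡ true → Edgeᵗ t (val t p) (val t q)
  adj⇒Edge : ∀ Γ p q → adj (graph* Γ) p q ≡ true → Edge Γ (val* Γ p) (val* Γ q)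
  adj⇒Edgeᵗ (ten Γ Δ) (inj₁ p) (inj₁ q) a = inj₂ (inj₁ (adj⇒Edge Γ p q a))
  adj⇒Edgeᵗ (ten Γ Δ) (inj₁ p) (inj₂ q) a = inj₁ (inj₁ (val*-∈ Γ p , val*-∈ Δ q))
  adj⇒Edgeᵗ (ten Γ Δ) (inj₂ p) (inj₁ q) a = inj₁ (inj₂ (val*-∈ Δ p , val*-∈ Γ q))
  adj⇒Edgeᵗ (ten Γ Δ) (inj₂ p) (inj₂ q) a = inj₂ (inj₂ (adj⇒Edge Δ p q a))
  adj⇒Edge (t ∷ Γ) (inj₁ p) (inj₁ q) a = inj₁ (adj⇒Edgeᵗ t p q a)
  adj⇒Edge (t ∷ Γ) (inj₂ p) (inj₂ q) a = inj₂ (adj⇒Edge Γ p q a)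

  Realises : List (Tree V) → Set
  Realises Γ = ∀ p q → adj (graph* Γ) p q ≡ adj G (val* Γ p) (val* Γ q)

  record CotreeOf (S : List V) : Set where
    field
      trees    : List (Tree V)
      realises : Realises trees
      linear   : Linear trees
      only    : ∀ {x} → x ∈* trees → x ∈ˡ S
      every : ∀ {x} → x ∈ˡ S → x ∈* trees

  graph*≅ : ∀ {Γ} → Realises Γ → Linear Γ → (∀ x → x ∈* Γ) → G ≅ graph* Γ
  graph*≅ {Γ} r l all = ≅-flip (record
    { bij = mk↔ₛ′ (val* Γ) (λ x → proj₁ (pos* Γ (all x))) (λ x → proj₂ (pos* Γ (all x)))
                  (λ p → val*-injective Γ l _ _ (proj₂ (pos* Γ (all (val* Γ p)))))
    ; labPres = λ p → sym (graph*-lab Γ p) ; adjPres = λ p q → sym (r p q) })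

  module _ (cograph : ¬ InducedP4 G) where

    open Cotree G cograph

    realises-++ : ∀ Γ {Δ} → Realises Γ → Realises Δ → (∀ {x y} → x ∈* Γ → y ∈* Δ → adj G x y ≡ false) → Realises (Γ ++ Δ)
    realises-++ [] r s d p q = s p q
    realises-++ (t ∷ Γ) r s d (inj₁ p) (inj₁ q) = r (inj₁ p) (inj₁ q)
    realises-++ (t ∷ Γ) {Δ} r s d (inj₁ p) (inj₂ q) = sym ([ other , d (inj₁ (val-∈ t p)) ]′ (∈*-++ Γ (val*-∈ (Γ ++ Δ) q)))
      where
      other : ∀ {y} → y ∈* Γ → adj G (val t p) y ≡ false
      other y∈ with pos* Γ y∈
      ... | q' , refl = sym (r (inj₁ p) (inj₂ q'))
    realises-++ (t ∷ Γ) {Δ} r s d (inj₂ q) (inj₁ p) =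
      trans (sym ([ other , d (inj₁ (val-∈ t p)) ]′ (∈*-++ Γ (val*-∈ (Γ ++ Δ) q)))) (adjSym G _ _)
      where
      other : ∀ {y} → y ∈* Γ → adj G (val t p) y ≡ false
      other y∈ with pos* Γ y∈
      ... | q' , refl = sym (r (inj₁ p) (inj₂ q'))
    realises-++ (t ∷ Γ) r s d (inj₂ p) (inj₂ q) =
      realises-++ Γ (λ a b → r (inj₂ a) (inj₂ b)) s (λ x y → d (inj₂ x) y) p q

    cotree : ∀ k S → length S ≤ k → Unique S → CotreeOf S
    cotree k [] _ _ = record { trees = [] ; realises = λ () ; linear = _ ; only = λ () ; every = λ () }
    cotree (suc k) (v ∷ []) _ _ = record
      { trees = leaf v ∷ [] ; realises = λ { (inj₁ ⋆) (inj₁ ⋆) → sym (adjIrr G v) ; (inj₁ _) (inj₂ ()) ; (inj₂ ()) _ }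
      ; linear = _ , _ , λ _ () ; only = λ { (inj₁ refl) → here refl ; (inj₂ ()) } ; every = λ { (here refl) → inj₁ refl } }
    cotree (suc k) (v ∷ w ∷ S) le uq with bipartite v w S
    ... | bipartition {S₁} {S₂} b p (x₁ , x₁∈) (x₂ , x₂∈) u with unique-++ S₁ (unique-↭ p uq)
    ...   | u₁ , u₂ , dis = combine b u
      where
      pos-length : ∀ {x : V} {xs} → x ∈ˡ xs → 1 ≤ length xs
      pos-length (here _)  = s≤s z≤n
      pos-length (there _) = s≤s z≤n
      total : length S₁ + length S₂ ≤ suc k
      total = ≤-trans (≤-reflexive (trans (sym (length-++ S₁)) (sym (↭-length p)))) le
      T₁ : CotreeOf S₁
      T₁ = cotree k S₁ (≤-pred (≤-trans (≤-trans (≤-reflexive (+-comm 1 _)) (+-mono-≤ ≤-refl (pos-length x₂∈))) total)) u₁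
      T₂ : CotreeOf S₂
      T₂ = cotree k S₂ (≤-pred (≤-trans (+-mono-≤ (pos-length x₁∈) ≤-refl) total)) u₂
      open CotreeOf
      trees-disjoint : Disjoint (trees T₁) (trees T₂)
      trees-disjoint x y = dis (only T₁ x) (only T₂ y)
      combine : ∀ b → (∀ {x y} → x ∈ˡ S₁ → y ∈ˡ S₂ → adj G x y ≡ b) → CotreeOf (v ∷ w ∷ S)
      combine false u = record
        { trees = trees T₁ ++ trees T₂
        ; realises = realises-++ (trees T₁) (realises T₁) (realises T₂) (λ x y → u (only T₁ x) (only T₂ y))
        ; linear = linear-++ (trees T₁) (linear T₁) (linear T₂) trees-disjoint
        ; only = λ x → ∈-resp-↭ (↭-sym p) ([ (λ y → ∈-++⁺ˡ (only T₁ y)) , (λ y → ∈-++⁺ʳ S₁ (only T₂ y)) ]′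
            (∈*-++ (trees T₁) x))
        ; every = λ x → [ (λ y → ∈*-++ˡ (trees T₁) (every T₁ y)) , (λ y → ∈*-++ʳ (trees T₁) (every T₂ y)) ]′ (∈-++⁻ S₁
            (∈-resp-↭ p x)) }
      combine true u = record
        { trees = ten (trees T₁) (trees T₂) ∷ []
        ; realises = λ { (inj₁ (inj₁ p)) (inj₁ (inj₁ q)) → realises T₁ p q ; (inj₁ (inj₂ p)) (inj₁ (inj₂ q))
            → realises T₂ p q
                       ; (inj₁ (inj₁ p)) (inj₁ (inj₂ q)) → sym (u (only T₁ (val*-∈ _ p)) (only T₂ (val*-∈ _ q)))
                       ; (inj₁ (inj₂ p)) (inj₁ (inj₁ q)) → sym (trans (adjSym G _ _)
                           (u (only T₁ (val*-∈ _ q)) (only T₂ (val*-∈ _ p))))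
                       ; (inj₁ _) (inj₂ ()) ; (inj₂ ()) _ }
        ; linear = (linear T₁ , linear T₂ , trees-disjoint) , _ , λ _ ()
        ; only = λ { (inj₁ x) → ∈-resp-↭ (↭-sym p) ([ (λ y → ∈-++⁺ˡ (only T₁ y)) , (λ y → ∈-++⁺ʳ S₁ (only T₂ y)) ]′ x)
            ; (inj₂ ()) }
        ; every = λ x → inj₁ ([ (λ y → inj₁ (every T₁ y)) , (λ y → inj₂ (every T₂ y)) ]′ (∈-++⁻ S₁ (∈-resp-↭ p x))) }

-- Chordless alternating cycles

module Matching {n : ℕ} (label : Fin n → Atom) (β : Fin n → Fin n)
                (β-invol : ∀ x → β (β x) ≡ x) (β-dual : ∀ x → label (β x) ≡ dual (label x)) where

  V = Fin n

  open Leaves {V}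

  β-fixfree : ∀ {x} → ¬ (β x ≡ x)
  β-fixfree {x} eq = dual-fixfree (trans (sym (β-dual x)) (cong label eq))
    where
    dual-fixfree : ∀ {a} → ¬ (dual a ≡ a)
    dual-fixfree {var _} ()
    dual-fixfree {dvar _} ()

  β-swap : ∀ {x y} → β x ≡ y → β y ≡ x
  β-swap refl = β-invol _

  -- Existence and uniqueness of the partner refer to different relations. In a bad set both are
  -- adjacency; in an arc the partner lies across the root of the tree and is the only other vertex
  -- of the arc in the whole tree.
  record Matched (R S : V → V → Set) (D : Subset V) (c : V → Bool) (x : V) : Set where
    constructor matched
    field
      {partner} : V
      partner∈  : partner ∈ D
      edge      : R x partner
      bicolour  : c partner ≡ not (c x)
      unique    : ∀ {z} → z ∈ D → S x z → z ≡ partner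

  -- The induced subgraph on D is a perfect matching with bichromatic edges; closed under the linking β,
  -- it is a union of chordless alternating cycles.
  record Bad (Γ : List (Tree V)) : Set where
    field
      D         : Subset V
      c         : V → Bool
      inhabited : Inhabited D
      inside    : ∀ {x} → x ∈ D → x ∈* Γ
      closed    : ∀ {x} → x ∈ D → β x ∈ D
      anti      : ∀ {x} → x ∈ D → c (β x) ≡ not (c x)
      regular   : ∀ {x} → x ∈ D → Matched (Edge Γ) (Edge Γ) D c x

  record Valid (Γ : List (Tree V)) : Set where
    field
      linear : Linear Γ
      closed : ∀ {x} → x ∈* Γ → β x ∈* Γ
      good   : ¬ Bad Γ

  valid-restrict : ∀ {Γ Δ} → Valid Γ → Linear Δ → (∀ {x} → x ∈* Δ → β x ∈* Δ) → (∀ {x} → x ∈* Δ → x ∈* Γ)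
                 → (∀ {x y} → x ∈* Δ → y ∈* Δ → Edge Δ x y → Edge Γ x y)
                 → (∀ {x y} → x ∈* Δ → y ∈* Δ → Edge Γ x y → Edge Δ x y) → Valid Δ
  valid-restrict v l cl sub up down = record { linear = l ; closed = cl ; good = λ b → let open Bad b in good record
      { D = D ; c = c ; inhabited = inhabited ; inside = λ x → sub (inside x) ; closed = closed ; anti = anti
      ; regular = λ x → let open Matched (regular x) in
          matched partner∈ (up (inside x) (inside partner∈) edge) bicolour
                  (λ z s → unique z (down (inside x) (inside z) s)) } }
    where open Valid v using (good)

  valid-↭ : ∀ {Γ Δ} → Γ ↭ Δ → Valid Γ → Valid Δ
  valid-↭ p v = valid-restrict v (linear-↭ p linear) (λ x → ∈*-↭ p (closed (∈*-↭ (↭-sym p) x))) (∈*-↭ (↭-sym p))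
                  (λ _ _ → Edge-↭ (↭-sym p)) (λ _ _ → Edge-↭ p)
    where open Valid v

  valid-flip : ∀ {H K Γ} → Valid (ten H K ∷ Γ) → Valid (ten K H ∷ Γ)
  valid-flip {H} {K} v = let (lH , lK , d) , lΓ , d' = linear in
      valid-restrict v ((lK , lH , λ x y → d y x) , lΓ , λ x → d' (⊎-swap x)) (λ x → move (closed (move x))) move
                       (λ _ _ → edge) (λ _ _ → edge)
    where
    open Valid v
    move : ∀ {H K Γ x} → x ∈* ten H K ∷ Γ → x ∈* ten K H ∷ Γ
    move (inj₁ x) = inj₁ (⊎-swap x)
    move (inj₂ x) = inj₂ x
    edge : ∀ {H K Γ x y} → Edge (ten H K ∷ Γ) x y → Edge (ten K H ∷ Γ) x y
    edge (inj₁ (inj₁ c)) = inj₁ (inj₁ (⊎-swap c))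
    edge (inj₁ (inj₂ e)) = inj₁ (inj₂ (⊎-swap e))
    edge (inj₂ e) = inj₂ e

  valid-axiom : ∀ {x y Γ} → β x ≡ y → Valid (leaf x ∷ leaf y ∷ Γ) → Valid Γ
  valid-axiom {x} {y} {Γ} refl v = let _ , (_ , lΓ , dy) , dx = linear in
      valid-restrict v lΓ (λ {z} z∈ → rest dx dy z∈ (closed (inj₂ (inj₂ z∈))))
        (λ z → inj₂ (inj₂ z)) (λ _ _ e → inj₂ (inj₂ e)) (λ { _ _ (inj₂ (inj₂ e)) → e })
    where
    open Valid v
    rest : (∀ {z} → z ≡ x → z ∈* leaf y ∷ Γ → ⊥) → (∀ {z} → z ≡ y → z ∈* Γ → ⊥)
         → ∀ {z} → z ∈* Γ → β z ∈* leaf x ∷ leaf y ∷ Γ → β z ∈* Γ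
    rest dx dy z∈ (inj₁ eq) = ⊥-elim (dy (sym (β-swap eq)) z∈)
    rest dx dy z∈ (inj₂ (inj₁ eq)) = ⊥-elim (dx (trans (sym (β-invol _)) (trans (cong β eq) (β-invol x))) (inj₂ z∈))
    rest dx dy z∈ (inj₂ (inj₂ k)) = k

  module _ {H K Γ} (v : Valid (ten H K ∷ Γ)) (closedH : ∀ {x} → x ∈* H → β x ∈* H) where

    open Valid v

    valid-split₁ : Valid H
    valid-split₁ = let (lH , lK , d) , lΓ , d' = linear in
      valid-restrict v lH closedH (λ x → inj₁ (inj₁ x)) (λ _ _ e → inj₁ (inj₂ (inj₁ e)))
        λ { x y (inj₁ (inj₁ (inj₁ (_ , q)))) → ⊥-elim (d y q) ; x y (inj₁ (inj₁ (inj₂ (p , _)))) → ⊥-elim (d x p)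
          ; x y (inj₁ (inj₂ (inj₁ e))) → e ; x y (inj₁ (inj₂ (inj₂ e))) → ⊥-elim (d x (Edge⇒∈ K e))
          ; x y (inj₂ e) → ⊥-elim (d' (inj₁ x) (Edge⇒∈ Γ e)) }

    valid-split₂ : Valid (K ++ Γ)
    valid-split₂ = let (lH , lK , d) , lΓ , d' = linear in
      valid-restrict v (linear-++ K lK lΓ (λ x → d' (inj₂ x))) (λ x → leave d d' x (closed (enter x))) enter
        (λ _ _ e → [ (λ e → inj₁ (inj₂ (inj₂ e))) , inj₂ ]′ (Edge-++ K e))
        λ { x y (inj₁ (inj₁ (inj₁ (p , _)))) → ⊥-elim (outside d d' x p) ; x y (inj₁ (inj₁ (inj₂ (_ , q)))) → ⊥-elim
            (outside d d' y q)
          ; x y (inj₁ (inj₂ (inj₁ e))) → ⊥-elim (outside d d' x (Edge⇒∈ H e)) ; x y (inj₁ (inj₂ (inj₂ e))) → Edge-++ˡ K e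
          ; x y (inj₂ e) → Edge-++ʳ K e }
      where
      enter : ∀ {x} → x ∈* K ++ Γ → x ∈* ten H K ∷ Γ
      enter x = [ (λ k → inj₁ (inj₂ k)) , inj₂ ]′ (∈*-++ K x)
      outside : Disjoint H K → (∀ {x} → x ∈ᵗ ten H K → x ∈* Γ → ⊥) → ∀ {x} → x ∈* K ++ Γ → x ∈* H → ⊥
      outside d d' x h = [ d h , d' (inj₁ h) ]′ (∈*-++ K x)
      leave : Disjoint H K → (∀ {x} → x ∈ᵗ ten H K → x ∈* Γ → ⊥)
            → ∀ {x} → x ∈* K ++ Γ → β x ∈* ten H K ∷ Γ → β x ∈* K ++ Γ
      leave d d' x (inj₁ (inj₁ h)) = ⊥-elim (outside d d' x (subst (_∈* H) (β-invol _) (closedH h)))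
      leave d d' x (inj₁ (inj₂ k)) = ∈*-++ˡ K k
      leave d d' x (inj₂ g) = ∈*-++ʳ K g

  Same : List (Tree V) → V → V → Set
  Same []      x y = ⊥
  Same (t ∷ Γ) x y = (x ∈ᵗ t × y ∈ᵗ t) ⊎ Same Γ x y

  Crossᵗ : Tree V → V → V → Set
  Crossᵗ (leaf _)  x y = ⊥
  Crossᵗ (ten H K) x y = Cross H K x y

  -- Adjacency through a root tensor only. Walks use no other edges, so they can be followed without
  -- looking inside the sides of a tensor.
  Crosses : List (Tree V) → V → V → Set
  Crosses []      x y = ⊥
  Crosses (t ∷ Γ) x y = Crossᵗ t x y ⊎ Crosses Γ x y

  Same-sym : ∀ Γ {x y} → Same Γ x y → Same Γ y x
  Same-sym (t ∷ Γ) (inj₁ (p , q)) = inj₁ (q , p)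
  Same-sym (t ∷ Γ) (inj₂ s) = inj₂ (Same-sym Γ s)

  Same⇒∈ : ∀ Γ {x y} → Same Γ x y → x ∈* Γ
  Same⇒∈ (t ∷ Γ) (inj₁ (p , q)) = inj₁ p
  Same⇒∈ (t ∷ Γ) (inj₂ s) = inj₂ (Same⇒∈ Γ s)

  Same-refl : ∀ Γ {x} → x ∈* Γ → Same Γ x x
  Same-refl (t ∷ Γ) (inj₁ p) = inj₁ (p , p)
  Same-refl (t ∷ Γ) (inj₂ s) = inj₂ (Same-refl Γ s)

  Same-trans : ∀ Γ → Linear Γ → ∀ {x y z} → Same Γ x y → Same Γ y z → Same Γ x z
  Same-trans (t ∷ Γ) l (inj₁ (p , _)) (inj₁ (_ , q)) = inj₁ (p , q)
  Same-trans (t ∷ Γ) (_ , l , d) (inj₁ (_ , p)) (inj₂ s) = ⊥-elim (d p (Same⇒∈ Γ s))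
  Same-trans (t ∷ Γ) (_ , l , d) (inj₂ s) (inj₁ (p , _)) = ⊥-elim (d p (Same⇒∈ Γ (Same-sym Γ s)))
  Same-trans (t ∷ Γ) (_ , l , d) (inj₂ s) (inj₂ s') = inj₂ (Same-trans Γ l s s')

  Edge⇒Same : ∀ Γ {x y} → Edge Γ x y → Same Γ x y
  Edge⇒Same (t ∷ Γ) (inj₁ e) = inj₁ (Edgeᵗ⇒∈ t e , Edgeᵗ⇒∈ t (Edgeᵗ-sym t e))
  Edge⇒Same (t ∷ Γ) (inj₂ e) = inj₂ (Edge⇒Same Γ e)

  Crosses⇒Edge : ∀ Γ {x y} → Crosses Γ x y → Edge Γ x y
  Crosses⇒Edge (ten H K ∷ Γ) (inj₁ c) = inj₁ (inj₁ c)
  Crosses⇒Edge (t ∷ Γ) (inj₂ c) = inj₂ (Crosses⇒Edge Γ c)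

  Crosses⇒Same : ∀ Γ {x y} → Crosses Γ x y → Same Γ x y
  Crosses⇒Same Γ c = Edge⇒Same Γ (Crosses⇒Edge Γ c)

  Crosses-sym : ∀ Γ {x y} → Crosses Γ x y → Crosses Γ y x
  Crosses-sym (ten H K ∷ Γ) (inj₁ (inj₁ (p , q))) = inj₁ (inj₂ (q , p))
  Crosses-sym (ten H K ∷ Γ) (inj₁ (inj₂ (p , q))) = inj₁ (inj₁ (q , p))
  Crosses-sym (t ∷ Γ) (inj₂ c) = inj₂ (Crosses-sym Γ c)

  Same-++ : ∀ Γ {Δ x y} → Same (Γ ++ Δ) x y → Same Γ x y ⊎ Same Δ x y
  Same-++ []      p = inj₂ p
  Same-++ (t ∷ Γ) (inj₁ p) = inj₁ (inj₁ p)
  Same-++ (t ∷ Γ) (inj₂ p) = [ (λ q → inj₁ (inj₂ q)) , inj₂ ]′ (Same-++ Γ p)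

  Same-↭ : ∀ {Γ Δ x y} → Γ ↭ Δ → Same Γ x y → Same Δ x y
  Same-↭ ↭.refl p = p
  Same-↭ (↭.prep t q) p = [ inj₁ , (λ r → inj₂ (Same-↭ q r)) ]′ p
  Same-↭ (↭.swap t u q) (inj₁ p) = inj₂ (inj₁ p)
  Same-↭ (↭.swap t u q) (inj₂ (inj₁ p)) = inj₁ p
  Same-↭ (↭.swap t u q) (inj₂ (inj₂ p)) = inj₂ (inj₂ (Same-↭ q p))
  Same-↭ (↭.trans q r) p = Same-↭ r (Same-↭ q p)

  Crosses-↭ : ∀ {Γ Δ x y} → Γ ↭ Δ → Crosses Γ x y → Crosses Δ x y
  Crosses-↭ ↭.refl p = p
  Crosses-↭ (↭.prep t q) p = [ inj₁ , (λ r → inj₂ (Crosses-↭ q r)) ]′ p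
  Crosses-↭ (↭.swap t u q) (inj₁ p) = inj₂ (inj₁ p)
  Crosses-↭ (↭.swap t u q) (inj₂ (inj₁ p)) = inj₁ p
  Crosses-↭ (↭.swap t u q) (inj₂ (inj₂ p)) = inj₂ (inj₂ (Crosses-↭ q p))
  Crosses-↭ (↭.trans q r) p = Crosses-↭ r (Crosses-↭ q p)

  opposite : ∀ Γ → Linear Γ → ∀ {x y z} → Same Γ x y → Crosses Γ y z → Crosses Γ x y ⊎ Crosses Γ x z
  opposite (ten H K ∷ Γ) l (inj₁ (inj₁ x , _)) (inj₁ (inj₁ (y , z))) = inj₂ (inj₁ (inj₁ (x , z)))
  opposite (ten H K ∷ Γ) l (inj₁ (inj₂ x , _)) (inj₁ (inj₁ (y , z))) = inj₁ (inj₁ (inj₂ (x , y)))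
  opposite (ten H K ∷ Γ) l (inj₁ (inj₁ x , _)) (inj₁ (inj₂ (y , z))) = inj₁ (inj₁ (inj₁ (x , y)))
  opposite (ten H K ∷ Γ) l (inj₁ (inj₂ x , _)) (inj₁ (inj₂ (y , z))) = inj₂ (inj₁ (inj₂ (x , z)))
  opposite (t ∷ Γ) (_ , l , d) (inj₁ (_ , y)) (inj₂ c) = ⊥-elim (d y (Same⇒∈ Γ (Crosses⇒Same Γ c)))
  opposite (ten H K ∷ Γ) (_ , l , d) (inj₂ s) (inj₁ (inj₁ (y , _))) = ⊥-elim (d (inj₁ y) (Same⇒∈ Γ (Same-sym Γ s)))
  opposite (ten H K ∷ Γ) (_ , l , d) (inj₂ s) (inj₁ (inj₂ (y , _))) = ⊥-elim (d (inj₂ y) (Same⇒∈ Γ (Same-sym Γ s)))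
  opposite (t ∷ Γ) (_ , l , d) (inj₂ s) (inj₂ c) = [ (λ c → inj₁ (inj₂ c)) , (λ c → inj₂ (inj₂ c)) ]′ (opposite Γ l s c)

  _∈ᵗ?_ : ∀ x t → Dec (x ∈ᵗ t)
  _∈*?_ : ∀ x Γ → Dec (x ∈* Γ)
  x ∈ᵗ? leaf v  = x ≟ v
  x ∈ᵗ? ten H K = (x ∈*? H) ⊎-dec (x ∈*? K)
  x ∈*? []      = no λ ()
  x ∈*? (t ∷ Γ) = (x ∈ᵗ? t) ⊎-dec (x ∈*? Γ)

  same? : ∀ Γ x y → Dec (Same Γ x y)
  same? []      x y = no λ ()
  same? (t ∷ Γ) x y = ((x ∈ᵗ? t) ×-dec (y ∈ᵗ? t)) ⊎-dec same? Γ x y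

  crosses? : ∀ Γ x y → Dec (Crosses Γ x y)
  crosses? []      x y = no λ ()
  crosses? (leaf _ ∷ Γ)  x y = no (λ ()) ⊎-dec crosses? Γ x y
  crosses? (ten H K ∷ Γ) x y =
    (((x ∈*? H) ×-dec (y ∈*? K)) ⊎-dec ((x ∈*? K) ×-dec (y ∈*? H))) ⊎-dec crosses? Γ x y

  -- An alternating path from h ∈ H to v, where v and n lie on opposite sides of one tree, that meets no other tree twice.
  record Arc (Γ H N : List (Tree V)) (n : V) : Set where
    field
      E      : Subset V
      c      : V → Bool
      h v    : V
      h∈H    : h ∈* H
      h∈E    : h ∈ E
      v∈E    : v ∈ E
      v×n    : Crosses Γ v n
      closed : ∀ {x} → x ∈ E → β x ∈ E
      anti   : ∀ {x} → x ∈ E → c (β x) ≡ not (c x)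
      inside : ∀ {x} → x ∈ E → x ∈* N ⊎ x ∈* H
      ends   : c v ≡ not (c h)
      at-h   : ∀ {z} → z ∈ E → Same Γ h z → z ≡ h
      at-v   : ∀ {z} → z ∈ E → Same Γ v z → z ≡ v
      inner  : ∀ {x} → x ∈ E → ¬ (x ≡ h) → ¬ (x ≡ v)
             → Matched (Crosses Γ) (λ x z → Same Γ x z × ¬ (z ≡ x)) E c x

  -- Merging trees into one side of a tensor keeps validity

  module Merge {H K N Y : List (Tree V)} (valid : Valid (ten H K ∷ N ++ Y))
               (arc : ∀ {n} → n ∈* N → ¬ (β n ∈* N) → ¬ (β n ∈* H) → Arc (ten H K ∷ N ++ Y) H N n) where

    open Valid valid

    private
      Γ Γ' : List (Tree V)
      Γ  = ten H K ∷ N ++ Y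
      Γ' = ten (N ++ H) K ∷ Y

      linH = proj₁ (proj₁ linear)
      linK = proj₁ (proj₂ (proj₁ linear))
      H#K : Disjoint H K
      H#K = proj₂ (proj₂ (proj₁ linear))
      linN = proj₁ (linear-++⁻ N (proj₁ (proj₂ linear)))
      linY = proj₁ (proj₂ (linear-++⁻ N (proj₁ (proj₂ linear))))
      N#Y : Disjoint N Y
      N#Y = proj₂ (proj₂ (linear-++⁻ N (proj₁ (proj₂ linear))))
      H#N : Disjoint H N
      H#N h n = proj₂ (proj₂ linear) (inj₁ h) (∈*-++ˡ N n)
      H#Y : Disjoint H Y
      H#Y h y = proj₂ (proj₂ linear) (inj₁ h) (∈*-++ʳ N y)
      K#N : Disjoint K N
      K#N h n = proj₂ (proj₂ linear) (inj₂ h) (∈*-++ˡ N n)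
      K#Y : Disjoint K Y
      K#Y h y = proj₂ (proj₂ linear) (inj₂ h) (∈*-++ʳ N y)

      linear' : Linear Γ'
      linear' = (linear-++ N linN linH (λ n h → H#N h n) , linK , λ x k → [ K#N k , (λ h → H#K h k) ]′ (∈*-++ N x))
              , linY , λ { (inj₁ x) y → [ (λ n → N#Y n y) , (λ h → H#Y h y) ]′ (∈*-++ N x) ; (inj₂ k) y → K#Y k y }

      to : ∀ {x} → x ∈* Γ → x ∈* Γ'
      to (inj₁ (inj₁ h)) = inj₁ (inj₁ (∈*-++ʳ N h))
      to (inj₁ (inj₂ k)) = inj₁ (inj₂ k)
      to (inj₂ x) = [ (λ n → inj₁ (inj₁ (∈*-++ˡ N n))) , inj₂ ]′ (∈*-++ N x)

      from : ∀ {x} → x ∈* Γ' → x ∈* Γ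
      from (inj₁ (inj₁ x)) = [ (λ n → inj₂ (∈*-++ˡ N n)) , (λ h → inj₁ (inj₁ h)) ]′ (∈*-++ N x)
      from (inj₁ (inj₂ k)) = inj₁ (inj₂ k)
      from (inj₂ y) = inj₂ (∈*-++ʳ N y)

      edge-to : ∀ {x y} → Edge Γ x y → Edge Γ' x y
      edge-to (inj₁ (inj₁ (inj₁ (h , k)))) = inj₁ (inj₁ (inj₁ (∈*-++ʳ N h , k)))
      edge-to (inj₁ (inj₁ (inj₂ (k , h)))) = inj₁ (inj₁ (inj₂ (k , ∈*-++ʳ N h)))
      edge-to (inj₁ (inj₂ (inj₁ e))) = inj₁ (inj₂ (inj₁ (Edge-++ʳ N e)))
      edge-to (inj₁ (inj₂ (inj₂ e))) = inj₁ (inj₂ (inj₂ e))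
      edge-to (inj₂ e) = [ (λ e → inj₁ (inj₂ (inj₁ (Edge-++ˡ N e)))) , inj₂ ]′ (Edge-++ N e)

      edge-from : ∀ {x y} → Edge Γ' x y → Edge Γ x y ⊎ Cross N K x y
      edge-from (inj₁ (inj₁ (inj₁ (x , k)))) = [ (λ n → inj₂ (inj₁ (n , k))) ,
          (λ h → inj₁ (inj₁ (inj₁ (inj₁ (h , k))))) ]′ (∈*-++ N x)
      edge-from (inj₁ (inj₁ (inj₂ (k , x)))) = [ (λ n → inj₂ (inj₂ (k , n))) ,
          (λ h → inj₁ (inj₁ (inj₁ (inj₂ (k , h))))) ]′ (∈*-++ N x)
      edge-from (inj₁ (inj₂ (inj₁ e))) = [ (λ e → inj₁ (inj₂ (Edge-++ˡ N e))) , (λ e → inj₁ (inj₁ (inj₂ (inj₁ e)))) ]′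
          (Edge-++ N e)
      edge-from (inj₁ (inj₂ (inj₂ e))) = inj₁ (inj₁ (inj₂ (inj₂ e)))
      edge-from (inj₂ e) = inj₁ (inj₂ (Edge-++ʳ N e))

      Alike : V → V → Set
      Alike x y = (x ∈ᵗ ten H K × y ∈ᵗ ten H K) ⊎ (x ∈* N × y ∈* N) ⊎ (x ∈* Y × y ∈* Y)

      alike : ∀ {x y} → Same Γ x y → Alike x y
      alike (inj₁ p) = inj₁ p
      alike (inj₂ s) = inj₂ ([ (λ s → inj₁ (Same⇒∈ N s , Same⇒∈ N (Same-sym N s)))
                             , (λ s → inj₂ (Same⇒∈ Y s , Same⇒∈ Y (Same-sym Y s))) ]′ (Same-++ N s))

      T#N : ∀ {x} → x ∈ᵗ ten H K → x ∈* N → ⊥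
      T#N = [ H#N , K#N ]′

      T#Y : ∀ {x} → x ∈ᵗ ten H K → x ∈* Y → ⊥
      T#Y = [ H#Y , K#Y ]′

      sameY : ∀ {x y} → Same Γ x y → x ∈* Y → y ∈* Y
      sameY s x with alike s
      ... | inj₁ (t , _) = ⊥-elim (T#Y t x)
      ... | inj₂ (inj₁ (n , _)) = ⊥-elim (N#Y n x)
      ... | inj₂ (inj₂ (_ , y)) = y

      sameN : ∀ {x y} → Same Γ x y → x ∈* N → y ∈* N
      sameN s x with alike s
      ... | inj₁ (t , _) = ⊥-elim (T#N t x)
      ... | inj₂ (inj₁ (_ , y)) = y
      ... | inj₂ (inj₂ (y , _)) = ⊥-elim (N#Y x y)

    module _ (bad : Bad Γ') where

      open Bad bad renaming (closed to D-closed; inside to D-inside; anti to D-anti)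

      private
        transfer : (∀ {x y} → x ∈ D → y ∈ D → Cross N K x y → ⊥) → Bad Γ
        transfer none = record
          { D = D ; c = c ; inhabited = inhabited ; inside = λ x → from (D-inside x) ; closed = D-closed ; anti = D-anti
          ; regular = λ x → let open Matched (regular x) in
              matched partner∈ ([ (λ e → e) , (λ x-y → ⊥-elim (none x partner∈ x-y)) ]′ (edge-from edge)) bicolour
                      (λ z e → unique z (edge-to e)) }

        meets : ∀ Δ → Inhabited (D ∩ decided (λ x → x ∈*? Δ)) ⊎ (∀ {x} → x ∈ D → x ∈* Δ → ⊥)
        meets Δ with searchable-Fin n (D ∩ decided (λ x → x ∈*? Δ))
        ... | inj₁ i = inj₁ i
        ... | inj₂ e = inj₂ λ x x∈Δ → e (∈∩ x (∈decided x∈Δ))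

        -- All of `N` and `H` is joined to all of `K` after the merge, so uniqueness of partners
        -- leaves `n` and `k` as the only vertices of `D` on their sides. Before the merge this edge
        -- is missing; it is replaced by the path that enters the arc from `n` at `v` and leaves it
        -- from `h` to `k`.
        module Glue {k n : V} (k∈D : k ∈ D) (k∈K : k ∈* K) (n∈D : n ∈ D) (n∈N : n ∈* N) where

          n×k : ∀ {m l} → m ∈* N ⊎ m ∈* H → l ∈* K → Edge Γ' m l
          n×k m l = inj₁ (inj₁ (inj₁ ([ ∈*-++ˡ N , ∈*-++ʳ N ]′ m , l)))

          only-n : ∀ {m} → m ∈ D → m ∈* N ⊎ m ∈* H → m ≡ n
          only-n m∈D m = trans (unique m∈D (Edge-sym Γ' (n×k m k∈K))) (sym (unique n∈D (Edge-sym Γ' (n×k (inj₁ n∈N) k∈K))))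
            where open Matched (regular k∈D)

          only-k : ∀ {m} → m ∈ D → m ∈* K → m ≡ k
          only-k m∈D m = trans (unique m∈D (n×k (inj₁ n∈N) m)) (sym (unique k∈D (n×k (inj₁ n∈N) k∈K)))
            where open Matched (regular n∈D)

          opposite-colours : c k ≡ not (c n)
          opposite-colours = trans (cong c (unique k∈D (n×k (inj₁ n∈N) k∈K))) bicolour
            where open Matched (regular n∈D)

          βn∉ : β n ∈* N ⊎ β n ∈* H → ⊥
          βn∉ p = β-fixfree (only-n (D-closed n∈D) p)

          module A = Arc (arc n∈N (λ p → βn∉ (inj₁ p)) (λ p → βn∉ (inj₂ p)))
          open A using (E; h; v)

          -- The arc stays within `N` and `H`, where `D` has only `n`; and `n` is not on the arc,
          -- since its partner under `β` lies outside `N` and `H`.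
          E#D : ∀ {x} → x ∈ E → x ∈ D → ⊥
          E#D {x} x∈E x∈D with only-n x∈D (A.inside x∈E)
          ... | refl = βn∉ (A.inside (A.closed x∈E))

          E#Y : ∀ {x z} → x ∈ E → z ∈* Y → Same Γ x z → ⊥
          E#Y x∈E z s = [ (λ n → N#Y n y) , (λ h → H#Y h y) ]′ (A.inside x∈E)
            where y = sameY (Same-sym Γ s) z

          trans-same : ∀ {x y z} → Same Γ x y → Same Γ y z → Same Γ x z
          trans-same = Same-trans Γ linear

          -- The colours of the arc are fixed only up to a global exchange, chosen here so that `h`
          -- takes over the colour of `n`; `v` then gets the opposite one because the ends of an arc
          -- differ.
          shift-by : Bool
          shift-by = A.c h xor c n

          flip : Bool → Bool
          flip b = shift-by xor b

          flip-h : flip (A.c h) ≡ c n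
          flip-h = cancel (A.c h) (c n)
            where
            cancel : ∀ a b → (a xor b) xor a ≡ b
            cancel true  true  = refl
            cancel true  false = refl
            cancel false true  = refl
            cancel false false = refl

          flip-not : ∀ b → flip (not b) ≡ not (flip b)
          flip-not b = commute shift-by b
            where
            commute : ∀ a b → a xor not b ≡ not (a xor b)
            commute true  b = refl
            commute false b = refl

          c' : V → Bool
          c' x = if E x then flip (A.c x) else c x

          c'-E : ∀ {x} → x ∈ E → c' x ≡ flip (A.c x)
          c'-E {x} (mem p) = cong (λ b → if b then flip (A.c x) else c x) p

          c'-D : ∀ {x} → x ∈ D → c' x ≡ c x
          c'-D {x} x∈D with E x in eq
          ... | true  = ⊥-elim (E#D (mem eq) x∈D)
          ... | false = refl

          c'-h : c' h ≡ c n
          c'-h = trans (c'-E A.h∈E) flip-h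

          c'-v : c' v ≡ not (c n)
          c'-v = trans (c'-E A.v∈E) (trans (cong flip A.ends) (trans (flip-not (A.c h)) (cong not flip-h)))

          no-loop : ∀ {x z} → Edge Γ x z → ¬ (z ≡ x)
          no-loop e refl = Edge-irrefl Γ linear e

          k-n : ¬ Edge Γ k n
          k-n e = T#N (inj₂ k∈K) (sameN (Same-sym Γ (Edge⇒Same Γ e)) n∈N)

          k-only-n : ∀ {z} → z ∈ D → Edge Γ k z → z ≡ n
          k-only-n z e = trans (unique z (edge-to e)) (sym (unique n∈D (Edge-sym Γ' (n×k (inj₁ n∈N) k∈K))))
            where open Matched (regular k∈D)

          n-only-k : ∀ {z} → z ∈ D → Edge Γ n z → z ≡ k
          n-only-k z e = trans (unique z (edge-to e)) (sym (unique k∈D (n×k (inj₁ n∈N) k∈K)))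
            where open Matched (regular n∈D)

          tree : ∀ {x y} → x ∈ᵗ ten H K → y ∈ᵗ ten H K → Same Γ x y
          tree x y = inj₁ (x , y)

          D' : Subset V
          D' = D ∪ E

          M : V → Set
          M = Matched (Edge Γ) (Edge Γ) D' c'

          match-h : M h
          match-h = matched (∪ˡ k∈D) (inj₁ (inj₁ (inj₁ (A.h∈H , k∈K))))
            (trans (c'-D k∈D) (trans opposite-colours (cong not (sym c'-h))))
            (λ {z} z∈ e → [ (λ z∈D → inD z∈D (Edge⇒Same Γ e)) , (λ z∈E → ⊥-elim
                (no-loop e (A.at-h z∈E (Edge⇒Same Γ e)))) ]′ (∪-elim z∈))
            where
            inD : ∀ {z} → z ∈ D → Same Γ h z → z ≡ k
            inD z∈D s with alike s
            ... | inj₁ (_ , inj₂ z∈K) = only-k z∈D z∈K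
            ... | inj₁ (_ , inj₁ z∈H) = ⊥-elim (H#N (subst (_∈* H) (only-n z∈D (inj₂ z∈H)) z∈H) n∈N)
            ... | inj₂ (inj₁ (hN , _)) = ⊥-elim (H#N A.h∈H hN)
            ... | inj₂ (inj₂ (hY , _)) = ⊥-elim (H#Y A.h∈H hY)

          v~n : Same Γ v n
          v~n = Crosses⇒Same Γ A.v×n

          match-v : M v
          match-v = matched (∪ˡ n∈D) (Crosses⇒Edge Γ A.v×n)
            (trans (c'-D n∈D) (trans (sym (not-involutive _)) (cong not (sym c'-v))))
            (λ {z} z∈ e → [ (λ z∈D → only-n z∈D (inj₁ (sameN (trans-same (Same-sym Γ v~n) (Edge⇒Same Γ e)) n∈N)))
                          , (λ z∈E → ⊥-elim (no-loop e (A.at-v z∈E (Edge⇒Same Γ e)))) ]′ (∪-elim z∈))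

          match-inner : ∀ {x} → x ∈ E → ¬ (x ≡ h) → ¬ (x ≡ v) → M x
          match-inner {x} x∈E x≢h x≢v = matched (∪ʳ partner∈) (Crosses⇒Edge Γ edge)
            (trans (c'-E partner∈) (trans (cong flip bicolour) (trans (flip-not _) (cong not (sym (c'-E x∈E))))))
            (λ {z} z∈ e → [ (λ z∈D → ⊥-elim (outer z∈D (Edge⇒Same Γ e) (A.inside x∈E)))
                          , (λ z∈E → unique z∈E (Edge⇒Same Γ e , no-loop e)) ]′ (∪-elim z∈))
            where
            open Matched (A.inner x∈E x≢h x≢v)
            outer : ∀ {z} → z ∈ D → Same Γ x z → x ∈* N ⊎ x ∈* H → ⊥
            outer z∈D s (inj₁ xN) = x≢v (A.at-v x∈E (trans-same v~n
              (subst (λ z → Same Γ z x) (only-n z∈D (inj₁ (sameN s xN))) (Same-sym Γ s))))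
            outer z∈D s (inj₂ xH) with alike s
            ... | inj₁ (_ , inj₂ z∈K) = x≢h (A.at-h x∈E (tree (inj₁ A.h∈H) (inj₁ xH)))
            ... | inj₁ (_ , inj₁ z∈H) = H#N (subst (_∈* H) (only-n z∈D (inj₂ z∈H)) z∈H) n∈N
            ... | inj₂ (inj₁ (xN , _)) = H#N xH xN
            ... | inj₂ (inj₂ (xY , _)) = H#Y xH xY

          match-E : ∀ {x} → x ∈ E → M x
          match-E {x} x∈E with x ≟ h | x ≟ v
          ... | yes refl | _        = match-h
          ... | no _     | yes refl = match-v
          ... | no x≢h   | no x≢v   = match-inner x∈E x≢h x≢v

          match-k : M k
          match-k = matched (∪ʳ A.h∈E) (inj₁ (inj₁ (inj₂ (k∈K , A.h∈H))))
            (trans c'-h (trans (sym (not-involutive _)) (cong not (trans (sym opposite-colours) (sym (c'-D k∈D))))))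
            (λ {z} z∈ e → [ (λ z∈D → ⊥-elim (k-n (subst (Edge Γ k) (k-only-n z∈D e) e)))
                          , (λ z∈E → A.at-h z∈E (trans-same (tree (inj₁ A.h∈H) (inj₂ k∈K)) (Edge⇒Same Γ e))) ]′ (∪-elim z∈))

          match-n : M n
          match-n = matched (∪ʳ A.v∈E) (Edge-sym Γ (Crosses⇒Edge Γ A.v×n))
            (trans c'-v (cong not (sym (c'-D n∈D))))
            (λ {z} z∈ e → [ (λ z∈D → ⊥-elim (k-n (Edge-sym Γ (subst (Edge Γ n) (n-only-k z∈D e) e))))
                          , (λ z∈E → A.at-v z∈E (trans-same v~n (Edge⇒Same Γ e))) ]′ (∪-elim z∈))

          match-Y : ∀ {x} → x ∈ D → x ∈* Y → M x
          match-Y {x} x∈D xY = matched (∪ˡ partner∈) ([ (λ e → e) , (λ x-y → ⊥-elim (away x-y)) ]′ (edge-from edge))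
            (trans (c'-D partner∈) (trans bicolour (cong not (sym (c'-D x∈D)))))
            (λ {z} z∈ e → [ (λ z∈D → unique z∈D (edge-to e)) , (λ z∈E → ⊥-elim
                (E#Y z∈E xY (Same-sym Γ (Edge⇒Same Γ e)))) ]′ (∪-elim z∈))
            where
            open Matched (regular x∈D)
            away : ∀ {y} → Cross N K x y → ⊥
            away (inj₁ (xN , _)) = N#Y xN xY
            away (inj₂ (xK , _)) = K#Y xK xY

          match-D : ∀ {x} → x ∈ D → M x
          match-D {x} x∈D with from (D-inside x∈D)
          ... | inj₁ (inj₁ xH) = ⊥-elim (H#N (subst (_∈* H) (only-n x∈D (inj₂ xH)) xH) n∈N)
          ... | inj₁ (inj₂ xK) = subst M (sym (only-k x∈D xK)) match-k
          ... | inj₂ p with ∈*-++ N p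
          ...   | inj₁ xN = subst M (sym (only-n x∈D (inj₁ xN))) match-n
          ...   | inj₂ xY = match-Y x∈D xY

          glued : Bad Γ
          glued = record
            { D = D' ; c = c' ; inhabited = k , ∪ˡ k∈D
            ; inside = λ x → [ (λ d → from (D-inside d))
                             , (λ e → [ (λ n → inj₂ (∈*-++ˡ N n)) , (λ h → inj₁ (inj₁ h)) ]′ (A.inside e)) ]′ (∪-elim x)
            ; closed = λ x → [ (λ d → ∪ˡ (D-closed d)) , (λ e → ∪ʳ (A.closed e)) ]′ (∪-elim x)
            ; anti = λ x → [ (λ d → trans (c'-D (D-closed d)) (trans (D-anti d) (cong not (sym (c'-D d)))))
                           , (λ e → trans (c'-E (A.closed e)) (trans (cong flip (A.anti e))
                               (trans (flip-not _) (cong not (sym (c'-E e)))))) ]′ (∪-elim x)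
            ; regular = λ x → [ match-D , match-E ]′ (∪-elim x) }

      unmerge : Bad Γ
      unmerge with meets K | meets N
      ... | inj₂ noK | _ = transfer λ { x y (inj₁ (_ , k)) → noK y k ; x y (inj₂ (k , _)) → noK x k }
      ... | inj₁ _ | inj₂ noN = transfer λ { x y (inj₁ (n , _)) → noN x n ; x y (inj₂ (_ , n)) → noN y n }
      ... | inj₁ (k , k∈) | inj₁ (n , n∈) =
        Glue.glued (∩ˡ k∈) (decided∈ (∩ʳ k∈)) (∩ˡ n∈) (decided∈ (∩ʳ n∈))

    merge-valid : Valid Γ'
    merge-valid = record { linear = linear' ; closed = λ x → to (closed (from x)) ; good = λ b → good (unmerge b) }

-- Sequentialisation

module Sequentialisation {n : ℕ} (label : Fin n → Atom) (β : Fin n → Fin n)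
                (β-invol : ∀ x → β (β x) ≡ x) (β-dual : ∀ x → label (β x) ≡ dual (label x)) where

  open Leaves {Fin n}
  open Matching label β β-invol β-dual
  open Semantics label using (Derivable; nil; ax; split; merge; flip; perm)

  -- Alternating walks between trees, and loops

  module Walks (Γ : List (Tree V)) (linear : Linear Γ) (closed : ∀ {x} → x ∈* Γ → β x ∈* Γ) where

    private
      infix 4 _~_
      _~_ : V → V → Set
      x ~ y = Same Γ x y
      ~-sym : ∀ {x y} → x ~ y → y ~ x
      ~-sym = Same-sym Γ
      ~-trans : ∀ {x y z} → x ~ y → y ~ z → x ~ z
      ~-trans = Same-trans Γ linear
      cross~ : ∀ {x y} → Crosses Γ x y → x ~ y
      cross~ = Crosses⇒Same Γ
      cross-irrefl : ∀ {x} → ¬ Crosses Γ x x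
      cross-irrefl c = Edge-irrefl Γ linear (Crosses⇒Edge Γ c)

    -- Walk h l a: an alternating walk from a to h; it leaves each tree along the linking at the vertex listed in l
    -- (newest first), which lies opposite to the vertex where the tree was entered.
    data Walk : V → List V → V → Set where
      stop : ∀ {w} → w ∈* Γ → Walk w (w ∷ []) w
      step : ∀ {w w' l a} → Walk w' l a → Crosses Γ (β w') w → All (λ p → ¬ (w ~ p)) l → Walk w (w ∷ l) a

    walk-∈ : ∀ {h l a p} → Walk h l a → p ∈ˡ l → p ∈* Γ
    walk-∈ (stop w) (here refl) = w
    walk-∈ (step W c _) (here refl) = Same⇒∈ Γ (~-sym (cross~ c))
    walk-∈ (step W c _) (there p) = walk-∈ W p

    newest : ∀ {h l a} → Walk h l a → h ∈ˡ l
    newest (stop _) = here refl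
    newest (step _ _ _) = here refl

    oldest : ∀ {h l a} → Walk h l a → a ∈ˡ l
    oldest (stop _) = here refl
    oldest (step W _ _) = there (oldest W)

    distinct : ∀ {h l a p q} → Walk h l a → p ∈ˡ l → q ∈ˡ l → p ~ q → p ≡ q
    distinct (stop _) (here refl) (here refl) s = refl
    distinct (step _ _ _) (here refl) (here refl) s = refl
    distinct (step _ _ new) (here refl) (there q) s = ⊥-elim (All.lookup new q s)
    distinct (step _ _ new) (there p) (here refl) s = ⊥-elim (All.lookup new p (~-sym s))
    distinct (step W _ _) (there p) (there q) s = distinct W p q s

    Next : ∀ {h l a} → Walk h l a → V → V → Set
    Next (stop _) p q = ⊥
    Next (step {w} {w'} W _ _) p q = (p ≡ w' × q ≡ w) ⊎ Next W p q

    next-∈ : ∀ {h l a p q} (W : Walk h l a) → Next W p q → p ∈ˡ l × q ∈ˡ l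
    next-∈ (step W _ _) (inj₁ (refl , refl)) = there (newest W) , here refl
    next-∈ (step W _ _) (inj₂ nx) = let p , q = next-∈ W nx in there p , there q

    next-cross : ∀ {h l a p q} (W : Walk h l a) → Next W p q → Crosses Γ (β p) q
    next-cross (step W c _) (inj₁ (refl , refl)) = c
    next-cross (step W _ _) (inj₂ nx) = next-cross W nx

    fresh : ∀ {h l a w w'} (W : Walk h l a) → Crosses Γ (β w') w → All (λ p → ¬ (w ~ p)) l → ¬ (w ∈ˡ l)
    fresh W c new w∈ = All.lookup new w∈ (Same-refl Γ (Same⇒∈ Γ (~-sym (cross~ c))))

    next-functional : ∀ {h l a p p' q} (W : Walk h l a) → Next W p q → Next W p' q → p ≡ p'
    next-functional (step W c new) (inj₁ (refl , refl)) (inj₁ (refl , _)) = refl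
    next-functional (step W c new) (inj₁ (refl , refl)) (inj₂ nx) = ⊥-elim (fresh W c new (proj₂ (next-∈ W nx)))
    next-functional (step W c new) (inj₂ nx) (inj₁ (refl , refl)) = ⊥-elim (fresh W c new (proj₂ (next-∈ W nx)))
    next-functional (step W c new) (inj₂ nx) (inj₂ nx') = next-functional W nx nx'

    next-oldest : ∀ {h l a p q} (W : Walk h l a) → Next W p q → ¬ (q ≡ a)
    next-oldest (step W c new) (inj₁ (refl , refl)) refl = fresh W c new (oldest W)
    next-oldest (step W _ _) (inj₂ nx) = next-oldest W nx

    older : ∀ {h l a q} (W : Walk h l a) → q ∈ˡ l → q ≡ a ⊎ Σ[ p ∈ V ] Next W p q
    older (stop _) (here refl) = inj₁ refl
    older (step {w' = w'} W _ _) (here refl) = inj₂ (w' , inj₁ (refl , refl))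
    older (step W _ _) (there q) = map₂ (λ (p , nx) → p , inj₂ nx) (older W q)

    newer : ∀ {h l a p} (W : Walk h l a) → p ∈ˡ l → p ≡ h ⊎ Σ[ q ∈ V ] Next W p q
    newer (stop _) (here refl) = inj₁ refl
    newer (step W _ _) (here refl) = inj₁ refl
    newer (step {w} W _ _) (there q) = [ (λ { refl → inj₂ (w , inj₁ (refl , refl)) }) ,
        (λ (p , nx) → inj₂ (p , inj₂ nx)) ]′ (newer W q)

    -- The stretch from `w` to the newest vertex. It avoids `a`, and hence the tree into which the
    -- loop closes.
    upper : ∀ {h l a w} → Walk h l a → w ∈ˡ l → ¬ (w ≡ a)
          → Σ[ l' ∈ List V ] (Walk h l' w × (∀ {p} → p ∈ˡ l' → p ∈ˡ l × ¬ (p ≡ a)))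
    upper (stop _) (here refl) w≢a = ⊥-elim (w≢a refl)
    upper {w = w} W@(step _ _ _) (here refl) w≢a = w ∷ [] , stop (walk-∈ W (here refl)) , λ { (here refl) → here refl
        , w≢a }
    upper (step {w} W c new) (there w∈) w≢a with upper W w∈ w≢a
    ... | l' , W' , sub = w ∷ l' , step W' c (All.tabulate (λ p → All.lookup new (proj₁ (sub p))))
        , λ { (here refl) → here refl , (λ { refl → fresh W c new (oldest W) }) ; (there p) → there (proj₁ (sub p))
            , proj₂ (sub p) }

    -- The stretch from the oldest vertex to the one just before `w`. It avoids `w`, although the
    -- link at its end leads into the tree of `w`.
    lower : ∀ {h l a v w} (W : Walk h l a) → Next W v w
          → Σ[ l' ∈ List V ] (Walk v l' a × (∀ {p} → p ∈ˡ l' → p ∈ˡ l × ¬ (p ≡ w)))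
    lower (step {w} {l = l} W c new) (inj₁ (refl , refl)) = l , W , λ p → there p , λ { refl → fresh W c new p }
    lower (step W c new) (inj₂ nx) with lower W nx
    ... | l' , W' , sub = l' , W' , λ p → there (proj₁ (sub p)) , proj₂ (sub p)

    _∈ˡ?_ : (x : V) (l : List V) → Dec (x ∈ˡ l)
    x ∈ˡ? l = Any.any? (x ≟_) l

    -- Listed vertices are coloured 0 and their partners 1, so that links and crossings both
    -- alternate. `out` covers two situations at once: the walk closes up across the tensor of `a`,
    -- or its final link leads to a tree not on the walk, in which case `out` holds vacuously.
    module Track {h l a} (W : Walk h l a) (out : ∀ {p} → p ∈ˡ l → β h ~ p → p ≡ a × Crosses Γ (β h) a) where

      visited : Subset V
      visited = decided (_∈ˡ? l)

      E : Subset V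
      E = decided (λ x → (x ∈ˡ? l) ⊎-dec (β x ∈ˡ? l))

      c : V → Bool
      c x = not (visited x)

      c-visited : ∀ {x} → x ∈ˡ l → c x ≡ false
      c-visited p = cong not (holds (∈decided {P? = _∈ˡ? l} p))

      c-other : ∀ {x} → ¬ (x ∈ˡ l) → c x ≡ true
      c-other {x} ¬p with visited x in eq
      ... | true  = ⊥-elim (¬p (decided∈ {P? = _∈ˡ? l} (mem eq)))
      ... | false = refl

      data Location (x : V) : Set where
        at   : x ∈ˡ l → Location x
        link : ∀ {p q} → Next W p q → x ≡ β p → Location x
        exit : x ≡ β h → Location x

      locate : ∀ {x} → x ∈ E → Location x
      locate x∈E with decided∈ x∈E
      ... | inj₁ p = at p
      ... | inj₂ p with newer W p
      ...   | inj₁ eq = exit (sym (β-swap eq))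
      ...   | inj₂ (q , nx) = link nx (sym (β-invol _))

      -- The partner of a listed vertex lies across from the next listed vertex. Were it listed too,
      -- it would be that vertex, as the walk lists one vertex per tree, and nothing lies across
      -- from itself.
      β∉ : ∀ {x} → x ∈ˡ l → ¬ (β x ∈ˡ l)
      β∉ x∈ βx∈ with newer W x∈
      ... | inj₁ refl with out βx∈ (Same-refl Γ (walk-∈ W βx∈))
      ...   | eq , cr = cross-irrefl (subst (λ z → Crosses Γ z _) eq cr)
      β∉ x∈ βx∈ | inj₂ (q , nx) with distinct W βx∈ (proj₂ (next-∈ W nx)) (cross~ (next-cross W nx))
      ... | refl = cross-irrefl (next-cross W nx)

      a∈E : a ∈ E
      a∈E = ∈decided (inj₁ (oldest W))

      βh∈E : β h ∈ E
      βh∈E = ∈decided (inj₂ (subst (_∈ˡ l) (sym (β-invol h)) (newest W)))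

      E-closed : ∀ {x} → x ∈ E → β x ∈ E
      E-closed x∈E = ∈decided ([ (λ p → inj₂ (subst (_∈ˡ l) (sym (β-invol _)) p)) , inj₁ ]′ (decided∈ x∈E))

      E-anti : ∀ {x} → x ∈ E → c (β x) ≡ not (c x)
      E-anti x∈E with decided∈ x∈E
      ... | inj₁ p = trans (c-other (β∉ p)) (cong not (sym (c-visited p)))
      ... | inj₂ p = trans (c-visited p) (cong not (sym (c-other (λ q → β∉ q p))))

      c-a : c a ≡ false
      c-a = c-visited (oldest W)

      c-βh : c (β h) ≡ true
      c-βh = c-other (β∉ (newest W))

      link~ : ∀ {p q} → Next W p q → β p ~ q
      link~ nx = cross~ (next-cross W nx)

      at-a : ∀ {z} → z ∈ E → a ~ z → z ≡ a ⊎ z ≡ β h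
      at-a z∈E s with locate z∈E
      ... | at p = inj₁ (sym (distinct W (oldest W) p s))
      ... | exit eq = inj₂ eq
      ... | link nx refl = ⊥-elim (next-oldest W nx (sym (distinct W (oldest W) (proj₂ (next-∈ W nx)) (~-trans s
          (link~ nx)))))

      at-βh : ∀ {z} → z ∈ E → β h ~ z → z ≡ β h ⊎ z ≡ a
      at-βh z∈E s with locate z∈E
      ... | at p = inj₂ (proj₁ (out p s))
      ... | exit eq = inj₁ eq
      ... | link nx refl = ⊥-elim (next-oldest W nx (proj₁ (out (proj₂ (next-∈ W nx)) (~-trans s (link~ nx)))))

      inner : ∀ {x} → x ∈ E → ¬ (x ≡ a) → ¬ (x ≡ β h) → Matched (Crosses Γ) (λ x z → x ~ z × ¬ (z ≡ x)) E c x
      inner x∈E x≢a x≢βh with locate x∈E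
      ... | exit eq = ⊥-elim (x≢βh eq)
      ... | at x∈ with older W x∈
      ...   | inj₁ eq = ⊥-elim (x≢a eq)
      ...   | inj₂ (p , nx) = matched
              (∈decided (inj₂ (subst (_∈ˡ l) (sym (β-invol p)) (proj₁ (next-∈ W nx)))))
              (Crosses-sym Γ (next-cross W nx))
              (trans (c-other (β∉ (proj₁ (next-∈ W nx)))) (cong not (sym (c-visited x∈))))
              uniq
        where
        uniq : ∀ {z} → z ∈ E → _ ~ z × ¬ (z ≡ _) → z ≡ β p
        uniq z∈E (s , ne) with locate z∈E
        ... | at z∈ = ⊥-elim (ne (sym (distinct W x∈ z∈ s)))
        ... | exit refl = ⊥-elim (x≢a (proj₁ (out x∈ (~-sym s))))
        ... | link nx' refl with distinct W x∈ (proj₂ (next-∈ W nx')) (~-trans s (link~ nx'))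
        ...   | refl = cong β (next-functional W nx' nx)
      inner x∈E x≢a x≢βh | link {p} {q} nx refl = matched
              (∈decided (inj₁ (proj₂ (next-∈ W nx)))) (next-cross W nx)
              (trans (c-visited (proj₂ (next-∈ W nx))) (cong not (sym (c-other (β∉ (proj₁ (next-∈ W nx)))))))
              uniq
        where
        uniq : ∀ {z} → z ∈ E → β p ~ z × ¬ (z ≡ β p) → z ≡ q
        uniq z∈E (s , ne) with locate z∈E
        ... | at z∈ = sym (distinct W (proj₂ (next-∈ W nx)) z∈ (~-trans (~-sym (link~ nx)) s))
        ... | exit refl = ⊥-elim (next-oldest W nx (proj₁ (out (proj₂ (next-∈ W nx)) (~-trans (~-sym s) (link~ nx)))))
        ... | link nx' refl with distinct W (proj₂ (next-∈ W nx')) (proj₂ (next-∈ W nx)) (~-trans (~-sym (link~ nx'))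
            (~-trans (~-sym s) (link~ nx)))
        ...   | refl = ⊥-elim (ne (cong β (next-functional W nx' nx)))

      E-inside : ∀ {x} → x ∈ E → x ∈* Γ
      E-inside x∈E = [ walk-∈ W , (λ p → subst (_∈* Γ) (β-invol _) (closed (walk-∈ W p))) ]′ (decided∈ x∈E)

      near : ∀ {x} → x ∈ E → x ≡ β h ⊎ x ≡ a ⊎ Σ[ p ∈ V ] (p ∈ˡ l × ¬ (p ≡ a) × x ~ p)
      near {x} x∈E with locate x∈E
      ... | exit eq = inj₁ eq
      ... | link nx refl = inj₂ (inj₂ (_ , proj₂ (next-∈ W nx) , next-oldest W nx , link~ nx))
      ... | at x∈ with x ≟ a
      ...   | yes eq = inj₂ (inj₁ eq)
      ...   | no ne  = inj₂ (inj₂ (_ , x∈ , ne , Same-refl Γ (walk-∈ W x∈)))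

    -- Each tree on the walk contains exactly two vertices of the track, and these lie across its
    -- root. Adjacency never leaves a tree, so there are no chords.
    closed-walk-bad : ∀ {h l a} → Walk h l a → (∀ {p} → p ∈ˡ l → β h ~ p → p ≡ a) → Crosses Γ (β h) a → Bad Γ
    closed-walk-bad {h} {l} {a} W out cr = record
      { D = E ; c = c ; inhabited = a , a∈E ; inside = E-inside ; closed = E-closed ; anti = E-anti ; regular = regular }
      where
      open Track W (λ p s → out p s , cr)
      no-loop : ∀ {x z} → Edge Γ x z → ¬ (z ≡ x)
      no-loop e refl = Edge-irrefl Γ linear e
      regular : ∀ {x} → x ∈ E → Matched (Edge Γ) (Edge Γ) E c x
      regular {x} x∈E with x ≟ a | x ≟ β h
      ... | yes refl | _ = matched βh∈E (Edge-sym Γ (Crosses⇒Edge Γ cr)) (trans c-βh (cong not (sym c-a)))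
              (λ z e → [ (λ eq → ⊥-elim (no-loop e eq)) , (λ eq → eq) ]′ (at-a z (Edge⇒Same Γ e)))
      ... | no _ | yes refl = matched a∈E (Crosses⇒Edge Γ cr) (trans c-a (cong not (sym c-βh)))
              (λ z e → [ (λ eq → ⊥-elim (no-loop e eq)) , (λ eq → eq) ]′ (at-βh z (Edge⇒Same Γ e)))
      ... | no x≢a | no x≢βh = let open Matched (inner x∈E x≢a x≢βh) in
              matched partner∈ (Crosses⇒Edge Γ edge) bicolour (λ z e → unique z (Edge⇒Same Γ e , no-loop e))

    -- The loop leaves and re-enters the tree of a on the same side H; N lists the other trees it visits. A vertex of N
    -- lies opposite to one of the two loop vertices of its tree, so one of the two arcs back to H starts there.
    module Blossom {h l a} (W : Walk h l a) (out : ∀ {p} → p ∈ˡ l → β h ~ p → p ≡ a) (H N : List (Tree V))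
                   (a∈H : a ∈* H) (βh∈H : β h ∈* H) (βh~a : β h ~ a)
                   (toN : ∀ {p x} → p ∈ˡ l → ¬ (p ≡ a) → x ~ p → x ∈* N)
                   (fromN : ∀ {x} → x ∈* N → Σ[ p ∈ V ] (p ∈ˡ l × ¬ (p ≡ a) × x ~ p)) where

      arc : ∀ {x} → x ∈* N → Arc Γ H N x
      arc {x} x∈N with fromN x∈N
      ... | w , w∈ , w≢a , x~w with older W w∈
      ...   | inj₁ eq = ⊥-elim (w≢a eq)
      ...   | inj₂ (v , nx) with opposite Γ linear x~w (Crosses-sym Γ (next-cross W nx))
      -- `x` lies opposite `w`: the arc follows the loop forwards from `w` and ends at `β h` in `H`.
      ...     | inj₁ cr with upper W w∈ w≢a
      ...       | l' , W' , sub = record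
                  { E = E ; c = c ; h = β h ; v = w ; h∈H = βh∈H ; h∈E = βh∈E ; v∈E = a∈E ; v×n = Crosses-sym Γ cr
                  ; closed = E-closed ; anti = E-anti
                  ; inside = λ z → [ (λ { refl → inj₂ βh∈H }) , [
                      (λ { refl → inj₁ (toN w∈ w≢a (Same-refl Γ (walk-∈ W w∈))) })
                                   , (λ (p , p∈ , _ , s) → inj₁ (toN (proj₁ (sub p∈)) (proj₂ (sub p∈)) s)) ]′ ]′ (near z)
                  ; ends = trans c-a (cong not (sym c-βh))
                  ; at-h = λ z s → [ (λ eq → eq) , (λ { refl → ⊥-elim (no-return s) }) ]′ (at-βh z s)
                  ; at-v = λ z s → [ (λ eq → eq) , (λ { refl → ⊥-elim (no-return (~-sym s)) }) ]′ (at-a z s)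
                  ; inner = λ z z≢h z≢v → inner z z≢v z≢h }
        where
        no-return : ¬ (β h ~ w)
        no-return s = w≢a (out w∈ s)
        open Track W' (λ p s → ⊥-elim (proj₂ (sub p) (out (proj₁ (sub p)) s)))
      -- `x` lies opposite `β v`, where the loop enters the tree: the arc follows the loop backwards
      -- from there and ends at `a` in `H`.
      arc {x} x∈N | w , w∈ , w≢a , x~w | inj₂ (v , nx) | inj₂ cr with lower W nx
      ... | l' , W' , sub = record
                  { E = E ; c = c ; h = a ; v = β v ; h∈H = a∈H ; h∈E = a∈E ; v∈E = βh∈E ; v×n = Crosses-sym Γ cr
                  ; closed = E-closed ; anti = E-anti
                  ; inside = λ z → [ (λ { refl → inj₁ (toN w∈ w≢a link~w) }) , [ (λ { refl → inj₂ a∈H })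
                                   , (λ (p , p∈ , p≢a , s) → inj₁ (toN (proj₁ (sub p∈)) p≢a s)) ]′ ]′ (near z)
                  ; ends = trans c-βh (cong not (sym c-a))
                  ; at-h = λ z s → [ (λ eq → eq) , (λ { refl → ⊥-elim (apart (~-sym s)) }) ]′ (at-a z s)
                  ; at-v = λ z s → [ (λ eq → eq) , (λ { refl → ⊥-elim (apart s) }) ]′ (at-βh z s)
                  ; inner = inner }
        where
        link~w : β v ~ w
        link~w = cross~ (next-cross W nx)
        apart : ¬ (β v ~ a)
        apart s = w≢a (distinct W w∈ (oldest W) (~-trans (~-sym link~w) s))
        open Track W' (λ p s → ⊥-elim (proj₂ (sub p) (distinct W (proj₁ (sub p)) w∈ (~-trans (~-sym s) link~w))))

    -- The link at `w` leaves the side of the tensor on which `w` lies. This excludes a loop inside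
    -- a single side, whose contraction would merge nothing.
    escapes : V → Set
    escapes w = β w ~ w → Crosses Γ (β w) w

    record Loop : Set where
      field
        {h a}   : V
        {l}     : List V
        walk    : Walk h l a
        closing : β h ~ a
        first   : ∀ {p} → p ∈ˡ l → β h ~ p → p ≡ a
        escape  : escapes h

    -- The initial part of the walk is dropped, so that it starts in the tree of `u`.
    cut : ∀ {h l a} u → Walk h l a → Any (u ~_) l
        → Σ[ l' ∈ List V ] Σ[ a' ∈ V ] (Walk h l' a' × u ~ a' × (∀ {p} → p ∈ˡ l' → u ~ p → p ≡ a') ×
            (∀ {p} → p ∈ˡ l' → p ∈ˡ l))
    cut u W@(stop _) (here s) = _ , _ , W , s , (λ { (here refl) _ → refl }) , λ p → p
    cut u (step {w} W c new) any with same? Γ u w | any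
    ... | yes s | _ = w ∷ [] , w , stop (Same⇒∈ Γ (~-sym s)) , s , (λ { (here refl) _ → refl }) , λ { (here refl)
        → here refl }
    ... | no ns | here s = ⊥-elim (ns s)
    ... | no ns | there k with cut u W k
    ...   | l' , a' , W' , s , first , sub =
      w ∷ l' , a' , step W' c (All.tabulate (λ p → All.lookup new (sub p))) , s
      , (λ { (here refl) s' → ⊥-elim (ns s') ; (there p) s' → first p s' }) , λ { (here refl) → here refl ; (there p)
          → there (sub p) }

  -- Reducible trees and the search for a loop

  extract : ∀ Γ {x} → x ∈* Γ → Σ[ t ∈ Tree V ] Σ[ Γ' ∈ List (Tree V) ] (Γ ↭ t ∷ Γ' × x ∈ᵗ t)
  extract (t ∷ Γ) (inj₁ p) = t , Γ , ↭-refl , p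
  extract (t ∷ Γ) (inj₂ p) with extract Γ p
  ... | u , Γ' , eq , q = u , t ∷ Γ' , ↭-trans (↭.prep t eq) (↭.swap t u ↭-refl) , q

  Closed : List (Tree V) → Set
  Closed H = ∀ {x} → x ∈* H → β x ∈* H

  Escape : List (Tree V) → Set
  Escape H = Σ[ x ∈ V ] (x ∈* H × ¬ (β x ∈* H))

  escape? : ∀ H → Escape H ⊎ Closed H
  escape? H with searchable-Fin n (decided (λ x → (x ∈*? H) ×-dec ¬? (β x ∈*? H)))
  ... | inj₁ (x , p) = inj₁ (x , decided∈ p)
  ... | inj₂ e = inj₂ λ {x} x∈ → case β x ∈*? H of λ { (yes q) → q ; (no q) → ⊥-elim (e (∈decided (x∈ , q))) }

  data Open : Tree V → Set where
    opened : ∀ {H K} → Escape H → Escape K → Open (ten H K)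

  data Special : Tree V → Set where
    is-leaf : ∀ {x} → Special (leaf x)
    closedˡ : ∀ {H K} → Closed H → Special (ten H K)
    closedʳ : ∀ {H K} → Closed K → Special (ten H K)

  find : ∀ Γ → All Open Γ ⊎ Σ[ t ∈ Tree V ] Σ[ Γ' ∈ List (Tree V) ] (Γ ↭ t ∷ Γ' × Special t)
  find [] = inj₁ []
  find (leaf x ∷ Γ) = inj₂ (leaf x , Γ , ↭-refl , is-leaf)
  find (ten H K ∷ Γ) with escape? H | escape? K | find Γ
  ... | inj₂ cH | _ | _ = inj₂ (_ , Γ , ↭-refl , closedˡ cH)
  ... | inj₁ _ | inj₂ cK | _ = inj₂ (_ , Γ , ↭-refl , closedʳ cK)
  ... | inj₁ eH | inj₁ eK | inj₁ all = inj₁ (opened eH eK ∷ all)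
  ... | inj₁ _ | inj₁ _ | inj₂ (t , Γ' , p , s) =
    inj₂ (t , ten H K ∷ Γ' , ↭-trans (↭.prep _ p) (↭.swap _ t ↭-refl) , s)

  module Search (Γ : List (Tree V)) (linear : Linear Γ) (closed : ∀ {x} → x ∈* Γ → β x ∈* Γ) (open' : All Open Γ) where

    open Walks Γ linear closed

    -- The side opposite `u` is not closed under the linking, which provides `w`. A link from `w`
    -- that stays in the tree must cross the root.
    cross-escape : ∀ Δ → Linear Δ → All Open Δ → ∀ {u} → u ∈* Δ
                 → Σ[ w ∈ V ] (Crosses Δ u w × (Same Δ (β w) w → Crosses Δ (β w) w))
    cross-escape (t ∷ Δ) (_ , l , d) (_ ∷ os) (inj₂ u) with cross-escape Δ l os u
    ... | w , cr , es = w , inj₂ cr , λ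
      { (inj₁ (_ , w∈t)) → ⊥-elim (d w∈t (Same⇒∈ Δ (Same-sym Δ (Crosses⇒Same Δ cr)))) ; (inj₂ s) → inj₂ (es s) }
    cross-escape (ten H K ∷ Δ) (_ , l , d) (opened (w , w∈H , esc) _ ∷ os) (inj₁ (inj₂ u)) = w , inj₁ (inj₂ (u , w∈H)) , λ
      { (inj₁ (inj₁ q , _)) → ⊥-elim (esc q) ; (inj₁ (inj₂ q , _)) → inj₁ (inj₂ (q , w∈H))
      ; (inj₂ s) → ⊥-elim (d (inj₁ w∈H) (Same⇒∈ Δ (Same-sym Δ s))) }
    cross-escape (ten H K ∷ Δ) (_ , l , d) (opened _ (w , w∈K , esc) ∷ os) (inj₁ (inj₁ u)) = w , inj₁ (inj₁ (u , w∈K)) , λ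
      { (inj₁ (inj₂ q , _)) → ⊥-elim (esc q) ; (inj₁ (inj₁ q , _)) → inj₁ (inj₁ (q , w∈K))
      ; (inj₂ s) → ⊥-elim (d (inj₂ w∈K) (Same⇒∈ Δ (Same-sym Δ s))) }

    Inner : Tree V → Set
    Inner t = ∀ {x y} → x ∈ᵗ t → y ∈ᵗ t → Same Γ x y

    -- `Δ` holds the trees that the walk has not visited. Each extension uses up one of them, so a
    -- visited tree is met again within `k` extensions.
    search : ∀ k Δ → length Δ ≤ k → All Inner Δ → ∀ {h l a} → (∀ {x} → x ∈* Γ → Any (Same Γ x) l ⊎ x ∈* Δ)
           → Walk h l a → escapes h → Loop
    search k Δ le inner {h} {l} cover W es with Any.any? (same? Γ (β h)) l
    ... | yes any with cut (β h) W any
    ...   | l' , a' , W' , s , first , _ = record { walk = W' ; closing = s ; first = first ; escape = es }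
    search k Δ le inner {h} {l} cover W es | no none
      with cover (closed (walk-∈ W (newest W))) | cross-escape Γ linear open' (closed (walk-∈ W (newest W)))
    ... | inj₁ any | _ = ⊥-elim (none any)
    ... | inj₂ u∈Δ | w , cr , es' with extract Δ u∈Δ
    ...   | t , Δ' , p , u∈t with k | ≤-trans (≤-reflexive (sym (↭-length p))) le | All-resp-↭ p inner
    ...     | suc k' | s≤s le' | it ∷ inner' = search k' Δ' le' inner' cover'
                (step W cr (All.tabulate (λ q s → none (Any.map (λ { refl → Same-trans Γ linear
                    (Crosses⇒Same Γ cr) s }) q)))) es'
      where
      cover' : ∀ {x} → x ∈* Γ → Any (Same Γ x) (w ∷ l) ⊎ x ∈* Δ'
      cover' x∈ with cover x∈
      ... | inj₁ any = inj₁ (there any)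
      ... | inj₂ x∈Δ with ∈*-↭ p x∈Δ
      ...   | inj₁ x∈t  = inj₁ (here (Same-trans Γ linear (it x∈t u∈t) (Crosses⇒Same Γ cr)))
      ...   | inj₂ x∈Δ' = inj₂ x∈Δ'

    inner-all : ∀ Δ → (∀ {x y} → Same Δ x y → Same Γ x y) → All Inner Δ
    inner-all []      f = []
    inner-all (t ∷ Δ) f = (λ x y → f (inj₁ (x , y))) ∷ inner-all Δ (λ s → f (inj₂ s))

    loop : ∀ {u} → u ∈* Γ → Loop
    loop u∈ with cross-escape Γ linear open' u∈
    ... | w , cr , es = search (length Γ) Γ ≤-refl (inner-all Γ (λ s → s)) inj₂
                          (stop (Same⇒∈ Γ (Same-sym Γ (Crosses⇒Same Γ cr)))) es

  -- A tensor counts by itself, so that splitting decreases the size even when one of its sides is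
  -- empty.
  size : Tree V → ℕ
  size* : List (Tree V) → ℕ
  size (leaf _)  = 1
  size (ten H K) = suc (size* H + size* K)
  size* []      = 0
  size* (t ∷ Γ) = size t + size* Γ

  size-++ : ∀ Γ Δ → size* (Γ ++ Δ) ≡ size* Γ + size* Δ
  size-++ []      Δ = refl
  size-++ (t ∷ Γ) Δ = trans (cong (size t +_) (size-++ Γ Δ)) (sym (+-assoc (size t) _ _))

  size-↭ : ∀ {Γ Δ} → Γ ↭ Δ → size* Γ ≡ size* Δ
  size-↭ ↭.refl = refl
  size-↭ (↭.prep t p) = cong (size t +_) (size-↭ p)
  size-↭ {t ∷ u ∷ Γ} {_ ∷ _ ∷ Δ} (↭.swap _ _ p) = trans (cong (λ s → size t + (size u + s)) (size-↭ p))
    (solve 3 (λ a b c → a :+ (b :+ c) := b :+ (a :+ c)) refl (size t) (size u) (size* Δ))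
    where open +-*-Solver
  size-↭ (↭.trans p q) = trans (size-↭ p) (size-↭ q)

  size-merge : ∀ H K N Y → size* (ten (N ++ H) K ∷ Y) ≡ size* (ten H K ∷ N ++ Y)
  size-merge H K N Y rewrite size-++ N H | size-++ N Y =
    cong suc (solve 4 (λ h k n y → ((n :+ h) :+ k) :+ y := (h :+ k) :+ (n :+ y)) refl (size* H) (size* K) (size* N)
        (size* Y))
    where open +-*-Solver

  size-split₁ : ∀ H K Γ → size* H < size* (ten H K ∷ Γ)
  size-split₁ H K Γ = s≤s (≤-trans (m≤m+n _ _) (m≤m+n _ _))

  size-split₂ : ∀ H K Γ → size* (K ++ Γ) < size* (ten H K ∷ Γ)
  size-split₂ H K Γ rewrite size-++ K Γ = s≤s (+-monoˡ-≤ (size* Γ) (m≤n+m (size* K) (size* H)))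

  arc-map : ∀ {Γ Δ H N x} → (∀ {x y} → Same Δ x y → Same Γ x y) → (∀ {x y} → Crosses Γ x y → Crosses Δ x y)
          → Arc Γ H N x → Arc Δ H N x
  arc-map back cross A = record
    { E = E ; c = c ; h = h ; v = v ; h∈H = h∈H ; h∈E = h∈E ; v∈E = v∈E ; v×n = cross v×n
    ; closed = closed ; anti = anti ; inside = inside ; ends = ends
    ; at-h = λ z s → at-h z (back s) ; at-v = λ z s → at-v z (back s)
    ; inner = λ x a b → let open Matched (inner x a b) in
        matched partner∈ (cross edge) bicolour (λ z (s , ne) → unique z (back s , ne)) }
    where open Arc A

  size-pos : ∀ t → 1 ≤ size t
  size-pos (leaf _)  = s≤s z≤n
  size-pos (ten _ _) = s≤s z≤n

  Same-++ˡ : ∀ Γ {Δ x y} → Same Γ x y → Same (Γ ++ Δ) x y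
  Same-++ˡ (t ∷ Γ) (inj₁ p) = inj₁ p
  Same-++ˡ (t ∷ Γ) (inj₂ p) = inj₂ (Same-++ˡ Γ p)

  -- One round of the lexicographic induction on size and number of trees. A leaf, or a tensor with
  -- a β-closed side, is treated at once; without these, links leave both sides of every tensor, and
  -- a loop exists.
  reduce : ∀ a b → (∀ Γ → size* Γ ≤ a → Valid Γ → Derivable Γ)
         → (∀ Γ → size* Γ ≤ suc a → length Γ ≤ b → Valid Γ → Derivable Γ)
         → ∀ t₀ Γ₀ → size* (t₀ ∷ Γ₀) ≤ suc a → length (t₀ ∷ Γ₀) ≤ suc b → Valid (t₀ ∷ Γ₀) → Derivable (t₀ ∷ Γ₀)
  reduce a b smaller shorter t₀ Γ₀ le len valid with find (t₀ ∷ Γ₀)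
  ... | inj₂ (_ , Γ' , p , closedˡ {H} {K} cH) = perm (↭-sym p) (split
          (smaller H (below (size-split₁ H K Γ')) (valid-split₁ v cH))
          (smaller (K ++ Γ') (below (size-split₂ H K Γ')) (valid-split₂ v cH)))
    where
    v = valid-↭ p valid
    below : ∀ {m} → m < size* (ten H K ∷ Γ') → m ≤ a
    below m< = ≤-pred (≤-trans m< (≤-trans (≤-reflexive (sym (size-↭ p))) le))
  ... | inj₂ (_ , Γ' , p , closedʳ {H} {K} cK) = perm (↭-sym p) (flip (split
          (smaller K (below (size-split₁ K H Γ')) (valid-split₁ v cK))
          (smaller (H ++ Γ') (below (size-split₂ K H Γ')) (valid-split₂ v cK))))
    where
    v = valid-flip (valid-↭ p valid)
    below : ∀ {m} → m < size* (ten K H ∷ Γ') → m ≤ a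
    below m< = ≤-pred (≤-trans m< (≤-trans (≤-reflexive (trans (cong (λ s → suc s + size* Γ') (+-comm (size* K)
        (size* H))) (sym (size-↭ p)))) le))
  ... | inj₂ (_ , Γ' , p , is-leaf {x}) with Valid.closed (valid-↭ p valid) {x} (inj₁ refl)
  ...   | inj₁ eq = ⊥-elim (β-fixfree eq)
  ...   | inj₂ βx∈ with extract Γ' βx∈
  ...     | leaf y , Γ″ , q , eq = perm (↭-sym r) (ax lab-eq
              (smaller Γ″ (≤-pred (≤-trans (s≤s (n≤1+n _)) (≤-trans (≤-reflexive (sym (size-↭ r))) le)))
                 (valid-axiom eq (valid-↭ r valid))))
    where
    r : t₀ ∷ Γ₀ ↭ leaf x ∷ leaf y ∷ Γ″
    r = ↭-trans p (↭.prep _ q)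
    lab-eq : label x ≡ dual (label y)
    lab-eq = trans (cong label (sym (β-invol x))) (trans (β-dual (β x)) (cong (dual ∘ label) eq))
  ...     | ten H K , Γ″ , q , side = perm (↭-sym r) ([ absorb H K v len' , (λ k → flip (absorb K H
      (valid-flip v) len″ k)) ]′ side)
    where
    r : t₀ ∷ Γ₀ ↭ ten H K ∷ leaf x ∷ Γ″
    r = ↭-trans p (↭-trans (↭.prep _ q) (↭.swap _ _ ↭-refl))
    v = valid-↭ r valid
    len' : size* (ten H K ∷ leaf x ∷ Γ″) ≤ suc a
    len' = ≤-trans (≤-reflexive (sym (size-↭ r))) le
    len″ : size* (ten K H ∷ leaf x ∷ Γ″) ≤ suc a
    len″ = ≤-trans (≤-reflexive (cong (λ s → suc s + suc (size* Γ″)) (+-comm (size* K) (size* H)))) len'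
    absorb : ∀ H K → Valid (ten H K ∷ leaf x ∷ Γ″) → size* (ten H K ∷ leaf x ∷ Γ″) ≤ suc a → β x ∈* H
           → Derivable (ten H K ∷ leaf x ∷ Γ″)
    -- No arc has to be constructed: the only vertex to be merged is `x`, and its link already leads
    -- into `H`.
    absorb H K v le' βx∈H = merge (leaf x ∷ []) (shorter _
      (≤-trans (≤-reflexive (size-merge H K (leaf x ∷ []) Γ″)) le')
      (≤-pred (≤-trans (≤-reflexive (sym (↭-length r))) len))
      (Merge.merge-valid {N = leaf x ∷ []} v (λ { (inj₁ refl) _ βx∉H → ⊥-elim (βx∉H βx∈H) ; (inj₂ ()) })))
  reduce a b smaller shorter t₀ Γ₀ le len valid | inj₁ open' = contract
    where
    Γ = t₀ ∷ Γ₀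
    open Valid valid using (linear; closed; good)
    open Walks Γ linear closed
    start : All Open Γ → Σ[ u ∈ V ] u ∈* Γ
    start (opened (u , u∈ , _) _ ∷ _) = u , inj₁ (inj₁ u∈)
    open Loop (Search.loop Γ linear closed open' (proj₂ (start open'))) renaming (a to w₀)

    not-crossing : ¬ Crosses Γ (β h) w₀
    not-crossing cr = good (closed-walk-bad walk first cr)

    -- A loop within one tree would, since its link escapes, cross the root and be a bad set by
    -- itself.
    h≢w₀ : ¬ (h ≡ w₀)
    h≢w₀ eq = not-crossing (subst (Crosses Γ (β h)) eq (escape (subst (Same Γ (β h)) (sym eq) closing)))

    -- The loop was found in `Γ`, but the side to contract into may be the right one. Only the
    -- relations `Same` and `Crosses` matter, so the statement allows a permuted and flipped copy of
    -- `Γ`.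
    contract-into : ∀ H K Γ' → (∀ {x y} → Same Γ x y → Same (ten H K ∷ Γ') x y)
                  → (∀ {x y} → Same (ten H K ∷ Γ') x y → Same Γ x y)
                  → (∀ {x y} → Crosses Γ x y → Crosses (ten H K ∷ Γ') x y)
                  → size* (ten H K ∷ Γ') ≤ suc a → length (ten H K ∷ Γ') ≤ suc b → Valid (ten H K ∷ Γ')
                  → w₀ ∈* H → β h ∈* H → Derivable (ten H K ∷ Γ')
    contract-into H K Γ' there' back cross le' len' v w₀∈H βh∈H
      with sift (λ t → Any.any? (λ q → (q ∈ᵗ? t) ×-dec ¬? (q ≟ w₀)) l) Γ'
    ... | N , Y , s , inN , inY = perm (↭-sym r) (merge N
          (shorter _ (≤-trans (≤-reflexive (trans (size-merge H K N Y) (sym (size-↭ r)))) le')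
            (≤-pred (≤-trans (s≤s fewer) (≤-trans (≤-reflexive (sym (↭-length r))) len')))
            (Merge.merge-valid (valid-↭ r v)
              (λ x∈N _ _ → arc-map (λ s → back (Same-↭ (↭-sym r) s)) (λ c → Crosses-↭ r (cross c))
                             (Blossom.arc walk first H N w₀∈H βh∈H closing toN fromN x∈N)))))
      where
      r : ten H K ∷ Γ' ↭ ten H K ∷ N ++ Y
      r = ↭.prep _ s
      visited-Y : ∀ Y → All (λ t → ¬ Any (λ q → q ∈ᵗ t × ¬ (q ≡ w₀)) l) Y → ∀ {q} → q ∈ˡ l → ¬ (q ≡ w₀) → ¬ (q ∈* Y)
      visited-Y (t ∷ Y) (no-t ∷ _) q∈l ne (inj₁ q∈t) = no-t (Any.map (λ { refl → q∈t , ne }) q∈l)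
      visited-Y (t ∷ Y) (_ ∷ nos) q∈l ne (inj₂ q∈Y) = visited-Y Y nos q∈l ne q∈Y
      visited-N : ∀ N → All (λ t → Any (λ q → q ∈ᵗ t × ¬ (q ≡ w₀)) l) N → ∀ {x} → x ∈* N
                → Σ[ q ∈ V ] (q ∈ˡ l × ¬ (q ≡ w₀) × Same N x q)
      visited-N (t ∷ N) (yes-t ∷ _) (inj₁ x∈t) with find-any yes-t
        where
        find-any : ∀ {l} → Any (λ q → q ∈ᵗ t × ¬ (q ≡ w₀)) l → Σ[ q ∈ V ] (q ∈ˡ l × q ∈ᵗ t × ¬ (q ≡ w₀))
        find-any (here (q , ne)) = _ , here refl , q , ne
        find-any (there k) = let q , q∈ , rest = find-any k in q , there q∈ , rest
      ... | q , q∈l , q∈t , ne = q , q∈l , ne , inj₁ (x∈t , q∈t)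
      visited-N (t ∷ N) (_ ∷ ys) (inj₂ x∈N) = let q , q∈l , ne , sm = visited-N N ys x∈N in q , q∈l , ne , inj₂ sm
      toN : ∀ {q x} → q ∈ˡ l → ¬ (q ≡ w₀) → Same Γ x q → x ∈* N
      toN q∈l ne sm with Same-↭ r (there' sm)
      ... | inj₁ (_ , q∈t) = ⊥-elim (ne (distinct walk q∈l (oldest walk) (back (Same-↭ (↭-sym r) (inj₁ (q∈t
          , inj₁ w₀∈H))))))
      ... | inj₂ sm' with Same-++ N sm'
      ...   | inj₁ inside = Same⇒∈ N inside
      ...   | inj₂ outside = ⊥-elim (visited-Y Y inY q∈l ne (Same⇒∈ Y (Same-sym Y outside)))
      fromN : ∀ {x} → x ∈* N → Σ[ q ∈ V ] (q ∈ˡ l × ¬ (q ≡ w₀) × Same Γ x q)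
      fromN x∈N = let q , q∈l , ne , sm = visited-N N inN x∈N in q , q∈l , ne , back (Same-↭ (↭-sym r) (inj₂ (Same-++ˡ N sm)))
      nonempty : ∀ N {x} → x ∈* N → suc (length Y) ≤ length (N ++ Y)
      nonempty (t ∷ N) _ = s≤s (≤-trans (m≤n+m _ _) (≤-reflexive (sym (length-++ N))))
      fewer : suc (length Y) ≤ length (N ++ Y)
      -- The tree of `h` is visited and is not that of `w₀`, so at least one tree is merged and the
      -- list gets shorter.
      fewer = nonempty N (toN (newest walk) h≢w₀ (Same-refl Γ (walk-∈ walk (newest walk))))

    contract : Derivable Γ
    contract with extract Γ (Same⇒∈ Γ (Same-sym Γ closing))
    ... | t , Γ' , p , w₀∈t with All-resp-↭ p open' | Same-↭ p closing
    ...   | _ | inj₂ sm = ⊥-elim (proj₂ (proj₂ (linear-↭ p linear)) w₀∈t (Same⇒∈ Γ' (Same-sym Γ' sm)))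
    ...   | opened {H} {K} _ _ ∷ _ | inj₁ (βh∈t , _) with w₀∈t | βh∈t
    ...     | inj₁ w | inj₁ z = perm (↭-sym p) (contract-into H K Γ' (Same-↭ p) (Same-↭ (↭-sym p)) (Crosses-↭ p)
                (≤-trans (≤-reflexive (sym (size-↭ p))) le) (≤-trans (≤-reflexive (sym (↭-length p))) len)
                    (valid-↭ p valid) w z)
    ...     | inj₁ w | inj₂ z = ⊥-elim (not-crossing (Crosses-↭ (↭-sym p) (inj₁ (inj₂ (z , w)))))
    ...     | inj₂ w | inj₁ z = ⊥-elim (not-crossing (Crosses-↭ (↭-sym p) (inj₁ (inj₁ (z , w)))))
    ...     | inj₂ w | inj₂ z = perm (↭-sym p) (flip (contract-into K H Γ'
                (λ s → same-flip (Same-↭ p s)) (λ s → Same-↭ (↭-sym p) (same-flip s)) (λ c → cross-flip (Crosses-↭ p c))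
                (≤-trans (≤-reflexive (trans (cong (λ s → suc s + size* Γ') (+-comm (size* K) (size* H)))
                    (sym (size-↭ p)))) le)
                (≤-trans (≤-reflexive (sym (↭-length p))) len) (valid-flip (valid-↭ p valid)) w z))
      where
      same-flip : ∀ {H K x y} → Same (ten H K ∷ Γ') x y → Same (ten K H ∷ Γ') x y
      same-flip (inj₁ (p , q)) = inj₁ (⊎-swap p , ⊎-swap q)
      same-flip (inj₂ s) = inj₂ s
      cross-flip : ∀ {H K x y} → Crosses (ten H K ∷ Γ') x y → Crosses (ten K H ∷ Γ') x y
      cross-flip (inj₁ c) = inj₁ (⊎-swap c)
      cross-flip (inj₂ c) = inj₂ c

  derivable : ∀ a b Γ → size* Γ ≤ a → length Γ ≤ b → Valid Γ → Derivable Γ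
  derivable a b [] _ _ _ = nil
  derivable zero b (t ∷ Γ) le _ _ = case ≤-trans (size-pos t) (≤-trans (m≤m+n _ _) le) of λ ()
  derivable (suc a) zero (t ∷ Γ) _ () _
  derivable (suc a) (suc b) (t ∷ Γ) =
    reduce a b (λ Δ le → derivable a (length Δ) Δ le ≤-refl) (derivable (suc a) b) t Γ

-- From the invariant of a cograph to its derivation

module _ {n : ℕ} {G : LGraph (Fin n)} (L : Linked G) (cograph : ¬ InducedP4 G) where

  private
    e = adj G

  open Linked L
  open Matching (lab G) β β-invol β-dual
  open Leaves {Fin n}
  open Realisation G

  IsEdge : Fin n → Fin n → Set
  IsEdge x y = e x y ≡ true

  IsEdge-sym : ∀ {x y} → IsEdge x y → IsEdge y x
  IsEdge-sym p = trans (adjSym G _ _) p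

  -- Each matching edge is a conjunction with a zero end, hence refuted. As the matching is induced,
  -- such an edge has no neighbours in the rest, so `par` adds the edges one at a time.
  regular-refuted : ∀ l {D c} → (∀ {x} → x ∈ D → x ∈ˡ l) → Inhabited D → (∀ {x} → x ∈ D → Matched IsEdge IsEdge D c x)
                  → Refuted e (λ x → c x ≡ false) D
  regular-refuted [] sub (x , x∈D) _ = case sub x∈D of λ ()
  regular-refuted (x ∷ l) {D} {c} sub inh reg with ∈-dec D x
  ... | inj₂ x∉D = regular-refuted l (λ z → case sub z of λ { (here refl) → ⊥-elim (x∉D z) ; (there k) → k }) inh reg
  ... | inj₁ x∈D = finish (searchable-Fin n rest)
    where
    open Matched (reg x∈D) using () renaming
        (partner to y; partner∈ to y∈D; edge to x-y; bicolour to x-y-bicolour; unique to x-only)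
    y-only : ∀ {z} → z ∈ D → IsEdge y z → z ≡ x
    y-only z∈D y-z = trans (Matched.unique (reg y∈D) z∈D y-z) (sym (Matched.unique (reg y∈D) x∈D (IsEdge-sym x-y)))
    Ends : Fin n → Set
    Ends z = z ≡ x ⊎ z ≡ y
    ends? : ∀ z → Dec (Ends z)
    ends? z = (z ≟ x) ⊎-dec (z ≟ y)
    pair rest : Subset (Fin n)
    pair = decided ends?
    rest = D ∩ decided (λ z → ¬? (ends? z))
    R : Subset (Fin n) → Set
    R = Refuted e (λ x → c x ≡ false)
    x≢y : ¬ (x ≡ y)
    x≢y eq = case trans (sym x-y) (trans (cong (e x) (sym eq)) (adjIrr G x)) of λ ()
    ordered : ∀ u v → ¬ (u ≡ v) → (∀ {z} → z ∈ pair → z ≡ u ⊎ z ≡ v) → u ∈ pair → v ∈ pair → IsEdge u v → c v ≡ false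
        → R pair
    ordered u v ne only u∈ v∈ u-v zero' = ten (decided (_≟ u)) (decided (_≟ v))
      (mkSplit (λ z → subst (_∈ pair) (sym (decided∈ z)) u∈) (λ z → subst (_∈ pair) (sym (decided∈ z)) v∈)
               (λ z → [ (λ q → inj₁ (∈decided q)) , (λ q → inj₂ (∈decided q)) ]′ (only z))
               (λ a b → ne (trans (sym (decided∈ a)) (decided∈ b))))
      (λ a b → trans (cong₂ e (decided∈ a) (decided∈ b)) u-v)
      (atom v (∈decided refl) (λ z → decided∈ z) zero')
    pair-refuted : R pair
    pair-refuted with c x in eq
    ... | false = ordered y x (x≢y ∘ sym) (λ z → ⊎-swap (decided∈ z)) (∈decided (inj₂ refl)) (∈decided (inj₁ refl))
        (IsEdge-sym x-y) eq
    ... | true  = ordered x y x≢y (λ z → decided∈ z) (∈decided (inj₁ refl)) (∈decided (inj₂ refl)) x-y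
        (trans x-y-bicolour (cong not eq))
    pair⊆D : pair ⊆ D
    pair⊆D z = [ (λ q → subst (_∈ D) (sym q) x∈D) , (λ q → subst (_∈ D) (sym q) y∈D) ]′ (decided∈ z)
    cover-D : ∀ {z} → z ∈ D → z ∈ pair ⊎ z ∈ rest
    cover-D {z} z∈D with ends? z
    ... | yes q = inj₁ (∈decided q)
    ... | no q  = inj₂ (∈∩ z∈D (∈decided q))
    not-ends : ∀ {z} → z ∈ rest → ¬ Ends z
    not-ends z = decided∈ (∩ʳ z)
    isolated : ∀ {u z} → u ∈ pair → z ∈ rest → e u z ≡ false
    isolated {u} {z} u∈ z∈ with e u z in eq | decided∈ u∈
    ... | false | _ = refl
    ... | true | inj₁ q = ⊥-elim (not-ends z∈ (inj₂ (x-only (∩ˡ z∈) (subst (λ u → IsEdge u z) q eq))))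
    ... | true | inj₂ q = ⊥-elim (not-ends z∈ (inj₁ (y-only (∩ˡ z∈) (subst (λ u → IsEdge u z) q eq))))
    reg' : ∀ {z} → z ∈ rest → Matched IsEdge IsEdge rest c z
    reg' {z} z∈ = let open Matched (reg (∩ˡ z∈)) in matched
      ([ (λ w → case trans (sym (IsEdge-sym edge)) (isolated w z∈) of λ ()) , (λ w → w) ]′ (cover-D partner∈))
      edge bicolour (λ w∈ → unique (∩ˡ w∈))
    finish : Inhabited rest ⊎ Empty rest → R D
    finish (inj₂ e∅) = refuted-cong pair⊆D (λ z → [ (λ p → p) , (λ r → ⊥-elim (e∅ r)) ]′ (cover-D z)) pair-refuted
    finish (inj₁ inh') = par pair rest (mkSplit pair⊆D ∩ˡ cover-D (λ p r → not-ends r (decided∈ p)))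
      (λ u u' z → trans (isolated u z) (sym (isolated u' z))) pair-refuted
      (regular-refuted l (λ z → case sub (∩ˡ z) of λ { (here refl) → ⊥-elim (not-ends z (inj₁ refl)) ; (there k)
          → k }) inh' reg')

  open CotreeOf (cotree cograph (length (allFin n)) (allFin n) ≤-refl (allFin⁺ n))

  everywhere : ∀ x → x ∈* trees
  everywhere x = every (∈-allFin x)

  edge⇒ : ∀ {x y} → Edge trees x y → IsEdge x y
  edge⇒ ed with Edge⇒adj trees ed
  ... | p , q , refl , refl , a = trans (sym (realises p q)) a

  ⇒edge : ∀ {x y} → IsEdge x y → Edge trees x y
  ⇒edge {x} {y} ed with pos* trees (everywhere x) | pos* trees (everywhere y)
  ... | p , refl | q , refl = adj⇒Edge trees p q (trans (realises p q) ed)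

  cotree-valid : Valid trees
  cotree-valid = record { linear = linear ; closed = λ _ → everywhere _ ; good = λ b → let open Bad b in
    irrefutable D c closed anti (regular-refuted (allFin n) (λ _ → ∈-allFin _) inhabited
      (λ x → let open Matched (regular x) in matched partner∈ (edge⇒ edge) bicolour (λ z ed → unique z (⇒edge ed)))) }

  linked⇒provable : Provable AiSw (n , G)
  linked⇒provable = Semantics.sound (lab G)
    (Sequentialisation.derivable (lab G) β β-invol β-dual _ _ trees ≤-refl ≤-refl cotree-valid)
    G (graph*≅ {trees} realises linear everywhere)

theorem8p6 : (A : Graph) → Cograph A → (Provable GSssUp A ⇔ Provable AiSw A)
theorem8p6 A cograph = mk⇔ (λ p → linked⇒provable (provable⇒linked A p) cograph) AiSw⇒GSssUp
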